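{- Let $p$ be an odd prime and $d\in\mathbb{F}_p$, $d\neq 0,1$, such that $\sum_{j=0}^{\frac{p-1}{2}}\left(C_{\frac{p-1}{2}}^{j}\right)^2 d^j \equiv 0 \pmod p$. Let $n\ge 1$. If $n$ is odd, then $\overline{N}_{d[p^n]} = p^n+1$ and $N_{d[p^n]} = p^n-1-2\left(\frac{d}{p}\right)$. If $n$ is even, then $N_{d[p^n]} = p^n-3-2(-p)^{n/2}$ and $\overline{N}_{d[p^n]} = p^n+1-2(-p)^{n/2}$.
   Context: $E_d$ is the Edwards curve $x^2+y^2=1+dx^2y^2$. $N_{d[p^n]}$ is the number of affine solutions $(x,y)\in\mathbb{F}_{p^n}^2$ of this equation. $\overline{N}_{d[p^n]}$ is the number of points over $\mathbb{F}_{p^n}$ of the projective curve completed by its points at infinity, i.e. of the nonsingular projective model of $E_d$ (equivalently, of the elliptic curve $v^2=(d-1)u^3+2(d+1)u^2+(d-1)u$ including its point at infinity). $C_n^j=\binom{n}{j}$ and $\left(\frac{d}{p}\right)$ is the Legendre symbol. -}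

module Defs where

open import Level using (0ℓ)
open import Data.Nat using (ℕ; zero; suc; _∸_; _/_; _%_)
import Data.Nat as N
open import Data.Nat.Combinatorics using (_C_)
open import Data.Integer using (ℤ; +_; -[1+_])
open import Data.Fin using (Fin)
import Data.Fin as F
open import Data.List using (List; map; allFin; upTo)
open import Data.Nat.ListAction using (sum)
open import Data.List.Relation.Unary.Any using (any?)
open import Data.Bool using (if_then_else_)
open import Data.Product using (∃)
open import Relation.Nullary using (¬_; Dec; yes; no; does)
open import Relation.Binary.PropositionalEquality using (_≡_; refl; cong; trans; sym)
open import Algebra.Core using (Op₁; Op₂)
open import Algebra.Structures using (IsCommutativeRing)
open import Function.Bundles using (_↔_; Inverse)

record FiniteField (q : ℕ) : Set₁ where
  infixl 7 _*_
  infixl 6 _+_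
  field
    Carrier    : Set
    _+_        : Op₂ Carrier
    _*_        : Op₂ Carrier
    -_         : Op₁ Carrier
    0#         : Carrier
    1#         : Carrier
    isCommutativeRing : IsCommutativeRing _≡_ _+_ _*_ -_ 0# 1#
    0≢1        : ¬ (0# ≡ 1#)
    inverse    : ∀ x → ¬ (x ≡ 0#) → ∃ λ y → x * y ≡ 1#
    enum       : Fin q ↔ Carrier

  elt : Fin q → Carrier
  elt = Inverse.to enum

  index : Carrier → Fin q
  index = Inverse.from enum

  _≟_ : (x y : Carrier) → Dec (x ≡ y)
  x ≟ y with index x F.≟ index y
  ... | yes e = yes (trans (sym (Inverse.inverseˡ enum refl))
                      (trans (cong elt e) (Inverse.inverseˡ enum refl)))
  ... | no ne = no (λ e → ne (cong index e))

  ι : ℕ → Carrier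
  ι zero    = 0#
  ι (suc k) = 1# + ι k

  sq : Carrier → Carrier
  sq x = x * x


countSolutions : ∀ {q} (K : FiniteField q) →
                 (FiniteField.Carrier K → FiniteField.Carrier K → FiniteField.Carrier K) →
                 (FiniteField.Carrier K → FiniteField.Carrier K → FiniteField.Carrier K) → ℕ
countSolutions {q} K lhs rhs =
  sum (map (λ i → sum (map (λ j →
        if does (lhs (elt i) (elt j) ≟ rhs (elt i) (elt j)) then 1 else 0)
        (allFin q))) (allFin q))
  where open FiniteField K

edwardsAffineCount : ∀ {q} (K : FiniteField q) → ℕ → ℕ
edwardsAffineCount K d =
  countSolutions K (λ x y → sq x + sq y) (λ x y → 1# + ι d * sq x * sq y)
  where open FiniteField K

-- N̄_{d[q]} : points of the nonsingular projective model, i.e. of the elliptic curve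
-- v² = (d-1)u³ + 2(d+1)u² + (d-1)u together with its point at infinity.
-- (d - 1 is written ι d + (- 1#), so it is the field difference.)
edwardsProjectiveCount : ∀ {q} (K : FiniteField q) → ℕ → ℕ
edwardsProjectiveCount K d =
  suc (countSolutions K (λ u v → sq v)
         (λ u v → (ι d + - 1#) * u * u * u + ι 2 * (ι d + 1#) * u * u + (ι d + - 1#) * u))
  where open FiniteField K

legendre : ℕ → ℕ → ℤ
legendre zero    d = + 0
legendre (suc m) d with d % suc m N.≟ 0
... | yes _ = + 0
... | no  _ with any? (λ x → (x N.* x) % suc m N.≟ d % suc m) (upTo (suc m))
...   | yes _ = + 1
...   | no  _ = -[1+ 0 ]

hasseSum : ℕ → ℕ → ℕ
hasseSum m d = sum (map (λ j → (m C j) N.* (m C j) N.* (d N.^ j)) (upTo (suc m)))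

{-# OPTIONS --safe #-}
-- The Edwards curve and its elliptic model both reduce to the character sum
-- S = ∑ χ((0 - u)(-1 - u)(-d - u)) over K = 𝔽_(p^n). For a monic polynomial g over 𝔽_p put
-- X(g) = χ(g(0) g(-1) g(-d)), and let c_r = ∑ X(g) over deg g = r. Then c₂ = p is a Jacobi sum,
-- c_r = 0 for r ≥ 3 by interpolation at 0, -1, -d, and c₁ ≡ 0 modulo p by the hypothesis on the
-- Hasse sum, whence c₁ = 0 since |c₁| < p. So ∑ c_r T^r = 1 + p T², and the logarithmic derivative
-- of its Euler product over the irreducible polynomials yields S as its n-th coefficient, because
-- the Frobenius orbits in K are the irreducible polynomials of degree dividing n.

module Submission where

open import Data.Nat using (ℕ; zero; suc; s≤s; z≤n)
import Data.Integer as Z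
import Data.Integer.Properties as ZP
import Data.Nat as N
import Data.Nat.Properties as NP
open import Data.Bool using (true; false; if_then_else_)
open import Data.List using (List; []; _∷_; map; _++_; length; cartesianProductWith; upTo; allFin; replicate)
import Data.List.Properties as LP
open import Data.List.Membership.Propositional using (_∈_; lose; find)
open import Data.List.Relation.Unary.Any using (here; there; any?; satisfied)
open import Data.List.Relation.Unary.All as All using (All; []; _∷_)
open import Data.List.Relation.Unary.AllPairs as AllPairs using ([]; _∷_)
open import Data.List.Relation.Unary.Unique.Propositional using (Unique)
open import Data.Product using (_×_; _,_; ∃; proj₁; proj₂)
open import Data.Sum using (_⊎_; inj₁; inj₂; [_,_]′)
open import Data.Empty using (⊥-elim)
open import Relation.Nullary using (¬_; Dec; yes; no; does)
open import Relation.Binary.PropositionalEquality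
open import Relation.Binary.Definitions using (DecidableEquality; tri<; tri≈; tri>)
open import Algebra.Core using (Op₂)
open import Algebra.Structures using (IsCommutativeMonoid; IsCommutativeRing)
open import Function using (_∘_)
open import Defs
open import Data.Integer using (ℤ; -[1+_]) renaming (+_ to #_)
import Data.Sign as Sign
open import Data.Fin using (Fin; toℕ; fromℕ<)
open import Data.Maybe using (Maybe; just; nothing)
open import Data.List.Membership.Propositional.Properties using (∈-map⁺; ∈-allFin; ∈-upTo⁺; ∈-upTo⁻; ∈-cartesianProductWith⁺; ∈-cartesianProductWith⁻; ∈-++⁺ˡ; ∈-++⁺ʳ; ∈-++⁻)
import Data.List.Relation.Unary.Unique.Propositional.Properties as UP
open import Algebra.Bundles using (CommutativeRing; RawRing)
open import Function.Bundles using (Inverse)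
open import Level using (0ℓ)
import Relation.Nullary.Decidable as Dec
import Data.Integer.Solver
open import Data.Nat.Primality using (Prime; euclidsLemma; prime⇒nonTrivial; prime⇒nonZero; prime⇒irreducible)
open import Data.Nat.Divisibility using (_∣_; ∣⇒≤; divides; m∣m*n; _∣?_)
open import Data.Nat.Combinatorics using (_C_; nCn≡1; nCk+nC[k+1]≡[n+1]C[k+1])
open import Data.Nat.Combinatorics.Specification using (k>n⇒nCk≡0)
import Data.Fin as Fin
open import Data.Nat.DivMod using (_/_; _%_; m≡m%n+[m/n]*n; m%n<n; m*n/n≡m)
import Data.Product.Properties as ×P
import Data.Nat.Solver
open import Data.Nat.Coprimality using (Coprime; coprime-Bézout)
open import Data.Nat.GCD using (module Bézout)
open import Data.Nat.ListAction using (sum)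
open import Relation.Nullary.Decidable using (¬?; _×-dec_)
import Data.Fin.Properties as FinP
import Algebra.Morphism.RingMonomorphism as RingMonomorphism
open import Function.Construct.Identity using (↔-id)

-- The sum over `K` and the polynomials over the prime field `F` are linked by norms. If `u` has
-- minimal polynomial `g` of degree `e` and `n = j * e`, then `g` at `c` is the norm of `c - u` from
-- `F(u)`. As `(p^n - 1)/2 = (p - 1)/2 * (1 + p + ... + p^(n-1))`, Euler's criterion makes the
-- character of `K` at the cubic in `u` equal to the `j`-th power of `X g`. That every irreducible
-- polynomial of degree dividing `n` does occur is obtained not from splitting fields but by
-- comparing totals: an irreducible has at most as many roots in `K` as its degree, and the
-- logarithmic derivative for the trivial `X = 1` shows that these degrees add up to `p^n`, the size
-- of `K`. The inverse roots of `1 + p T^2` are the two square roots of `-p`; their odd power sums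
-- vanish, which is the source of the two cases. Of the `-2χ(d)` in the affine count, one half comes
-- from the zeros of `1 - d x^2`, the other from the sum of `χ((1 - t)(1 - d t))`.

module ZS = Data.Integer.Solver.+-*-Solver
open ZS using () renaming (_:+_ to _⊕_; _:*_ to _⊗_; _:-_ to _⊖_; :-_ to ⊝_; _:=_ to _⊜_)

-- Finite sums

module ListSum {A : Set} (_∙_ : Op₂ A) (ε : A)
  (isCM : IsCommutativeMonoid _≡_ _∙_ ε) where

  open IsCommutativeMonoid isCM using (assoc; comm; identityˡ; identityʳ)
  open ≡-Reasoning

  ∑ : {B : Set} → List B → (B → A) → A
  ∑ []       f = ε
  ∑ (x ∷ xs) f = f x ∙ ∑ xs f

  private variable
    B B′ : Set

  ∑-cong∈ : (xs : List B) {f g : B → A} → (∀ x → x ∈ xs → f x ≡ g x) → ∑ xs f ≡ ∑ xs g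
  ∑-cong∈ []       e = refl
  ∑-cong∈ (x ∷ xs) e = cong₂ _∙_ (e x (here refl)) (∑-cong∈ xs (λ y m → e y (there m)))

  ∑-cong : (xs : List B) {f g : B → A} → (∀ x → f x ≡ g x) → ∑ xs f ≡ ∑ xs g
  ∑-cong xs e = ∑-cong∈ xs (λ x _ → e x)

  interchange : ∀ a b c d → (a ∙ b) ∙ (c ∙ d) ≡ (a ∙ c) ∙ (b ∙ d)
  interchange a b c d = begin
    (a ∙ b) ∙ (c ∙ d) ≡⟨ assoc a b _ ⟩
    a ∙ (b ∙ (c ∙ d)) ≡⟨ cong (a ∙_) (sym (assoc b c d)) ⟩
    a ∙ ((b ∙ c) ∙ d) ≡⟨ cong (λ t → a ∙ (t ∙ d)) (comm b c) ⟩
    a ∙ ((c ∙ b) ∙ d) ≡⟨ cong (a ∙_) (assoc c b d) ⟩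
    a ∙ (c ∙ (b ∙ d)) ≡⟨ sym (assoc a c _) ⟩
    (a ∙ c) ∙ (b ∙ d) ∎

  ∑-∙ : (xs : List B) (f g : B → A) → ∑ xs (λ x → f x ∙ g x) ≡ ∑ xs f ∙ ∑ xs g
  ∑-∙ []       f g = sym (identityˡ ε)
  ∑-∙ (x ∷ xs) f g = trans (cong (_ ∙_) (∑-∙ xs f g)) (interchange _ _ _ _)

  ∑-ε : (xs : List B) {f : B → A} → (∀ x → x ∈ xs → f x ≡ ε) → ∑ xs f ≡ ε
  ∑-ε []       e = refl
  ∑-ε (x ∷ xs) e =
    trans (cong₂ _∙_ (e x (here refl)) (∑-ε xs (λ y m → e y (there m)))) (identityˡ ε)

  ∑-swap : (xs : List B) (ys : List B′) (f : B → B′ → A) →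
           ∑ xs (λ x → ∑ ys (f x)) ≡ ∑ ys (λ y → ∑ xs (λ x → f x y))
  ∑-swap []       ys f = sym (∑-ε ys (λ _ _ → refl))
  ∑-swap (x ∷ xs) ys f = trans (cong (_ ∙_) (∑-swap xs ys f)) (sym (∑-∙ ys _ _))

  ∑-map : (h : B → B′) (xs : List B) (f : B′ → A) → ∑ (map h xs) f ≡ ∑ xs (f ∘ h)
  ∑-map h []       f = refl
  ∑-map h (x ∷ xs) f = cong (_ ∙_) (∑-map h xs f)

  ∑-++ : (xs ys : List B) (f : B → A) → ∑ (xs ++ ys) f ≡ ∑ xs f ∙ ∑ ys f
  ∑-++ []       ys f = sym (identityˡ _)
  ∑-++ (x ∷ xs) ys f = trans (cong (_ ∙_) (∑-++ xs ys f)) (sym (assoc _ _ _))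

  ∑-cartesian : {D : Set} (h : B → B′ → D) (xs : List B) (ys : List B′) (f : D → A) →
                ∑ (cartesianProductWith h xs ys) f ≡ ∑ xs (λ x → ∑ ys (λ y → f (h x y)))
  ∑-cartesian h []       ys f = refl
  ∑-cartesian h (x ∷ xs) ys f =
    trans (∑-++ (map (h x) ys) _ f) (cong₂ _∙_ (∑-map (h x) ys f) (∑-cartesian h xs ys f))

  ∑-single : {xs : List B} {a : B} {f : B → A} → Unique xs → a ∈ xs →
             (∀ x → x ≢ a → f x ≡ ε) → ∑ xs f ≡ f a
  ∑-single {xs = x ∷ xs} (x∉ ∷ u) (here refl) e =
    trans (cong (_ ∙_) (∑-ε xs (λ y m → e y (λ { refl → All.lookup x∉ m refl })))) (identityʳ _)
  ∑-single {xs = x ∷ xs} {a} (x∉ ∷ u) (there m) e =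
    trans (cong₂ _∙_ (e x (λ { refl → All.lookup x∉ m refl })) (∑-single u m e)) (identityˡ _)

  [_]·_ : {P : Set} → Dec P → A → A
  [ d ]· a = if does d then a else ε

  []·-yes : {P : Set} (d : Dec P) {a : A} → P → [ d ]· a ≡ a
  []·-yes (yes _) _ = refl
  []·-yes (no ¬p) p = ⊥-elim (¬p p)

  []·-no : {P : Set} (d : Dec P) {a : A} → ¬ P → [ d ]· a ≡ ε
  []·-no (yes p) ¬p = ⊥-elim (¬p p)
  []·-no (no _)  _  = refl

  ∑-upTo-suc : ∀ n (f : ℕ → A) → ∑ (upTo (suc n)) f ≡ f 0 ∙ ∑ (upTo n) (f ∘ suc)
  ∑-upTo-suc n f = cong (f 0 ∙_) (trans (cong (λ l → ∑ l f) (sym (LP.map-upTo suc n))) (∑-map suc (upTo n) f))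

  ∑-upTo-last : ∀ n (f : ℕ → A) → ∑ (upTo (suc n)) f ≡ ∑ (upTo n) f ∙ f n
  ∑-upTo-last n f = trans (cong (λ l → ∑ l f) (sym (LP.upTo-∷ʳ n)))
    (trans (∑-++ (upTo n) (n ∷ []) f) (cong (∑ (upTo n) f ∙_) (identityʳ (f n))))

  -- Both sides are the sum over `upTo (suc n)`, split at its last and at its first term. It acts as
  -- a telescoping rule, for valuations and for the cyclic rotation of a Frobenius orbit.
  ∑-upTo-shift : ∀ n (f : ℕ → A) → ∑ (upTo n) f ∙ f n ≡ f 0 ∙ ∑ (upTo n) (f ∘ suc)
  ∑-upTo-shift n f = trans (sym (∑-upTo-last n f)) (∑-upTo-suc n f)

  ∑-upTo-+ : ∀ m n (f : ℕ → A) → ∑ (upTo (m N.+ n)) f ≡ ∑ (upTo m) f ∙ ∑ (upTo n) (λ i → f (m N.+ i))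
  ∑-upTo-+ zero    n f = sym (identityˡ _)
  ∑-upTo-+ (suc m) n f = begin
    ∑ (upTo (suc m N.+ n)) f ≡⟨ ∑-upTo-suc (m N.+ n) f ⟩
    f 0 ∙ ∑ (upTo (m N.+ n)) (f ∘ suc) ≡⟨ cong (f 0 ∙_) (∑-upTo-+ m n (f ∘ suc)) ⟩
    f 0 ∙ (∑ (upTo m) (f ∘ suc) ∙ ∑ (upTo n) (λ i → f (suc m N.+ i))) ≡⟨ sym (assoc _ _ _) ⟩
    (f 0 ∙ ∑ (upTo m) (f ∘ suc)) ∙ ∑ (upTo n) (λ i → f (suc m N.+ i))
      ≡⟨ cong (_∙ ∑ (upTo n) (λ i → f (suc m N.+ i))) (sym (∑-upTo-suc m f)) ⟩
    ∑ (upTo (suc m)) f ∙ ∑ (upTo n) (λ i → f (suc m N.+ i)) ∎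

  ∑-fibre : (_≟_ : DecidableEquality B′) (xs : List B) {ys : List B′} → Unique ys →
            (σ : B → B′) → (∀ x → x ∈ xs → σ x ∈ ys) → (f : B′ → B → A) →
            ∑ xs (λ x → f (σ x) x) ≡ ∑ ys (λ y → ∑ xs (λ x → [ σ x ≟ y ]· f y x))
  ∑-fibre _≟_ xs {ys} uy σ σ∈ f = begin
    ∑ xs (λ x → f (σ x) x)
      ≡⟨ ∑-cong∈ xs (λ x m → sym (trans (∑-single uy (σ∈ x m)
           (λ y y≢ → []·-no (σ x ≟ y) (y≢ ∘ sym))) ([]·-yes (σ x ≟ σ x) refl))) ⟩
    ∑ xs (λ x → ∑ ys (λ y → [ σ x ≟ y ]· f y x))
      ≡⟨ ∑-swap xs ys _ ⟩
    ∑ ys (λ y → ∑ xs (λ x → [ σ x ≟ y ]· f y x)) ∎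

  ∑-reindex : (_≟_ : DecidableEquality B′) {xs : List B} {ys : List B′} → Unique xs → Unique ys →
              (σ : B → B′) (τ : B′ → B) →
              (∀ x → x ∈ xs → σ x ∈ ys) → (∀ y → y ∈ ys → τ y ∈ xs) →
              (∀ x → τ (σ x) ≡ x) → (∀ y → σ (τ y) ≡ y) → (f : B′ → A) →
              ∑ xs (f ∘ σ) ≡ ∑ ys f
  ∑-reindex _≟_ {xs} {ys} ux uy σ τ σ∈ τ∈ τσ στ f =
    trans (∑-fibre _≟_ xs uy σ σ∈ (λ y _ → f y)) (∑-cong∈ ys (λ y m →
      trans (∑-single ux (τ∈ y m) (λ x x≢ → []·-no (σ x ≟ y) (λ e → x≢ (trans (sym (τσ x)) (cong τ e)))))
            ([]·-yes (σ (τ y) ≟ y) (στ y))))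

open ListSum Z._+_ (# 0) ZP.+-0-isCommutativeMonoid public
  using (∑; ∑-cong∈; ∑-cong; ∑-∙; ∑-ε; ∑-swap; ∑-map; ∑-++; ∑-cartesian; ∑-single
        ; ∑-upTo-last; ∑-upTo-shift; ∑-reindex)

+-cancelˡ : ∀ i {j k} → i Z.+ j ≡ i Z.+ k → j ≡ k
+-cancelˡ i {j} {k} = ∙-cancelˡ i j k
  where open import Algebra.Properties.AbelianGroup ZP.+-0-abelianGroup using (∙-cancelˡ)

⟦_⟧ : {P : Set} → Dec P → ℤ
⟦ d ⟧ = if does d then # 1 else # 0

⟦⟧-yes : {P : Set} (d : Dec P) → P → ⟦ d ⟧ ≡ # 1
⟦⟧-yes (yes _) _ = refl
⟦⟧-yes (no ¬p) p = ⊥-elim (¬p p)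

⟦⟧-no : {P : Set} (d : Dec P) → ¬ P → ⟦ d ⟧ ≡ # 0
⟦⟧-no (yes p) ¬p = ⊥-elim (¬p p)
⟦⟧-no (no _)  _  = refl

⟦⟧-⇔ : {P Q : Set} (d : Dec P) (e : Dec Q) → (P → Q) → (Q → P) → ⟦ d ⟧ ≡ ⟦ e ⟧
⟦⟧-⇔ (yes p) e f g = sym (⟦⟧-yes e (f p))
⟦⟧-⇔ (no ¬p) e f g = sym (⟦⟧-no e (λ q → ¬p (g q)))

⟦⟧-≤ : {P Q : Set} (d : Dec P) (e : Dec Q) → (P → Q) → ⟦ d ⟧ Z.≤ ⟦ e ⟧
⟦⟧-≤ (no _)  (no _)  _ = ZP.≤-refl
⟦⟧-≤ (no _)  (yes _) _ = (Z.+≤+ N.z≤n)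
⟦⟧-≤ (yes _) (yes _) _ = ZP.≤-refl
⟦⟧-≤ (yes p) (no ¬q) f = ⊥-elim (¬q (f p))

⟦⟧-≥0 : {P : Set} (d : Dec P) → (# 0) Z.≤ ⟦ d ⟧
⟦⟧-≥0 (no _)  = ZP.≤-refl
⟦⟧-≥0 (yes _) = (Z.+≤+ N.z≤n)

⟦⟧-⊎-≤ : {P Q R : Set} (d : Dec P) (e : Dec Q) (f : Dec R) → (P → Q ⊎ R) →
         ⟦ d ⟧ Z.≤ ⟦ e ⟧ Z.+ ⟦ f ⟧
⟦⟧-⊎-≤ (no _)  e f g = ZP.+-mono-≤ (⟦⟧-≥0 e) (⟦⟧-≥0 f)
⟦⟧-⊎-≤ (yes p) e f g with g p
... | inj₁ x = ZP.+-mono-≤ (ZP.≤-reflexive (sym (⟦⟧-yes e x))) (⟦⟧-≥0 f)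
... | inj₂ r = ZP.+-mono-≤ (⟦⟧-≥0 e) (ZP.≤-reflexive (sym (⟦⟧-yes f r)))

module _ {B : Set} where

  open ≡-Reasoning

  ∑-*ˡ : (c : ℤ) (xs : List B) (f : B → ℤ) → ∑ xs (λ x → c Z.* f x) ≡ c Z.* ∑ xs f
  ∑-*ˡ c []       f = sym (ZP.*-zeroʳ c)
  ∑-*ˡ c (x ∷ xs) f =
    trans (cong (Z._+_ (c Z.* f x)) (∑-*ˡ c xs f)) (sym (ZP.*-distribˡ-+ c (f x) (∑ xs f)))

  ∑-*ʳ : (c : ℤ) (xs : List B) (f : B → ℤ) → ∑ xs (λ x → f x Z.* c) ≡ ∑ xs f Z.* c
  ∑-*ʳ c xs f = trans (∑-cong xs (λ x → ZP.*-comm (f x) c))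
                      (trans (∑-*ˡ c xs f) (ZP.*-comm c _))

  ∑-const : (c : ℤ) (xs : List B) → ∑ xs (λ _ → c) ≡ # (length xs) Z.* c
  ∑-const c []       = refl
  ∑-const c (x ∷ xs) = trans (cong (Z._+_ c) (∑-const c xs)) (sym (ZP.suc-* (# length xs) c))

  ∑-mono : (xs : List B) {f g : B → ℤ} → (∀ x → x ∈ xs → f x Z.≤ g x) → ∑ xs f Z.≤ ∑ xs g
  ∑-mono []       e = ZP.≤-refl
  ∑-mono (x ∷ xs) e = ZP.+-mono-≤ (e x (here refl)) (∑-mono xs (λ y m → e y (there m)))

  -- The counting principle behind three exact results: the number of square roots is `1 + χ`, the
  -- fixed points of Frobenius are the prime field, and every irreducible polynomial of suitable
  -- degree splits. In each case only a termwise bound is shown, and the totals do the rest.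
  ∑-≤-≡ : (xs : List B) {f g : B → ℤ} → (∀ x → x ∈ xs → f x Z.≤ g x) →
          ∑ xs g Z.≤ ∑ xs f → ∀ x → x ∈ xs → f x ≡ g x
  ∑-≤-≡ (x ∷ xs) {f} {g} e s = go
    where
    tail≤ : ∑ xs f Z.≤ ∑ xs g
    tail≤ = ∑-mono xs (λ y m → e y (there m))
    head≥ : g x Z.≤ f x
    head≥ = ZP.≮⇒≥ (λ lt → ZP.<⇒≱ (ZP.+-mono-<-≤ lt tail≤) s)
    tail≥ : ∑ xs g Z.≤ ∑ xs f
    tail≥ = ZP.≮⇒≥ (λ lt → ZP.<⇒≱ (ZP.+-mono-≤-< (e x (here refl)) lt) s)
    go : ∀ y → y ∈ x ∷ xs → f y ≡ g y
    go y (here refl) = ZP.≤-antisym (e x (here refl)) head≥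
    go y (there m)   = ∑-≤-≡ xs (λ z m′ → e z (there m′)) tail≥ y m

  ∑-δ : (_≟_ : DecidableEquality B) {xs : List B} {a : B} → Unique xs → a ∈ xs →
        (f : B → ℤ) → ∑ xs (λ x → ⟦ x ≟ a ⟧ Z.* f x) ≡ f a
  ∑-δ _≟_ {xs} {a} u m f =
    trans (∑-single u m (λ x x≢ → cong (Z._* f x) (⟦⟧-no (x ≟ a) x≢)))
          (trans (cong (Z._* f a) (⟦⟧-yes (a ≟ a) refl)) (ZP.*-identityˡ (f a)))

  ∑-δ1 : (_≟_ : DecidableEquality B) {xs : List B} {a : B} → Unique xs → a ∈ xs →
         ∑ xs (λ x → ⟦ x ≟ a ⟧) ≡ # 1
  ∑-δ1 _≟_ {xs} {a} u m =
    trans (∑-single u m (λ x x≢ → ⟦⟧-no (x ≟ a) x≢)) (⟦⟧-yes (a ≟ a) refl)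

∑-count : {B B′ : Set} (_≟_ : DecidableEquality B′) (xs : List B) {ys : List B′} → Unique ys →
          (σ : B → B′) → (∀ x → x ∈ xs → σ x ∈ ys) → (f : B′ → ℤ) →
          ∑ xs (f ∘ σ) ≡ ∑ ys (λ y → ∑ xs (λ x → ⟦ σ x ≟ y ⟧) Z.* f y)
∑-count _≟_ xs {ys} uy σ σ∈ f =
  trans (∑-cong∈ xs (λ x m → sym (trans (∑-cong ys (λ y → cong (Z._* f y)
          (⟦⟧-⇔ (σ x ≟ y) (y ≟ σ x) sym sym))) (∑-δ _≟_ uy (σ∈ x m) f))))
  (trans (∑-swap xs ys _) (∑-cong ys (λ y → ∑-*ʳ (f y) xs _)))

-- Finite fields

module Field {q : ℕ} (K : FiniteField q) where

  open FiniteField K public using (Carrier; _+_; _*_; -_; 0#; 1#; 0≢1; inverse; elt; index; _≟_; ι)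
  open FiniteField K using (isCommutativeRing; enum)

  commutativeRing : CommutativeRing 0ℓ 0ℓ
  commutativeRing = record { isCommutativeRing = isCommutativeRing }

  open CommutativeRing commutativeRing public
    using (+-assoc; +-comm; +-identityˡ; +-identityʳ; -‿inverseˡ; -‿inverseʳ
          ; *-assoc; *-comm; *-identityˡ; *-identityʳ; distribˡ; distribʳ; zeroˡ; zeroʳ
          ; ring; semiring; commutativeSemiring; +-isCommutativeMonoid; *-isCommutativeMonoid)
  open import Algebra.Properties.Ring ring public
    using (-‿distribˡ-*; -‿distribʳ-*; -0#≈0#; -‿involutive; -‿+-comm)
  open import Algebra.Properties.Semiring.Exp semiring public
    using (_^_; ^-homo-*; ^-assocʳ)
  open import Algebra.Properties.CommutativeSemiring.Exp commutativeSemiring public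
    using (^-distrib-*)
  open ≡-Reasoning

  ι-+ : ∀ m n → ι (m N.+ n) ≡ ι m + ι n
  ι-+ zero    n = sym (+-identityˡ _)
  ι-+ (suc m) n = trans (cong (1# +_) (ι-+ m n)) (sym (+-assoc _ _ _))

  ι-* : ∀ m n → ι (m N.* n) ≡ ι m * ι n
  ι-* zero    n = sym (zeroˡ _)
  ι-* (suc m) n = begin
    ι (n N.+ m N.* n) ≡⟨ ι-+ n _ ⟩
    ι n + ι (m N.* n) ≡⟨ cong₂ _+_ (sym (*-identityˡ _)) (ι-* m n) ⟩
    1# * ι n + ι m * ι n ≡⟨ sym (distribʳ _ _ _) ⟩
    ι (suc m) * ι n ∎

  -- The ring homomorphism from the integers. It carries character values and character sums into
  -- the field, where they become powers, and it supplies the coefficients of the ring solver.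
  cast : ℤ → Carrier
  cast (# n)    = ι n
  cast -[1+ n ] = - ι (suc n)

  cast-⊖ : ∀ m n → cast (m Z.⊖ n) ≡ ι m + - ι n
  cast-⊖ m       zero    = sym (trans (cong (ι m +_) -0#≈0#) (+-identityʳ _))
  cast-⊖ zero    (suc n) = sym (+-identityˡ _)
  cast-⊖ (suc m) (suc n) = begin
    cast (suc m Z.⊖ suc n) ≡⟨ cong cast (ZP.[1+m]⊖[1+n]≡m⊖n m n) ⟩
    cast (m Z.⊖ n) ≡⟨ cast-⊖ m n ⟩
    ι m + - ι n ≡⟨ cong (_+ - ι n) (sym (+-identityˡ _)) ⟩
    (0# + ι m) + - ι n ≡⟨ cong (λ t → (t + ι m) + - ι n) (sym (-‿inverseʳ 1#)) ⟩
    ((1# + - 1#) + ι m) + - ι n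
      ≡⟨ cong (_+ - ι n) (trans (+-assoc _ _ _) (trans (cong (1# +_) (+-comm _ _)) (sym (+-assoc _ _ _)))) ⟩
    ((1# + ι m) + - 1#) + - ι n ≡⟨ +-assoc _ _ _ ⟩
    (1# + ι m) + (- 1# + - ι n) ≡⟨ cong ((1# + ι m) +_) (-‿+-comm _ _) ⟩
    (1# + ι m) + - (1# + ι n) ∎

  cast-neg : ∀ i → cast (Z.- i) ≡ - cast i
  cast-neg (# zero)  = sym -0#≈0#
  cast-neg (# suc n) = refl
  cast-neg -[1+ n ]  = sym (-‿involutive _)

  cast-+ : ∀ i j → cast (i Z.+ j) ≡ cast i + cast j
  cast-+ (# m)    (# n)    = ι-+ m n
  cast-+ (# m)    -[1+ n ] = cast-⊖ m (suc n)
  cast-+ -[1+ m ] (# n)    = trans (cast-⊖ n (suc m)) (+-comm _ _)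
  cast-+ -[1+ m ] -[1+ n ] = begin
    - ι (suc (suc (m N.+ n))) ≡⟨ cong (λ t → - ι (suc t)) (sym (NP.+-suc m n)) ⟩
    - ι (suc m N.+ suc n) ≡⟨ cong -_ (ι-+ (suc m) (suc n)) ⟩
    - (ι (suc m) + ι (suc n)) ≡⟨ sym (-‿+-comm _ _) ⟩
    - ι (suc m) + - ι (suc n) ∎

  cast-◃- : ∀ k → cast (Sign.- Z.◃ k) ≡ - ι k
  cast-◃- zero    = sym -0#≈0#
  cast-◃- (suc k) = refl

  cast-◃+ : ∀ k → cast (Sign.+ Z.◃ k) ≡ ι k
  cast-◃+ zero    = refl
  cast-◃+ (suc k) = refl

  cast-* : ∀ i j → cast (i Z.* j) ≡ cast i * cast j
  cast-* (# m)    (# n)    = trans (cast-◃+ (m N.* n)) (ι-* m n)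
  cast-* (# m)    -[1+ n ] =
    trans (cast-◃- (m N.* suc n)) (trans (cong -_ (ι-* m (suc n))) (-‿distribʳ-* _ _))
  cast-* -[1+ m ] (# n)    =
    trans (cast-◃- (suc m N.* n)) (trans (cong -_ (ι-* (suc m) n)) (-‿distribˡ-* _ _))
  cast-* -[1+ m ] -[1+ n ] = begin
    ι (suc m N.* suc n) ≡⟨ ι-* (suc m) (suc n) ⟩
    ι (suc m) * ι (suc n) ≡⟨ sym (-‿involutive _) ⟩
    - - (ι (suc m) * ι (suc n)) ≡⟨ cong -_ (-‿distribʳ-* _ _) ⟩
    - (ι (suc m) * - ι (suc n)) ≡⟨ -‿distribˡ-* _ _ ⟩
    - ι (suc m) * - ι (suc n) ∎

  cast-^ : ∀ i n → cast (i Z.^ n) ≡ cast i ^ n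
  cast-^ i zero    = +-identityʳ 1#
  cast-^ i (suc n) = trans (cast-* i (i Z.^ n)) (cong (cast i *_) (cast-^ i n))

  import Algebra.Solver.Ring as RingSolver
  open import Algebra.Solver.Ring.AlmostCommutativeRing
    using (fromCommutativeRing; _-Raw-AlmostCommutative⟶_)

  private
    -- Agrees with cast, but sends 1 to 1# rather than to 1# + 0#, so that goals may mention 1#.
    coef : ℤ → Carrier
    coef (# 1)     = 1#
    coef -[1+ 0 ]  = - 1#
    coef i           = cast i

    coef≡cast : ∀ i → coef i ≡ cast i
    coef≡cast (# 0)             = refl
    coef≡cast (# 1)             = sym (+-identityʳ 1#)
    coef≡cast (# suc (suc n))   = refl
    coef≡cast -[1+ 0 ]          = cong -_ (sym (+-identityʳ 1#))
    coef≡cast -[1+ suc n ]      = refl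

    coef? : ∀ i j → Maybe (coef i ≡ coef j)
    coef? i j with i Z.≟ j
    ... | yes e = just (cong coef e)
    ... | no  _ = nothing

    via : ∀ i {x} → cast i ≡ x → coef i ≡ x
    via i = trans (coef≡cast i)

    morphism : Z.+-*-rawRing -Raw-AlmostCommutative⟶ fromCommutativeRing commutativeRing
    morphism = record
      { ⟦_⟧ = coef
      ; +-homo = λ i j → via (i Z.+ j) (trans (cast-+ i j) (sym (cong₂ _+_ (coef≡cast i) (coef≡cast j))))
      ; *-homo = λ i j → via (i Z.* j) (trans (cast-* i j) (sym (cong₂ _*_ (coef≡cast i) (coef≡cast j))))
      ; -‿homo = λ i → via (Z.- i) (trans (cast-neg i) (sym (cong -_ (coef≡cast i))))
      ; 0-homo = refl
      ; 1-homo = refl }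

  open RingSolver Z.+-*-rawRing (fromCommutativeRing commutativeRing) morphism coef?
    public using (solve; _:=_; _:+_; _:*_; :-_; _:-_; con; Polynomial)

  :0 :1 : ∀ {n} → Polynomial n
  :0 = con (# 0)
  :1 = con (# 1)

module FieldTheory {q : ℕ} (K : FiniteField q) where

  open Field K public
  open FiniteField K using (enum)
  open ≡-Reasoning

  elems : List Carrier
  elems = map elt (allFin q)

  elt-index : ∀ x → elt (index x) ≡ x
  elt-index x = Inverse.inverseˡ enum refl

  index-elt : ∀ i → index (elt i) ≡ i
  index-elt i = Inverse.inverseʳ enum refl

  elems-unique : Unique elems
  elems-unique = UP.map⁺ (λ {i} {j} e → trans (sym (index-elt i)) (trans (cong index e) (index-elt j)))
                         (UP.allFin⁺ q)

  ∈-elems : ∀ x → x ∈ elems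
  ∈-elems x = subst (_∈ elems) (elt-index x) (∈-map⁺ elt (∈-allFin (index x)))

  length-elems : length elems ≡ q
  length-elems = trans (LP.length-map elt (allFin q)) (LP.length-tabulate {n = q} (λ i → i))

  open ListSum _+_ 0# +-isCommutativeMonoid public
    renaming
    ( ∑ to ∑ᴷ; ∑-cong to ∑ᴷ-cong; ∑-cong∈ to ∑ᴷ-cong∈; ∑-∙ to ∑ᴷ-+; ∑-ε to ∑ᴷ-0
    ; ∑-single to ∑ᴷ-single; ∑-reindex to ∑ᴷ-reindex; ∑-swap to ∑ᴷ-swap
    ; ∑-upTo-suc to ∑ᴷ-upTo-suc; ∑-upTo-last to ∑ᴷ-upTo-last )
    using ()
  open ListSum _*_ 1# *-isCommutativeMonoid public
    renaming
    ( ∑ to ∏; ∑-cong to ∏-cong; ∑-∙ to ∏-*; ∑-single to ∏-single; ∑-reindex to ∏-reindex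
    ; ∑-upTo-suc to ∏-upTo-suc; ∑-upTo-last to ∏-upTo-last; ∑-upTo-+ to ∏-upTo-+ )
    using ()

  -- Zero is sent to zero, so that inversion is an involution of the whole field and can serve as a
  -- change of variable in sums over `elems`.
  inv : Carrier → Carrier
  inv x with x ≟ 0#
  ... | yes _ = 0#
  ... | no ne = proj₁ (inverse x ne)

  inv-0 : ∀ {x} → x ≡ 0# → inv x ≡ 0#
  inv-0 {x} e with x ≟ 0#
  ... | yes _ = refl
  ... | no ne = ⊥-elim (ne e)

  *-inv : ∀ {x} → x ≢ 0# → x * inv x ≡ 1#
  *-inv {x} ne with x ≟ 0#
  ... | yes e = ⊥-elim (ne e)
  ... | no n  = proj₂ (inverse x n)

  inv-* : ∀ {x} → x ≢ 0# → inv x * x ≡ 1#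
  inv-* ne = trans (*-comm _ _) (*-inv ne)

  inv-cancelˡ : ∀ {a} → a ≢ 0# → ∀ x → inv a * (a * x) ≡ x
  inv-cancelˡ ne x = trans (sym (*-assoc _ _ _)) (trans (cong (_* x) (inv-* ne)) (*-identityˡ x))

  inv-cancelʳ : ∀ {a} → a ≢ 0# → ∀ x → a * (inv a * x) ≡ x
  inv-cancelʳ ne x = trans (sym (*-assoc _ _ _)) (trans (cong (_* x) (*-inv ne)) (*-identityˡ x))

  *-cancel : ∀ {a x y} → a ≢ 0# → a * x ≡ a * y → x ≡ y
  *-cancel {a} ne e =
    trans (sym (inv-cancelˡ ne _)) (trans (cong (inv a *_) e) (inv-cancelˡ ne _))

  integral : ∀ x y → x * y ≡ 0# → x ≡ 0# ⊎ y ≡ 0#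
  integral x y e with x ≟ 0#
  ... | yes x0 = inj₁ x0
  ... | no ne  = inj₂ (*-cancel ne (trans e (sym (zeroʳ x))))

  *-≢0 : ∀ {x y} → x ≢ 0# → y ≢ 0# → x * y ≢ 0#
  *-≢0 nx ny e = [ nx , ny ]′ (integral _ _ e)

  inv-≢0 : ∀ {x} → x ≢ 0# → inv x ≢ 0#
  inv-≢0 {x} ne e = 0≢1 (trans (sym (zeroʳ x)) (trans (cong (x *_) (sym e)) (*-inv ne)))

  inv-inv : ∀ x → inv (inv x) ≡ x
  inv-inv x = go (x ≟ 0#)
    where
    go : Dec (x ≡ 0#) → inv (inv x) ≡ x
    go (yes e) = trans (inv-0 (inv-0 e)) (sym e)
    go (no ne) = *-cancel (inv-≢0 ne) (trans (*-inv (inv-≢0 ne)) (sym (inv-* ne)))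

  x-y≡0⇒x≡y : ∀ {x y} → x + - y ≡ 0# → x ≡ y
  x-y≡0⇒x≡y {x} {y} e = begin
    x ≡⟨ solve 2 (λ x y → x := (x :- y) :+ y) refl x y ⟩
    (x + - y) + y ≡⟨ cong (_+ y) e ⟩
    0# + y ≡⟨ +-identityˡ y ⟩
    y ∎

  1^ : ∀ n → 1# ^ n ≡ 1#
  1^ zero    = refl
  1^ (suc n) = trans (*-identityˡ _) (1^ n)

  0^ : ∀ n → 0# ^ suc n ≡ 0#
  0^ n = zeroˡ _

  ^-≢0 : ∀ {x} n → x ≢ 0# → x ^ n ≢ 0#
  ^-≢0 zero    ne e = 0≢1 (sym e)
  ^-≢0 (suc n) ne e = *-≢0 ne (^-≢0 n ne) e

  ∏-≢0 : {B : Set} (xs : List B) {f : B → Carrier} → (∀ x → f x ≢ 0#) → ∏ xs f ≢ 0#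
  ∏-≢0 []       ne e = 0≢1 (sym e)
  ∏-≢0 (x ∷ xs) ne   = *-≢0 (ne x) (∏-≢0 xs ne)

  ∏-const : {B : Set} (xs : List B) (a : Carrier) → ∏ xs (λ _ → a) ≡ a ^ length xs
  ∏-const []       a = refl
  ∏-const (x ∷ xs) a = cong (a *_) (∏-const xs a)

  ∑ᴷ-*ˡ : {B : Set} (c : Carrier) (xs : List B) (f : B → Carrier) →
          ∑ᴷ xs (λ x → c * f x) ≡ c * ∑ᴷ xs f
  ∑ᴷ-*ˡ c []       f = sym (zeroʳ c)
  ∑ᴷ-*ˡ c (x ∷ xs) f = trans (cong (c * f x +_) (∑ᴷ-*ˡ c xs f)) (sym (distribˡ c (f x) _))

  ∑ᴷ-1 : {B : Set} (xs : List B) → ∑ᴷ xs (λ _ → 1#) ≡ ι (length xs)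
  ∑ᴷ-1 []       = refl
  ∑ᴷ-1 (x ∷ xs) = cong (1# +_) (∑ᴷ-1 xs)

  cast-∑ : {B : Set} (xs : List B) (f : B → ℤ) → cast (∑ xs f) ≡ ∑ᴷ xs (λ x → cast (f x))
  cast-∑ []       f = refl
  cast-∑ (x ∷ xs) f = trans (cast-+ (f x) (∑ xs f)) (cong (cast (f x) +_) (cast-∑ xs f))

  reindexBy : (σ τ : Carrier → Carrier) → (∀ x → τ (σ x) ≡ x) → (∀ x → σ (τ x) ≡ x) →
              (f : Carrier → ℤ) → ∑ elems (λ x → f (σ x)) ≡ ∑ elems f
  reindexBy σ τ τσ στ = ∑-reindex _≟_ elems-unique elems-unique σ τ
    (λ x _ → ∈-elems (σ x)) (λ x _ → ∈-elems (τ x)) τσ στ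

  ∑-affine : ∀ {a} → a ≢ 0# → ∀ b (f : Carrier → ℤ) → ∑ elems (λ x → f (a * x + b)) ≡ ∑ elems f
  ∑-affine {a} ne b = reindexBy (λ x → a * x + b) (λ y → inv a * (y + - b))
    (λ x → trans (cong (inv a *_) (solve 2 (λ x b → (x :+ b) :- b := x) refl (a * x) b)) (inv-cancelˡ ne x))
    (λ y → trans (cong (_+ b) (inv-cancelʳ ne (y + - b))) (solve 2 (λ y b → (y :- b) :+ b := y) refl y b))

  -- Translation by 1 permutes the field, so the sum of all elements equals itself plus `q` times 1.
  ι-q : ι q ≡ 0#
  ι-q = begin
    ι q ≡⟨ cong ι (sym length-elems) ⟩
    ι (length elems) ≡⟨ sym (∑ᴷ-1 elems) ⟩
    ∑ᴷ elems (λ _ → 1#) ≡⟨ solve 2 (λ a s → a := (a :+ s) :- s) refl _ s ⟩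
    (∑ᴷ elems (λ _ → 1#) + s) + - s ≡⟨ cong (_+ - s) (sym (∑ᴷ-+ elems (λ _ → 1#) (λ x → x))) ⟩
    ∑ᴷ elems (λ x → 1# + x) + - s ≡⟨ cong (_+ - s) shift ⟩
    s + - s ≡⟨ -‿inverseʳ s ⟩
    0# ∎
    where
    s = ∑ᴷ elems (λ x → x)
    shift : ∑ᴷ elems (λ x → 1# + x) ≡ s
    shift = ∑ᴷ-reindex _≟_ elems-unique elems-unique (1# +_) (λ y → - 1# + y)
      (λ x _ → ∈-elems _) (λ x _ → ∈-elems _)
      (λ x → solve 1 (λ x → :- :1 :+ (:1 :+ x) := x) refl x)
      (λ x → solve 1 (λ x → :1 :+ (:- :1 :+ x) := x) refl x) (λ x → x)

  -- Multiplication by a permutes the nonzero elements.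
  fermat : ∀ a → a ^ q ≡ a
  fermat a = go (a ≟ 0#)
    where
    -- Replacing zero by one turns the product over all elements into the product of the nonzero
    -- ones.
    orOne : Carrier → Carrier
    orOne x = if does (x ≟ 0#) then 1# else x
    -- The correction at `x = 0`, where `a * orOne x` is `a` but `orOne (a * x)` is 1.
    pickZero : Carrier → Carrier
    pickZero x = if does (x ≟ 0#) then a else 1#
    orOne≢0 : ∀ x → orOne x ≢ 0#
    orOne≢0 x with x ≟ 0#
    ... | yes _ = λ e → 0≢1 (sym e)
    ... | no ne = ne
    P = ∏ elems orOne
    pointwise : a ≢ 0# → ∀ x → a * orOne x ≡ pickZero x * orOne (a * x)
    pointwise ne x with x ≟ 0# | (a * x) ≟ 0#
    ... | yes _ | yes _ = refl
    ... | yes e | no n  = ⊥-elim (n (trans (cong (a *_) e) (zeroʳ a)))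
    ... | no n  | yes e = ⊥-elim (*-≢0 ne n e)
    ... | no _  | no _  = sym (*-identityˡ _)
    pickZero-1 : ∀ x → x ≢ 0# → pickZero x ≡ 1#
    pickZero-1 x ne with x ≟ 0#
    ... | yes e = ⊥-elim (ne e)
    ... | no _  = refl
    pickZero-a : ∀ {x} → x ≡ 0# → pickZero x ≡ a
    pickZero-a {x} e with x ≟ 0#
    ... | yes _ = refl
    ... | no ne = ⊥-elim (ne e)
    go : Dec (a ≡ 0#) → a ^ q ≡ a
    -- The exponent `q` is not 0, since `index 0#` inhabits `Fin q`.
    go (yes e) = zero-power q (index 0#) e
      where
      zero-power : ∀ m → Fin m → a ≡ 0# → a ^ m ≡ a
      zero-power (suc m) _ e = trans (cong (_* a ^ m) e) (trans (zeroˡ _) (sym e))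
    go (no ne) = *-cancel (∏-≢0 elems orOne≢0) (begin
      P * a ^ q ≡⟨ *-comm _ _ ⟩
      a ^ q * P ≡⟨ cong (λ k → a ^ k * P) (sym length-elems) ⟩
      a ^ length elems * P ≡⟨ cong (_* P) (sym (∏-const elems a)) ⟩
      ∏ elems (λ _ → a) * P ≡⟨ sym (∏-* elems _ _) ⟩
      ∏ elems (λ x → a * orOne x) ≡⟨ ∏-cong elems (pointwise ne) ⟩
      ∏ elems (λ x → pickZero x * orOne (a * x)) ≡⟨ ∏-* elems _ _ ⟩
      ∏ elems pickZero * ∏ elems (λ x → orOne (a * x)) ≡⟨ cong₂ _*_
        (trans (∏-single elems-unique (∈-elems 0#) pickZero-1) (pickZero-a refl))
        (∏-reindex _≟_ elems-unique elems-unique (a *_) (inv a *_)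
          (λ x _ → ∈-elems _) (λ x _ → ∈-elems _) (inv-cancelˡ ne) (inv-cancelʳ ne) orOne) ⟩
      a * P ≡⟨ *-comm _ _ ⟩
      P * a ∎)

  -- A list of coefficients (constant term first) stands for the monic polynomial
  -- whose degree is its length: the leading coefficient 1 is implicit.
  eval : List Carrier → Carrier → Carrier
  eval []      x = 1#
  eval (c ∷ a) x = c + x * eval a x

  eval-T^ : ∀ n x → eval (replicate n 0#) x ≡ x ^ n
  eval-T^ zero    x = refl
  eval-T^ (suc n) x = trans (+-identityˡ _) (cong (x *_) (eval-T^ n x))

  -- The quotient by T - r, up to the remainder eval a r.
  synth : List Carrier → Carrier → List Carrier
  synth []          r = []
  synth (c ∷ [])    r = []
  synth (c ∷ d ∷ a) r = eval (d ∷ a) r ∷ synth (d ∷ a) r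

  length-synth : ∀ c a r → length (synth (c ∷ a) r) ≡ length a
  length-synth c []      r = refl
  length-synth c (d ∷ a) r = cong suc (length-synth d a r)

  eval-synth : ∀ c a r x → eval (c ∷ a) x ≡ eval (c ∷ a) r + (x + - r) * eval (synth (c ∷ a) r) x
  eval-synth c []      r x =
    solve 3 (λ c x r → c :+ x :* :1 := (c :+ r :* :1) :+ (x :- r) :* :1) refl c x r
  eval-synth c (d ∷ a) r x = trans (cong (λ t → c + x * t) (eval-synth d a r x))
    (solve 5 (λ c x r v s → c :+ x :* (v :+ (x :- r) :* s) :=
                            (c :+ r :* v) :+ (x :- r) :* (v :+ x :* s))
      refl c x r (eval (d ∷ a) r) (eval (synth (d ∷ a) r) x))

  root-split : ∀ c a r x → eval (c ∷ a) r ≡ 0# → eval (c ∷ a) x ≡ 0# →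
               x ≡ r ⊎ eval (synth (c ∷ a) r) x ≡ 0#
  root-split c a r x er ex = [ inj₁ ∘ x-y≡0⇒x≡y , inj₂ ]′ (integral _ _ (begin
    (x + - r) * s ≡⟨ sym (+-identityˡ _) ⟩
    0# + (x + - r) * s ≡⟨ cong (_+ (x + - r) * s) (sym er) ⟩
    eval (c ∷ a) r + (x + - r) * s ≡⟨ sym (eval-synth c a r x) ⟩
    eval (c ∷ a) x ≡⟨ ex ⟩
    0# ∎))
    where s = eval (synth (c ∷ a) r) x

  distinct-roots : ∀ e (a : List Carrier) (r : ℕ → Carrier) →
                   (∀ i j → i N.< j → j N.< e → r i ≢ r j) →
                   (∀ i → i N.< e → eval a (r i) ≡ 0#) → e N.≤ length a
  distinct-roots zero    a       r d z = z≤n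
  distinct-roots (suc e) []      r d z = ⊥-elim (0≢1 (sym (z 0 (s≤s z≤n))))
  distinct-roots (suc e) (c ∷ a) r d z = s≤s (subst (e N.≤_) (length-synth c a (r 0))
    (distinct-roots e (synth (c ∷ a) (r 0)) (r ∘ suc)
      (λ i j i<j j<e → d (suc i) (suc j) (s≤s i<j) (s≤s j<e))
      (λ i i<e → [ (λ eq → ⊥-elim (d 0 (suc i) (s≤s z≤n) (s≤s i<e) (sym eq))) , (λ q → q) ]′
        (root-split c a (r 0) (r (suc i)) (z 0 (s≤s z≤n)) (z (suc i) (s≤s i<e))))))

  -- Synthetic division by a root `r` lowers the degree by one, and every root is `r` or a root of
  -- the quotient.
  count-roots : (a : List Carrier) → ∑ elems (λ x → ⟦ eval a x ≟ 0# ⟧) Z.≤ # length a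
  count-roots a = go (length a) a refl
    where
    rootless : ∀ a → (∀ x → eval a x ≢ 0#) → ∑ elems (λ x → ⟦ eval a x ≟ 0# ⟧) ≡ # 0
    rootless a ne = ∑-ε elems (λ x _ → ⟦⟧-no (eval a x ≟ 0#) (ne x))
    go : ∀ k a → length a ≡ k → ∑ elems (λ x → ⟦ eval a x ≟ 0# ⟧) Z.≤ # k
    go k [] refl = ZP.≤-reflexive (rootless [] (λ x e → 0≢1 (sym e)))
    go (suc k) (c ∷ a) l with any? (λ x → eval (c ∷ a) x ≟ 0#) elems
    ... | no none = ZP.≤-trans (ZP.≤-reflexive (rootless (c ∷ a) (λ x e → none (lose′ x e)))) (Z.+≤+ z≤n)
      where
      lose′ : ∀ x → eval (c ∷ a) x ≡ 0# → _
      lose′ x = lose (∈-elems x)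
    ... | yes some with satisfied some
    ... | r , er = ZP.≤-trans
      (∑-mono elems (λ x _ → ⟦⟧-⊎-≤ (eval (c ∷ a) x ≟ 0#) (x ≟ r) (eval (synth (c ∷ a) r) x ≟ 0#)
        (root-split c a r x er)))
      (ZP.≤-trans (ZP.≤-reflexive (trans (∑-∙ elems _ _)
                     (cong (Z._+ ∑ elems (λ x → ⟦ eval (synth (c ∷ a) r) x ≟ 0# ⟧))
                       (∑-δ1 _≟_ elems-unique (∈-elems r)))))
        (ZP.+-monoʳ-≤ (# 1) (go k (synth (c ∷ a) r) (trans (length-synth c a r) (NP.suc-injective l)))))

-- The quadratic character

-- The possible character values. In odd characteristic `cast` is injective on them, so identities
-- between integer character values can be checked in the field.
data Sign₀ : ℤ → Set where
  nul : Sign₀ (# 0)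
  pos : Sign₀ (# 1)
  neg : Sign₀ -[1+ 0 ]

Sign₀-* : ∀ {i j} → Sign₀ i → Sign₀ j → Sign₀ (i Z.* j)
Sign₀-* nul nul = nul
Sign₀-* nul pos = nul
Sign₀-* nul neg = nul
Sign₀-* pos nul = nul
Sign₀-* pos pos = pos
Sign₀-* pos neg = neg
Sign₀-* neg nul = nul
Sign₀-* neg pos = neg
Sign₀-* neg neg = pos

Sign₀-^ : ∀ {i} n → Sign₀ i → Sign₀ (i Z.^ n)
Sign₀-^ zero    s = pos
Sign₀-^ (suc n) s = Sign₀-* s (Sign₀-^ n s)

module Character {q : ℕ} (K : FiniteField q) (k : ℕ) (q≡ : q ≡ suc (2 N.* suc k)) where

  open FieldTheory K
  open ≡-Reasoning

  h : ℕ
  h = suc k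

  cast-1 : cast (# 1) ≡ 1#
  cast-1 = +-identityʳ 1#

  cast--1 : cast -[1+ 0 ] ≡ - 1#
  cast--1 = cong -_ cast-1

  -- Otherwise 2 would be 0, and `ι q = 1 + 2h` would be 1 instead of 0.
  1≢-1 : 1# ≢ - 1#
  1≢-1 e = 0≢1 (begin
    0# ≡⟨ sym ι-q ⟩
    ι q ≡⟨ cong ι q≡ ⟩
    1# + ι (2 N.* h) ≡⟨ cong (1# +_) (ι-* 2 h) ⟩
    1# + (1# + (1# + 0#)) * ι h ≡⟨ cong (λ t → 1# + (t + (1# + 0#)) * ι h) e ⟩
    1# + (- 1# + (1# + 0#)) * ι h
      ≡⟨ solve 1 (λ x → :1 :+ (:- :1 :+ (:1 :+ :0)) :* x := :1) refl (ι h) ⟩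
    1# ∎)

  cast-injective : ∀ {i j} → Sign₀ i → Sign₀ j → cast i ≡ cast j → i ≡ j
  cast-injective nul nul e = refl
  cast-injective nul pos e = ⊥-elim (0≢1 (trans e cast-1))
  cast-injective nul neg e = ⊥-elim (0≢1 (begin
    0# ≡⟨ sym -0#≈0# ⟩
    - 0# ≡⟨ cong -_ (trans e cast--1) ⟩
    - - 1# ≡⟨ -‿involutive 1# ⟩
    1# ∎))
  cast-injective pos pos e = refl
  cast-injective pos neg e = ⊥-elim (1≢-1 (trans (sym cast-1) (trans e cast--1)))
  cast-injective neg neg e = refl
  cast-injective pos nul e = sym (cast-injective nul pos (sym e))
  cast-injective neg nul e = sym (cast-injective nul neg (sym e))
  cast-injective neg pos e = sym (cast-injective pos neg (sym e))

  ^2h : ∀ {x} → x ≢ 0# → x ^ (2 N.* h) ≡ 1#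
  ^2h {x} ne = *-cancel ne (begin
    x * x ^ (2 N.* h) ≡⟨ cong (x ^_) (sym q≡) ⟩
    x ^ q ≡⟨ fermat x ⟩
    x ≡⟨ sym (trans (*-comm x 1#) (*-identityˡ x)) ⟩
    x * 1# ∎)

  ^h-sq : ∀ x → (x * x) ^ h ≡ x ^ (2 N.* h)
  ^h-sq x = begin
    (x * x) ^ h ≡⟨ ^-distrib-* x x h ⟩
    x ^ h * x ^ h ≡⟨ sym (^-homo-* x h h) ⟩
    x ^ (h N.+ h) ≡⟨ cong (λ t → x ^ (h N.+ t)) (sym (NP.+-identityʳ h)) ⟩
    x ^ (2 N.* h) ∎

  ^h-±1 : ∀ {x} → x ≢ 0# → x ^ h ≡ 1# ⊎ x ^ h ≡ - 1#
  ^h-±1 {x} ne = [ inj₁ ∘ x-y≡0⇒x≡y , (λ e → inj₂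
    (trans (sym (solve 1 (λ y → (y :+ :1) :- :1 := y) refl (x ^ h)))
      (trans (cong (_+ - 1#) e) (+-identityˡ _)))) ]′
    (integral (x ^ h + - 1#) (x ^ h + 1#) (begin
      (x ^ h + - 1#) * (x ^ h + 1#)
        ≡⟨ solve 1 (λ y → (y :- :1) :* (y :+ :1) := y :* y :- :1) refl (x ^ h) ⟩
      x ^ h * x ^ h + - 1#
        ≡⟨ cong (_+ - 1#) (trans (sym (^-distrib-* x x h)) (trans (^h-sq x) (^2h ne))) ⟩
      1# + - 1# ≡⟨ -‿inverseʳ 1# ⟩
      0# ∎))

  -- Euler's criterion is taken as the definition: `h` is `(q - 1)/2`. Multiplicativity and the
  -- behaviour under norms are then rules for powers; the link with squares comes later, in
  -- `count-roots≡1+χ`.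
  χ : Carrier → ℤ
  χ x with x ≟ 0# | (x ^ h) ≟ 1#
  ... | yes _ | _     = # 0
  ... | no _  | yes _ = # 1
  ... | no _  | no _  = -[1+ 0 ]

  χ-sign : ∀ x → Sign₀ (χ x)
  χ-sign x with x ≟ 0# | (x ^ h) ≟ 1#
  ... | yes _ | _     = nul
  ... | no _  | yes _ = pos
  ... | no _  | no _  = neg

  cast-χ : ∀ x → cast (χ x) ≡ x ^ h
  cast-χ x with x ≟ 0# | (x ^ h) ≟ 1#
  ... | yes e | _     = sym (trans (cong (_^ h) e) (0^ k))
  ... | no _  | yes e = trans cast-1 (sym e)
  ... | no ne | no n  = trans cast--1 (sym ([ (λ e → ⊥-elim (n e)) , (λ e → e) ]′ (^h-±1 ne)))

  χ-unique : ∀ {x s} → Sign₀ s → cast s ≡ x ^ h → χ x ≡ s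
  χ-unique {x} s e = cast-injective (χ-sign x) s (trans (cast-χ x) (sym e))

  χ-* : ∀ x y → χ (x * y) ≡ χ x Z.* χ y
  χ-* x y = χ-unique (Sign₀-* (χ-sign x) (χ-sign y)) (begin
    cast (χ x Z.* χ y) ≡⟨ cast-* (χ x) (χ y) ⟩
    cast (χ x) * cast (χ y) ≡⟨ cong₂ _*_ (cast-χ x) (cast-χ y) ⟩
    x ^ h * y ^ h ≡⟨ sym (^-distrib-* x y h) ⟩
    (x * y) ^ h ∎)

  χ-0 : ∀ {x} → x ≡ 0# → χ x ≡ # 0
  χ-0 {x} e = χ-unique nul (sym (trans (cong (_^ h) e) (0^ k)))

  χ-1 : χ 1# ≡ # 1
  χ-1 = χ-unique pos (trans cast-1 (sym (1^ h)))

  χ-sq : ∀ {x} → x ≢ 0# → χ (x * x) ≡ # 1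
  χ-sq {x} ne = χ-unique pos (trans cast-1 (sym (trans (^h-sq x) (^2h ne))))

  χ-sq-* : ∀ {x} → x ≢ 0# → ∀ y → χ (x * x * y) ≡ χ y
  χ-sq-* {x} ne y = trans (χ-* (x * x) y) (trans (cong (Z._* χ y) (χ-sq ne)) (ZP.*-identityˡ (χ y)))

  ∑-elems-const : ∀ c → ∑ elems (λ _ → c) ≡ # q Z.* c
  ∑-elems-const c = trans (∑-const c elems) (cong (λ n → # n Z.* c) length-elems)

  roots : Carrier → ℤ
  roots x = ∑ elems (λ y → ⟦ (y * y) ≟ x ⟧)

  ∑-roots : ∑ elems roots ≡ # q
  ∑-roots = begin
    ∑ elems roots ≡⟨ ∑-swap elems elems _ ⟩
    ∑ elems (λ y → ∑ elems (λ x → ⟦ (y * y) ≟ x ⟧)) ≡⟨ ∑-cong elems (λ y → trans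
      (∑-cong elems (λ x → ⟦⟧-⇔ ((y * y) ≟ x) (x ≟ (y * y)) sym sym))
        (∑-δ1 _≟_ elems-unique (∈-elems (y * y)))) ⟩
    ∑ elems (λ _ → # 1) ≡⟨ ∑-elems-const (# 1) ⟩
    # q Z.* # 1 ≡⟨ ZP.*-identityʳ _ ⟩
    # q ∎

  T^h-1 : List Carrier
  T^h-1 = - 1# ∷ replicate k 0#

  -- Expresses `χ` through the roots of `T^h - 1`, so that a bound on their number bounds the
  -- character sum.
  χ-indicator : ∀ x → χ x ≡ # 2 Z.* ⟦ eval T^h-1 x ≟ 0# ⟧ Z.+ (-[1+ 0 ] Z.+ ⟦ x ≟ 0# ⟧)
  χ-indicator x with x ≟ 0# | (x ^ h) ≟ 1#
  ... | yes e | _ = cong (λ t → # 2 Z.* t Z.+ # 0) (sym (⟦⟧-no (eval T^h-1 x ≟ 0#) (λ r → 0≢1 (begin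
    0# ≡⟨ sym -0#≈0# ⟩
    - 0# ≡⟨ cong -_ (sym r) ⟩
    - eval T^h-1 x
      ≡⟨ cong -_ (trans (cong (λ t → - 1# + t * eval (replicate k 0#) x) e)
        (trans (cong (- 1# +_) (zeroˡ _)) (+-identityʳ _))) ⟩
    - - 1# ≡⟨ -‿involutive 1# ⟩
    1# ∎))))
  ... | no _ | yes e = cong (λ t → # 2 Z.* t Z.+ -[1+ 0 ]) (sym (⟦⟧-yes (eval T^h-1 x ≟ 0#)
    (trans (cong (λ t → - 1# + x * t) (eval-T^ k x)) (trans (cong (- 1# +_) e) (-‿inverseˡ 1#)))))
  ... | no _ | no ne = cong (λ t → # 2 Z.* t Z.+ -[1+ 0 ])
    (sym (⟦⟧-no (eval T^h-1 x ≟ 0#) (λ r → ne (x-y≡0⇒x≡y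
    (trans (+-comm _ _) (trans (cong (λ t → - 1# + x * t) (sym (eval-T^ k x))) r))))))

  -- At most `h` elements satisfy `x^h = 1`, so the sum is at most `2h - q + 1 = 0`.
  ∑χ≤0 : ∑ elems χ Z.≤ # 0
  ∑χ≤0 = ZP.≤-trans (ZP.≤-reflexive (begin
    ∑ elems χ ≡⟨ ∑-cong elems χ-indicator ⟩
    ∑ elems (λ x → # 2 Z.* A x Z.+ (-[1+ 0 ] Z.+ ⟦ x ≟ 0# ⟧))
      ≡⟨ trans (∑-∙ elems _ _) (cong₂ Z._+_ (∑-*ˡ (# 2) elems A)
        (∑-∙ elems (λ _ → -[1+ 0 ]) (λ x → ⟦ x ≟ 0# ⟧))) ⟩
    # 2 Z.* ∑ elems A Z.+ (∑ elems (λ _ → -[1+ 0 ]) Z.+ ∑ elems (λ x → ⟦ x ≟ 0# ⟧))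
      ≡⟨ cong₂ (λ a b → # 2 Z.* ∑ elems A Z.+ (a Z.+ b)) (∑-elems-const -[1+ 0 ])
        (∑-δ1 _≟_ elems-unique (∈-elems 0#)) ⟩
    # 2 Z.* ∑ elems A Z.+ (# q Z.* -[1+ 0 ] Z.+ # 1) ∎))
    (ZP.≤-trans (ZP.+-monoˡ-≤ _ (ZP.*-monoˡ-≤-nonNeg (# 2) (ZP.≤-trans (count-roots T^h-1)
        (ZP.≤-reflexive (cong (λ n → # suc n) (LP.length-replicate k))))))
      (ZP.≤-reflexive (begin
        Z.+ 2 Z.* # h Z.+ (# q Z.* -[1+ 0 ] Z.+ # 1)
          ≡⟨ cong (λ n → # 2 Z.* # h Z.+ (n Z.* -[1+ 0 ] Z.+ # 1)) (trans (cong #_ q≡)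
               (cong (Z._+_ (# 1)) (ZP.pos-* 2 h))) ⟩
        # 2 Z.* # h Z.+ ((# 1 Z.+ # 2 Z.* # h) Z.* -[1+ 0 ] Z.+ # 1)
          ≡⟨ ZS.solve 1 (λ h → ZS.con (# 2) ⊗ h ⊕ ((ZS.con (# 1) ⊕ ZS.con (# 2) ⊗ h)
               ⊗ ZS.con (-[1+ 0 ]) ⊕ ZS.con (# 1)) ⊜ ZS.con (# 0)) refl (# h) ⟩
        # 0 ∎)))
    where
    A : Carrier → ℤ
    A x = ⟦ eval T^h-1 x ≟ 0# ⟧

  -1≤χ : ∀ x → -[1+ 0 ] Z.≤ χ x
  -1≤χ x with χ x | χ-sign x
  ... | _ | nul = Z.-≤+
  ... | _ | pos = Z.-≤+
  ... | _ | neg = Z.-≤- z≤n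

  -- Without a square root the left side is 0 and `χ` is at least -1; with a root `s` other than 0,
  -- the only roots are `s` and `-s` while `χ` is 1.
  roots≤ : ∀ x → roots x Z.≤ # 1 Z.+ χ x
  roots≤ x with any? (λ s → (s * s) ≟ x) elems
  ... | no none = ZP.≤-trans (ZP.≤-reflexive
    (∑-ε elems (λ y m → ⟦⟧-no ((y * y) ≟ x) (λ e → none (lose m e)))))
                             (ZP.+-monoʳ-≤ (# 1) (-1≤χ x))
  ... | yes some with satisfied some
  ... | s , refl = go (s ≟ 0#)
    where
    go : Dec (s ≡ 0#) → roots (s * s) Z.≤ # 1 Z.+ χ (s * s)
    go (yes e) = ZP.≤-reflexive (trans
      (trans (∑-cong elems (λ y → ⟦⟧-⇔ ((y * y) ≟ (s * s)) (y ≟ 0#)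
          (λ e′ → [ (λ z → z) , (λ z → z) ]′ (integral y y (trans e′ (trans (cong (s *_) e) (zeroʳ s)))))
          (λ y0 → trans (cong (y *_) y0) (trans (zeroʳ y) (sym (trans (cong (s *_) e) (zeroʳ s)))))))
        (∑-δ1 _≟_ elems-unique (∈-elems 0#)))
      (sym (cong (Z._+_ (# 1)) (χ-0 (trans (cong (s *_) e) (zeroʳ s))))))
    go (no ne) = ZP.≤-trans (∑-mono elems (λ y _ → ⟦⟧-⊎-≤ ((y * y) ≟ (s * s)) (y ≟ s) (y ≟ (- s)) (λ e →
        [ inj₁ ∘ x-y≡0⇒x≡y , (λ z → inj₂ (x-y≡0⇒x≡y (trans (cong (y +_) (-‿involutive s)) z))) ]′
        (integral (y + - s) (y + s) (begin
          (y + - s) * (y + s)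
            ≡⟨ solve 2 (λ y s → (y :- s) :* (y :+ s) := y :* y :- s :* s) refl y s ⟩
          y * y + - (s * s) ≡⟨ cong (_+ - (s * s)) e ⟩
          s * s + - (s * s) ≡⟨ -‿inverseʳ _ ⟩
          0# ∎)))))
      (ZP.≤-reflexive (trans (∑-∙ elems _ _) (trans
        (cong₂ Z._+_ (∑-δ1 _≟_ elems-unique (∈-elems s)) (∑-δ1 _≟_ elems-unique (∈-elems (- s))))
        (cong (Z._+_ (# 1)) (sym (χ-sq ne))))))

  ∑-1+χ : ∑ elems (λ x → # 1 Z.+ χ x) ≡ # q Z.+ ∑ elems χ
  ∑-1+χ = trans (∑-∙ elems _ _) (cong (Z._+ ∑ elems χ) (trans (∑-elems-const (# 1)) (ZP.*-identityʳ (# q))))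

  -- The bound `roots≤` is termwise, the left sides add up to `q` and the right sides to at most
  -- `q`. This yields the hard half of Euler's criterion without a generator of the multiplicative
  -- group.
  count-roots≡1+χ : ∀ x → roots x ≡ # 1 Z.+ χ x
  count-roots≡1+χ x = ∑-≤-≡ elems (λ y _ → roots≤ y)
    (ZP.≤-trans (ZP.≤-reflexive ∑-1+χ) (ZP.≤-trans (ZP.+-monoʳ-≤ (# q) ∑χ≤0)
      (ZP.≤-reflexive (trans (ZP.+-identityʳ _) (sym ∑-roots))))) x (∈-elems x)

  ∑χ≡0 : ∑ elems χ ≡ # 0
  ∑χ≡0 = +-cancelˡ (# q) (begin
    Z.+ q Z.+ ∑ elems χ ≡⟨ sym ∑-1+χ ⟩
    ∑ elems (λ x → # 1 Z.+ χ x) ≡⟨ ∑-cong elems (sym ∘ count-roots≡1+χ) ⟩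
    ∑ elems roots ≡⟨ ∑-roots ⟩
    # q ≡⟨ sym (ZP.+-identityʳ _) ⟩
    # q Z.+ # 0 ∎)

  ∑χ-affine : ∀ {a} → a ≢ 0# → ∀ b → ∑ elems (λ x → χ (a * x + b)) ≡ # 0
  ∑χ-affine ne b = trans (∑-affine ne b χ) ∑χ≡0

  χ-sq-indicator : ∀ x → χ (x * x) Z.+ ⟦ x ≟ 0# ⟧ ≡ # 1
  χ-sq-indicator x = go (x ≟ 0#)
    where
    go : Dec (x ≡ 0#) → χ (x * x) Z.+ ⟦ x ≟ 0# ⟧ ≡ # 1
    go (yes e) = cong₂ Z._+_ (χ-0 (trans (cong (x *_) e) (zeroʳ x))) (⟦⟧-yes (x ≟ 0#) e)
    go (no ne) = cong₂ Z._+_ (χ-sq ne) (⟦⟧-no (x ≟ 0#) ne)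

  -- For nonzero `c` and `x`, `x (x + c)` is `x^2` times `c / x + 1`, and inversion turns the sum
  -- into one of `χ` over an affine function, which is 0. The summand 1 on the left is the term
  -- `χ 1` that the point `x = 0` contributes after this substitution.
  ∑χ-quadratic : ∀ c → ∑ elems (λ x → χ (x * (x + c))) Z.+ # 1 ≡ # q Z.* ⟦ c ≟ 0# ⟧
  ∑χ-quadratic c = trans (cong (Z._+_ (∑ elems (λ x → χ (x * (x + c)))))
    (sym (∑-δ1 _≟_ elems-unique (∈-elems 0#))))
    (trans (sym (∑-∙ elems _ _)) (go (c ≟ 0#)))
    where
    go : Dec (c ≡ 0#) → ∑ elems (λ x → χ (x * (x + c)) Z.+ ⟦ x ≟ 0# ⟧) ≡ # q Z.* ⟦ c ≟ 0# ⟧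
    go (yes e) = begin
      ∑ elems (λ x → χ (x * (x + c)) Z.+ ⟦ x ≟ 0# ⟧)
        ≡⟨ ∑-cong elems (λ x → trans (cong (λ t → χ (x * t) Z.+ ⟦ x ≟ 0# ⟧)
          (trans (cong (x +_) e) (+-identityʳ x))) (χ-sq-indicator x)) ⟩
      ∑ elems (λ _ → # 1) ≡⟨ ∑-elems-const (# 1) ⟩
      # q Z.* # 1 ≡⟨ cong (Z._*_ (# q)) (sym (⟦⟧-yes (c ≟ 0#) e)) ⟩
      # q Z.* ⟦ c ≟ 0# ⟧ ∎
    go (no ne) = begin
      ∑ elems (λ x → χ (x * (x + c)) Z.+ ⟦ x ≟ 0# ⟧) ≡⟨ ∑-cong elems (λ x → pointwise x (x ≟ 0#)) ⟩
      ∑ elems (λ x → χ (c * inv x + 1#))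
        ≡⟨ reindexBy inv inv inv-inv inv-inv (λ x → χ (c * x + 1#)) ⟩
      ∑ elems (λ x → χ (c * x + 1#)) ≡⟨ ∑χ-affine ne 1# ⟩
      # 0 ≡⟨ sym (trans (cong (Z._*_ (# q)) (⟦⟧-no (c ≟ 0#) ne)) (ZP.*-zeroʳ (# q))) ⟩
      # q Z.* ⟦ c ≟ 0# ⟧ ∎
      where
      pointwise : ∀ x → Dec (x ≡ 0#) → χ (x * (x + c)) Z.+ ⟦ x ≟ 0# ⟧ ≡ χ (c * inv x + 1#)
      pointwise x (yes e) = begin
        χ (x * (x + c)) Z.+ ⟦ x ≟ 0# ⟧
          ≡⟨ cong₂ Z._+_ (χ-0 (trans (cong (_* (x + c)) e) (zeroˡ _))) (⟦⟧-yes (x ≟ 0#) e) ⟩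
        # 1 ≡⟨ sym χ-1 ⟩
        χ 1#
          ≡⟨ cong χ (sym (trans (cong (λ t → c * t + 1#) (inv-0 e))
            (solve 1 (λ c → c :* :0 :+ :1 := :1) refl c))) ⟩
        χ (c * inv x + 1#) ∎
      pointwise x (no nx) = begin
        χ (x * (x + c)) Z.+ ⟦ x ≟ 0# ⟧ ≡⟨ cong (Z._+_ (χ (x * (x + c)))) (⟦⟧-no (x ≟ 0#) nx) ⟩
        χ (x * (x + c)) Z.+ # 0 ≡⟨ ZP.+-identityʳ _ ⟩
        χ (x * (x + c)) ≡⟨ cong (λ t → χ (x * (x + t))) (sym (inv-cancelʳ nx c)) ⟩
        χ (x * (x + x * (inv x * c)))
          ≡⟨ cong χ (solve 3 (λ x i c → x :* (x :+ x :* (i :* c)) := x :* x :* (c :* i :+ :1)) refl x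
            (inv x) c) ⟩
        χ (x * x * (c * inv x + 1#)) ≡⟨ χ-sq-* nx _ ⟩
        χ (c * inv x + 1#) ∎

-- Monic polynomials and Euclid's lemma

module Polynomials {q : ℕ} (K : FiniteField q) where

  open FieldTheory K
  open ≡-Reasoning

  Seq : Set
  Seq = ℕ → Carrier

  shift : Seq → Seq
  shift s zero    = 0#
  shift s (suc k) = s k

  δ : Seq
  δ zero    = 1#
  δ (suc k) = 0#

  -- Monic polynomials act on sequences, T acting as the shift. The action is faithful already
  -- at δ, so that identities between polynomials become identities between operators.
  act : List Carrier → Seq → Seq
  act []      s k = s k
  act (c ∷ a) s k = c * s k + shift (act a s) k

  shift-cong : ∀ {s t} → s ≗ t → shift s ≗ shift t
  shift-cong e zero    = refl
  shift-cong e (suc k) = e k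

  act-cong : ∀ a {s t} → s ≗ t → act a s ≗ act a t
  act-cong []      e k = e k
  act-cong (c ∷ a) e k = cong₂ _+_ (cong (c *_) (e k)) (shift-cong (act-cong a e) k)

  shift-linear : ∀ s x t k → shift (λ i → s i + x * t i) k ≡ shift s k + x * shift t k
  shift-linear s x t zero    = solve 1 (λ x → :0 := :0 :+ x :* :0) refl x
  shift-linear s x t (suc k) = refl

  act-linear : ∀ a s x t k → act a (λ i → s i + x * t i) k ≡ act a s k + x * act a t k
  act-linear []      s x t k = refl
  act-linear (c ∷ a) s x t k = begin
    c * (s k + x * t k) + shift (act a (λ i → s i + x * t i)) k
      ≡⟨ cong (c * (s k + x * t k) +_) (trans (shift-cong (act-linear a s x t) k) (shift-linear _ x _ k)) ⟩
    c * (s k + x * t k) + (shift (act a s) k + x * shift (act a t) k)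
      ≡⟨ solve 6 (λ c s x t u v → c :* (s :+ x :* t) :+ (u :+ x :* v) :=
                   (c :* s :+ u) :+ x :* (c :* t :+ v)) refl c (s k) x (t k) _ _ ⟩
    (c * s k + shift (act a s) k) + x * (c * t k + shift (act a t) k) ∎

  act-shift : ∀ a s → act a (shift s) ≗ shift (act a s)
  act-shift []      s k       = refl
  act-shift (c ∷ a) s zero    = trans (cong₂ _+_ (zeroʳ c) refl) (+-identityˡ 0#)
  act-shift (c ∷ a) s (suc k) = cong (c * s k +_) (act-shift a s k)

  act-comm : ∀ a b s → act a (act b s) ≗ act b (act a s)
  act-comm []      b s k = refl
  act-comm (c ∷ a) b s k = begin
    c * act b s k + shift (act a (act b s)) k
      ≡⟨ cong (c * act b s k +_) (trans (shift-cong (act-comm a b s) k) (sym (act-shift b (act a s) k))) ⟩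
    c * act b s k + act b (shift (act a s)) k
      ≡⟨ +-comm _ _ ⟩
    act b (shift (act a s)) k + c * act b s k
      ≡⟨ sym (act-linear b (shift (act a s)) c s k) ⟩
    act b (λ i → shift (act a s) i + c * s i) k
      ≡⟨ act-cong b (λ i → +-comm _ _) k ⟩
    act b (λ i → c * s i + shift (act a s) i) k ∎

  -- y + κ w for deg w < deg y (junk otherwise).
  addMul : List Carrier → Carrier → List Carrier → List Carrier
  addMul []      κ w       = []
  addMul (c ∷ y) κ []      = (c + κ) ∷ y
  addMul (c ∷ y) κ (e ∷ w) = (c + κ * e) ∷ addMul y κ w

  length-addMul : ∀ y κ w → length (addMul y κ w) ≡ length y
  length-addMul []      κ w       = refl
  length-addMul (c ∷ y) κ []      = refl
  length-addMul (c ∷ y) κ (e ∷ w) = cong suc (length-addMul y κ w)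

  act-addMul : ∀ y κ w → length w N.< length y → ∀ s k →
               act (addMul y κ w) s k ≡ act y s k + κ * act w s k
  act-addMul (c ∷ y) κ []      l s k =
    solve 4 (λ c κ s u → (c :+ κ) :* s :+ u := (c :* s :+ u) :+ κ :* s) refl c κ (s k) _
  act-addMul (c ∷ y) κ (e ∷ w) (s≤s l) s k = begin
    (c + κ * e) * s k + shift (act (addMul y κ w) s) k
      ≡⟨ cong ((c + κ * e) * s k +_) (trans (shift-cong (act-addMul y κ w l s) k) (shift-linear _ κ _ k)) ⟩
    (c + κ * e) * s k + (shift (act y s) k + κ * shift (act w s) k)
      ≡⟨ solve 6 (λ c κ e s u v → (c :+ κ :* e) :* s :+ (u :+ κ :* v) :=
                   (c :* s :+ u) :+ κ :* (e :* s :+ v)) refl c κ e (s k) _ _ ⟩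
    (c * s k + shift (act y s) k) + κ * (e * s k + shift (act w s) k) ∎

  eval-addMul : ∀ y κ w → length w N.< length y → ∀ x →
                eval (addMul y κ w) x ≡ eval y x + κ * eval w x
  eval-addMul (c ∷ y) κ []      l x =
    solve 4 (λ c κ x u → (c :+ κ) :+ x :* u := (c :+ x :* u) :+ κ :* :1) refl c κ x (eval y x)
  eval-addMul (c ∷ y) κ (e ∷ w) (s≤s l) x = trans (cong (λ t → (c + κ * e) + x * t) (eval-addMul y κ w l x))
    (solve 6 (λ c κ e x u v → (c :+ κ :* e) :+ x :* (u :+ κ :* v) :=
               (c :+ x :* u) :+ κ :* (e :+ x :* v)) refl c κ e x (eval y x) (eval w x))

  infixl 7 _·_
  -- In the recursive case `0# ∷ (a · b)` is `T` times the product; its degree exceeds that of `b`,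
  -- as `addMul` requires.
  _·_ : List Carrier → List Carrier → List Carrier
  []      · b = b
  (c ∷ a) · b = addMul (0# ∷ (a · b)) c b

  length-· : ∀ a b → length (a · b) ≡ length a N.+ length b
  length-· []      b = refl
  length-· (c ∷ a) b = trans (length-addMul (0# ∷ (a · b)) c b) (cong suc (length-· a b))

  private
    fits : ∀ a b → length b N.< suc (length (a · b))
    fits a b = s≤s (subst (length b N.≤_) (sym (length-· a b)) (NP.m≤n+m (length b) (length a)))

  act-· : ∀ a b s → act (a · b) s ≗ act a (act b s)
  act-· []      b s k = refl
  act-· (c ∷ a) b s k = begin
    act (addMul (0# ∷ (a · b)) c b) s k
      ≡⟨ act-addMul (0# ∷ (a · b)) c b (fits a b) s k ⟩
    (0# * s k + shift (act (a · b) s) k) + c * act b s k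
      ≡⟨ solve 3 (λ s u v → (:0 :* s :+ u) :+ v := v :+ u) refl (s k) _ _ ⟩
    c * act b s k + shift (act (a · b) s) k
      ≡⟨ cong (c * act b s k +_) (shift-cong (act-· a b s) k) ⟩
    c * act b s k + shift (act a (act b s)) k ∎

  eval-· : ∀ a b x → eval (a · b) x ≡ eval a x * eval b x
  eval-· []      b x = sym (*-identityˡ _)
  eval-· (c ∷ a) b x = begin
    eval (addMul (0# ∷ (a · b)) c b) x ≡⟨ eval-addMul (0# ∷ (a · b)) c b (fits a b) x ⟩
    (0# + x * eval (a · b) x) + c * eval b x
      ≡⟨ cong (λ t → (0# + x * t) + c * eval b x) (eval-· a b x) ⟩
    (0# + x * (eval a x * eval b x)) + c * eval b x
      ≡⟨ solve 4 (λ c x u v → (:0 :+ x :* (u :* v)) :+ c :* v := (c :+ x :* u) :* v) refl c x (eval a x)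
        (eval b x) ⟩
    (c + x * eval a x) * eval b x ∎

  private
    act-tail : ∀ c a k → act (c ∷ a) δ (suc k) ≡ act a δ k
    act-tail c a k = solve 2 (λ c u → c :* :0 :+ u := u) refl c _

    act-head : ∀ c a → act (c ∷ a) δ 0 ≡ c
    act-head c a = solve 1 (λ c → c :* :1 :+ :0 := c) refl c

  act-δ-≢0 : ∀ a κ → (∀ k → κ * act a δ k ≡ 0#) → κ ≡ 0#
  act-δ-≢0 []      κ z = trans (sym (trans (*-comm _ _) (*-identityˡ κ))) (z 0)
  act-δ-≢0 (c ∷ a) κ z = act-δ-≢0 a κ (λ k → trans (cong (κ *_) (sym (act-tail c a k))) (z (suc k)))

  -- At `δ` a polynomial produces its own coefficient sequence. The scalars are there because a
  -- difference of monic polynomials is monic only up to a factor; the leading coefficients give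
  -- `κ ≡ λ′`.
  act-δ-injective : ∀ a b κ λ′ → κ ≢ 0# → λ′ ≢ 0# →
                    (∀ k → κ * act a δ k ≡ λ′ * act b δ k) → a ≡ b × κ ≡ λ′
  act-δ-injective [] [] κ λ′ nκ nλ e =
    refl , trans (sym (trans (*-comm _ _) (*-identityˡ κ)))
      (trans (e 0) (trans (*-comm _ _) (*-identityˡ λ′)))
  act-δ-injective [] (d ∷ b) κ λ′ nκ nλ e = ⊥-elim (nλ (act-δ-≢0 b λ′ (λ k →
    trans (cong (λ′ *_) (sym (act-tail d b k))) (trans (sym (e (suc k))) (zeroʳ κ)))))
  act-δ-injective (c ∷ a) [] κ λ′ nκ nλ e = ⊥-elim (nκ (act-δ-≢0 a κ (λ k →
    trans (cong (κ *_) (sym (act-tail c a k))) (trans (e (suc k)) (zeroʳ λ′)))))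
  act-δ-injective (c ∷ a) (d ∷ b) κ λ′ nκ nλ e
    with act-δ-injective a b κ λ′ nκ nλ (λ k → trans (cong (κ *_) (sym (act-tail c a k)))
           (trans (e (suc k)) (cong (λ′ *_) (act-tail d b k))))
  ... | refl , refl = cong (_∷ a) (*-cancel nκ (begin
    κ * c ≡⟨ cong (κ *_) (sym (act-head c a)) ⟩
    κ * act (c ∷ a) δ 0 ≡⟨ e 0 ⟩
    κ * act (d ∷ a) δ 0 ≡⟨ cong (κ *_) (act-head d a) ⟩
    κ * d ∎)) , refl

  act-injective : ∀ {a b} → act a δ ≗ act b δ → a ≡ b
  act-injective {a} {b} e = proj₁ (act-δ-injective a b 1# 1# 1≢0 1≢0 (λ k → cong (1# *_) (e k)))
    where
    1≢0 : 1# ≢ 0#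
    1≢0 e = 0≢1 (sym e)

  -- Both products act as commuting polynomials in the shift, and the action at `δ` determines the
  -- polynomial; `·-assoc` has the same proof.
  ·-comm : ∀ a b → a · b ≡ b · a
  ·-comm a b = act-injective (λ k → trans (act-· a b δ k) (trans (act-comm a b δ k) (sym (act-· b a δ k))))

  ·-assoc : ∀ a b c → (a · b) · c ≡ a · (b · c)
  ·-assoc a b c = act-injective (λ k → begin
    act ((a · b) · c) δ k ≡⟨ act-· (a · b) c δ k ⟩
    act (a · b) (act c δ) k ≡⟨ act-· a b (act c δ) k ⟩
    act a (act b (act c δ)) k ≡⟨ act-cong a (λ i → sym (act-· b c δ i)) k ⟩
    act a (act (b · c) δ) k ≡⟨ sym (act-· a (b · c) δ k) ⟩
    act (a · (b · c)) δ k ∎)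

  ·-identityʳ : ∀ a → a · [] ≡ a
  ·-identityʳ a = ·-comm a []

  -- x = y + κ m with κ ≠ 0 and m monic.
  record _≈_+[_]_ (x y : List Carrier) (κ : Carrier) (m : List Carrier) : Set where
    constructor differ
    field
      κ≢0    : κ ≢ 0#
      action : ∀ s k → act x s k ≡ act y s k + κ * act m s k
  open _≈_+[_]_

  -- Stands in for subtraction, since lists represent neither zero nor polynomials that are not
  -- monic.
  difference : ∀ a b → length a ≡ length b →
               a ≡ b ⊎ ∃ λ κ → ∃ λ m → length m N.< length a × (a ≈ b +[ κ ] m)
  difference []      []      l = inj₁ refl
  difference (c ∷ a) (d ∷ b) l with difference a b (NP.suc-injective l)
  -- The leading coefficient `κ` of the difference is already fixed by the higher coefficients, so
  -- the new constant term is divided by it to keep the remainder monic.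
  ... | inj₂ (κ , m , m< , D) = inj₂ (κ , inv κ * (c + - d) ∷ m , s≤s m< , differ (κ≢0 D) (λ s k → begin
    c * s k + shift (act a s) k
      ≡⟨ cong (c * s k +_) (trans (shift-cong (action D s) k) (shift-linear _ κ _ k)) ⟩
    c * s k + (shift (act b s) k + κ * shift (act m s) k)
      ≡⟨ solve 6 (λ c d s u v κ → c :* s :+ (u :+ κ :* v) := (d :* s :+ u) :+ ((c :- d) :* s :+ κ :* v))
           refl c d (s k) _ _ κ ⟩
    (d * s k + shift (act b s) k) + ((c + - d) * s k + κ * shift (act m s) k)
      ≡⟨ cong (λ t → (d * s k + shift (act b s) k) + (t * s k + κ * shift (act m s) k))
           (sym (inv-cancelʳ (κ≢0 D) (c + - d))) ⟩
    (d * s k + shift (act b s) k) + (κ * (inv κ * (c + - d)) * s k + κ * shift (act m s) k)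
      ≡⟨ solve 5 (λ t κ e s v → t :+ (κ :* e :* s :+ κ :* v) := t :+ κ :* (e :* s :+ v))
           refl _ κ (inv κ * (c + - d)) (s k) _ ⟩
    (d * s k + shift (act b s) k) + κ * (inv κ * (c + - d) * s k + shift (act m s) k) ∎))
  ... | inj₁ refl with (c + - d) ≟ 0#
  ... | yes e = inj₁ (cong (_∷ a) (x-y≡0⇒x≡y e))
  ... | no ne = inj₂ (c + - d , [] , s≤s z≤n , differ ne (λ s k →
    solve 4 (λ c d s u → c :* s :+ u := (d :* s :+ u) :+ (c :- d) :* s) refl c d (s k) _))

  act-·-addMul : ∀ a y κ w → length w N.< length y → ∀ s k →
                 act (a · addMul y κ w) s k ≡ act (a · y) s k + κ * act (a · w) s k
  act-·-addMul a y κ w l s k = begin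
    act (a · addMul y κ w) s k ≡⟨ act-· a _ s k ⟩
    act a (act (addMul y κ w) s) k ≡⟨ act-cong a (act-addMul y κ w l s) k ⟩
    act a (λ i → act y s i + κ * act w s i) k ≡⟨ act-linear a (act y s) κ (act w s) k ⟩
    act a (act y s) k + κ * act a (act w s) k
      ≡⟨ sym (cong₂ (λ u v → u + κ * v) (act-· a y s k) (act-· a w s k)) ⟩
    act (a · y) s k + κ * act (a · w) s k ∎

  Quotient : List Carrier → List Carrier → Set
  Quotient a x = ∃ λ y → length a N.+ length y ≡ length x ×
    (x ≡ a · y ⊎ ∃ λ κ → ∃ λ m → length m N.< length a × (x ≈ (a · y) +[ κ ] m))

  -- The first guess `T^j` for the quotient matches the leading term. If the difference `κ m` still
  -- has large degree, `m` is divided by `a` and `κ` times its quotient is added to the guess. The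
  -- bound `n` makes the recursion structural.
  divide : ∀ n a x → length x N.≤ n → length a N.≤ length x → Quotient a x
  divide n a x x≤n a≤x = go n x≤n (difference x (a · T^j) (sym lengths))
    where
    T^j = replicate (length x N.∸ length a) 0#
    |T^j| : length T^j ≡ length x N.∸ length a
    |T^j| = LP.length-replicate (length x N.∸ length a)
    sum-length : length a N.+ length T^j ≡ length x
    sum-length = trans (cong (length a N.+_) |T^j|) (NP.m+[n∸m]≡n a≤x)
    lengths : length (a · T^j) ≡ length x
    lengths = trans (length-· a T^j) sum-length
    go : ∀ n → length x N.≤ n →
         x ≡ a · T^j ⊎ (∃ λ κ → ∃ λ m → length m N.< length x × (x ≈ (a · T^j) +[ κ ] m)) → Quotient a x
    go n x≤n (inj₁ e) = T^j , sum-length , inj₁ e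
    go n x≤n (inj₂ (κ , m , m<x , D)) with length m N.<? length a
    ... | yes m<a = T^j , sum-length , inj₂ (κ , m , m<a , D)
    go zero x≤n (inj₂ (κ , m , m<x , D)) | no m≮a = ⊥-elim (NP.n≮0 (NP.<-≤-trans m<x x≤n))
    go (suc n) x≤n (inj₂ (κ , m , m<x , D)) | no m≮a
      with divide n a m (NP.≤-pred (NP.<-≤-trans m<x x≤n)) (NP.≮⇒≥ m≮a)
    ... | y′ , ly′ , r = y , trans (cong (length a N.+_) (length-addMul T^j κ y′)) sum-length , result r
      where
      y = addMul T^j κ y′
      y′<j : length y′ N.< length T^j
      y′<j = NP.+-cancelˡ-< (length a) _ _ (subst₂ N._<_ (sym ly′) (sym sum-length) m<x)
      result : _ → (x ≡ a · y ⊎ ∃ λ κ → ∃ λ m → length m N.< length a × (x ≈ (a · y) +[ κ ] m))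
      result (inj₁ refl) = inj₁ (act-injective (λ k → trans (action D δ k)
        (sym (act-·-addMul a T^j κ y′ y′<j δ k))))
      result (inj₂ (κ′ , m′ , m′<a , D′)) = inj₂
        (κ * κ′ , m′ , m′<a , differ (*-≢0 (κ≢0 D) (κ≢0 D′)) (λ s k → begin
        act x s k ≡⟨ action D s k ⟩
        act (a · T^j) s k + κ * act m s k
          ≡⟨ cong (λ t → act (a · T^j) s k + κ * t) (action D′ s k) ⟩
        act (a · T^j) s k + κ * (act (a · y′) s k + κ′ * act m′ s k)
          ≡⟨ solve 5 (λ u κ v κ′ w → u :+ κ :* (v :+ κ′ :* w) := (u :+ κ :* v) :+ κ :* κ′ :* w) refl _ κ _
            κ′ _ ⟩
        (act (a · T^j) s k + κ * act (a · y′) s k) + κ * κ′ * act m′ s k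
          ≡⟨ cong (_+ κ * κ′ * act m′ s k) (sym (act-·-addMul a T^j κ y′ y′<j s k)) ⟩
        act (a · y) s k + κ * κ′ * act m′ s k ∎))

  act-·-difference : ∀ a {u v κ w} → u ≈ v +[ κ ] w → ∀ k →
                     act (a · u) δ k ≡ act (a · v) δ k + κ * act (a · w) δ k
  act-·-difference a {u} {v} {κ} {w} D k = begin
    act (a · u) δ k ≡⟨ act-· a u δ k ⟩
    act a (act u δ) k ≡⟨ act-cong a (action D δ) k ⟩
    act a (λ i → act v δ i + κ * act w δ i) k ≡⟨ act-linear a (act v δ) κ (act w δ) k ⟩
    act a (act v δ) k + κ * act a (act w δ) k
      ≡⟨ sym (cong₂ (λ x y → x + κ * y) (act-· a v δ k) (act-· a w δ k)) ⟩
    act (a · v) δ k + κ * act (a · w) δ k ∎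

  _∣ᴾ_ : List Carrier → List Carrier → Set
  a ∣ᴾ b = ∃ λ c → a · c ≡ b

  -- The difference of two multiples of `a` is `a` times `u - v`; normalising `u - v` to a monic `w`
  -- gives `a · w ≡ m`. The case `u ≡ v` would force `κ` to be 0.
  ∣-difference : ∀ a u v κ m → length u ≡ length v → κ ≢ 0# →
                 (∀ k → act (a · u) δ k ≡ act (a · v) δ k + κ * act m δ k) → a ∣ᴾ m
  ∣-difference a u v κ m l nκ e with difference u v l
  ... | inj₁ refl = ⊥-elim (nκ (act-δ-≢0 m κ (λ k → begin
    κ * act m δ k ≡⟨ solve 2 (λ x y → x := (y :+ x) :- y) refl _ (act (a · u) δ k) ⟩
    (act (a · u) δ k + κ * act m δ k) + - act (a · u) δ k
      ≡⟨ cong (_+ - act (a · u) δ k) (sym (e k)) ⟩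
    act (a · u) δ k + - act (a · u) δ k ≡⟨ -‿inverseʳ _ ⟩
    0# ∎)))
  ... | inj₂ (κ′ , w , _ , D) = w , proj₁ (act-δ-injective (a · w) m κ′ κ (κ≢0 D) nκ (λ k → begin
    κ′ * act (a · w) δ k ≡⟨ solve 2 (λ x y → x := (y :+ x) :- y) refl _ (act (a · v) δ k) ⟩
    (act (a · v) δ k + κ′ * act (a · w) δ k) + - act (a · v) δ k
      ≡⟨ cong (_+ - act (a · v) δ k) (trans (sym (act-·-difference a D k)) (e k)) ⟩
    (act (a · v) δ k + κ * act m δ k) + - act (a · v) δ k
      ≡⟨ sym (solve 2 (λ x y → x := (y :+ x) :- y) refl _ (act (a · v) δ k)) ⟩
    κ * act m δ k ∎))

  length-cancel : ∀ a u v → a · u ≡ a · v → length u ≡ length v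
  length-cancel a u v e = NP.+-cancelˡ-≡ (length a) _ _
    (trans (sym (length-· a u)) (trans (cong length e) (length-· a v)))

  ·-cancelˡ : ∀ a {u v} → a · u ≡ a · v → u ≡ v
  ·-cancelˡ a {u} {v} e with difference u v (length-cancel a u v e)
  ... | inj₁ eq = eq
  ... | inj₂ (κ , w , _ , D) = ⊥-elim (κ≢0 D (act-δ-≢0 (a · w) κ (λ k → begin
    κ * act (a · w) δ k ≡⟨ solve 2 (λ x y → x := (y :+ x) :- y) refl _ (act (a · v) δ k) ⟩
    (act (a · v) δ k + κ * act (a · w) δ k) + - act (a · v) δ k
      ≡⟨ cong (_+ - act (a · v) δ k) (trans (sym (act-·-difference a D k)) (cong (λ t → act t δ k) e)) ⟩
    act (a · v) δ k + - act (a · v) δ k ≡⟨ -‿inverseʳ _ ⟩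
    0# ∎)))

  record Irreducible (P : List Carrier) : Set where
    field
      positive : 1 N.≤ length P
      unsplit  : ∀ a b → a · b ≡ P → length a ≡ 0 ⊎ length b ≡ 0

  length-0 : ∀ {a : List Carrier} → length a ≡ 0 → a ≡ []
  length-0 {[]} _ = refl

  module _ {Q : List Carrier} (irr : Irreducible Q) where

    open Irreducible irr

    -- Euclidean descent on the degree of `a`: write `Q = a y + κ m`; then `κ m b = Q b - y (a b)`
    -- is again a multiple of `Q`, and `m` has smaller degree than `a`. The descent ends at `m = 1`.
    ∣-small : ∀ n a → length a N.≤ n → length a N.< length Q → ∀ b → Q ∣ᴾ (a · b) → Q ∣ᴾ b
    ∣-small n       []      a≤n a<Q b d = d
    ∣-small (suc n) (c ∷ a) a≤n a<Q b (z , Qz) with divide (length Q) (c ∷ a) Q NP.≤-refl (NP.<⇒≤ a<Q)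
    -- A zero remainder would factor `Q`: as `a` has positive degree here, irreducibility leaves `y`
    -- constant, and then `a` has the degree of `Q`.
    ... | y , ly , inj₁ e = [ (λ ()) , (λ y0 → ⊥-elim (NP.<-irrefl
            (trans (sym (NP.+-identityʳ _)) (trans (cong (suc (length a) N.+_) (sym y0)) ly)) a<Q)) ]′
            (unsplit (c ∷ a) y (sym e))
    ... | y , ly , inj₂ (κ , m , m<a , D) =
      ∣-small n m (NP.≤-pred (NP.≤-trans m<a a≤n)) (NP.<-trans m<a a<Q) b
        (∣-difference Q b (y · z) κ (m · b) lengths (κ≢0 D) (λ k → begin
          act (Q · b) δ k ≡⟨ act-· Q b δ k ⟩
          act Q (act b δ) k ≡⟨ action D (act b δ) k ⟩
          act ((c ∷ a) · y) (act b δ) k + κ * act m (act b δ) k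
            ≡⟨ cong₂ (λ u v → u + κ * v) (trans (sym (act-· ((c ∷ a) · y) b δ k))
              (cong (λ t → act t δ k) rearrange))
                 (sym (act-· m b δ k)) ⟩
          act (Q · (y · z)) δ k + κ * act (m · b) δ k ∎))
      where
      rearrange : ((c ∷ a) · y) · b ≡ Q · (y · z)
      rearrange = begin
        ((c ∷ a) · y) · b ≡⟨ cong (_· b) (·-comm (c ∷ a) y) ⟩
        (y · (c ∷ a)) · b ≡⟨ ·-assoc y (c ∷ a) b ⟩
        y · ((c ∷ a) · b) ≡⟨ cong (y ·_) (sym Qz) ⟩
        y · (Q · z) ≡⟨ sym (·-assoc y Q z) ⟩
        (y · Q) · z ≡⟨ cong (_· z) (·-comm y Q) ⟩
        (Q · y) · z ≡⟨ ·-assoc Q y z ⟩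
        Q · (y · z) ∎
      lengths : length b ≡ length (y · z)
      lengths = NP.+-cancelˡ-≡ (length Q) _ _ (begin
        length Q N.+ length b ≡⟨ cong (N._+ length b) (sym (trans (length-· (c ∷ a) y) ly)) ⟩
        length ((c ∷ a) · y) N.+ length b ≡⟨ sym (length-· ((c ∷ a) · y) b) ⟩
        length (((c ∷ a) · y) · b) ≡⟨ cong length rearrange ⟩
        length (Q · (y · z)) ≡⟨ length-· Q (y · z) ⟩
        length Q N.+ length (y · z) ∎)

    -- Only a factor of degree below that of `Q` is handled by `∣-small`, so `a` is first replaced
    -- by its remainder modulo `Q`.
    euclid : ∀ a b → Q ∣ᴾ (a · b) → Q ∣ᴾ a ⊎ Q ∣ᴾ b
    euclid a b (z , Qz) with length a N.<? length Q
    ... | yes a<Q = inj₂ (∣-small (length a) a NP.≤-refl a<Q b (z , Qz))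
    ... | no a≮Q with divide (length a) Q a NP.≤-refl (NP.≮⇒≥ a≮Q)
    ... | y , ly , inj₁ e = inj₁ (y , sym e)
    ... | y , ly , inj₂ (κ , m , m<Q , D) = inj₂ (∣-small (length m) m NP.≤-refl m<Q b
      (∣-difference Q z (y · b) κ (m · b) lengths (κ≢0 D) (λ k → begin
        act (Q · z) δ k ≡⟨ cong (λ t → act t δ k) Qz ⟩
        act (a · b) δ k ≡⟨ act-· a b δ k ⟩
        act a (act b δ) k ≡⟨ action D (act b δ) k ⟩
        act (Q · y) (act b δ) k + κ * act m (act b δ) k
          ≡⟨ cong₂ (λ u v → u + κ * v) (trans (sym (act-· (Q · y) b δ k))
            (cong (λ t → act t δ k) (·-assoc Q y b)))
               (sym (act-· m b δ k)) ⟩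
        act (Q · (y · b)) δ k + κ * act (m · b) δ k ∎)))
      where
      lengths : length z ≡ length (y · b)
      lengths = NP.+-cancelˡ-≡ (length Q) _ _ (begin
        length Q N.+ length z ≡⟨ sym (length-· Q z) ⟩
        length (Q · z) ≡⟨ trans (cong length Qz) (length-· a b) ⟩
        length a N.+ length b ≡⟨ cong (N._+ length b) (sym ly) ⟩
        (length Q N.+ length y) N.+ length b ≡⟨ NP.+-assoc (length Q) (length y) (length b) ⟩
        length Q N.+ (length y N.+ length b) ≡⟨ cong (length Q N.+_) (sym (length-· y b)) ⟩
        length Q N.+ length (y · b) ∎)

-- Unique factorization and the Euler product

module Factorization {q : ℕ} (K : FiniteField q) where

  open FieldTheory K
  open Polynomials K
  open ≡-Reasoning

  _≟ᴸ_ : (a b : List Carrier) → Dec (a ≡ b)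
  _≟ᴸ_ = LP.≡-dec _≟_

  monics : ℕ → List (List Carrier)
  monics zero    = [] ∷ []
  monics (suc k) = cartesianProductWith _∷_ elems (monics k)

  monics-unique : ∀ k → Unique (monics k)
  monics-unique zero    = All.[] AllPairs.∷ AllPairs.[]
  monics-unique (suc k) = UP.cartesianProductWith⁺ _∷_ LP.∷-injective elems-unique (monics-unique k)

  ∈-monics : ∀ a → a ∈ monics (length a)
  ∈-monics []      = here refl
  ∈-monics (c ∷ a) = ∈-cartesianProductWith⁺ _∷_ (∈-elems c) (∈-monics a)

  ∈-monics⁻ : ∀ k {a} → a ∈ monics k → length a ≡ k
  ∈-monics⁻ zero    (here refl) = refl
  ∈-monics⁻ (suc k) m with ∈-cartesianProductWith⁻ _∷_ elems (monics k) m
  ... | c , a , _ , a∈ , refl = cong suc (∈-monics⁻ k a∈)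

  ∈-monics′ : ∀ {k} a → length a ≡ k → a ∈ monics k
  ∈-monics′ a refl = ∈-monics a

  degreesUpTo : ℕ → List (List Carrier)
  degreesUpTo zero    = []
  degreesUpTo (suc n) = degreesUpTo n ++ monics (suc n)

  ∈-degrees : ∀ n a → 1 N.≤ length a → length a N.≤ n → a ∈ degreesUpTo n
  ∈-degrees zero    a 1≤ ≤n = ⊥-elim (NP.n≮0 (NP.≤-trans 1≤ ≤n))
  ∈-degrees (suc n) a 1≤ ≤n with length a N.≟ suc n
  ... | yes e = ∈-++⁺ʳ (degreesUpTo n) (∈-monics′ a e)
  ... | no ne = ∈-++⁺ˡ (∈-degrees n a 1≤ (NP.≤-pred (NP.≤∧≢⇒< ≤n ne)))

  ∈-degrees⁻ : ∀ n {a} → a ∈ degreesUpTo n → 1 N.≤ length a × length a N.≤ n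
  ∈-degrees⁻ (suc n) m with ∈-++⁻ (degreesUpTo n) m
  ... | inj₁ m′ = proj₁ (∈-degrees⁻ n m′) , NP.m≤n⇒m≤1+n (proj₂ (∈-degrees⁻ n m′))
  ... | inj₂ m′ = NP.≤-trans (s≤s z≤n) (NP.≤-reflexive (sym (∈-monics⁻ (suc n) m′))) , NP.≤-reflexive
    (∈-monics⁻ (suc n) m′)

  degrees-unique : ∀ n → Unique (degreesUpTo n)
  degrees-unique zero    = AllPairs.[]
  degrees-unique (suc n) = UP.++⁺ (degrees-unique n) (monics-unique (suc n))
    (λ (m , m′) → NP.<-irrefl refl (NP.≤-trans (NP.≤-reflexive (sym (∈-monics⁻ (suc n) m′)))
      (proj₂ (∈-degrees⁻ n m))))

  ∣-length : ∀ a b → a ∣ᴾ b → length a N.≤ length b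
  ∣-length a b (c , refl) = subst (length a N.≤_) (sym (length-· a c)) (NP.m≤m+n _ _)

  cofactor-length : ∀ a {b} c → a · c ≡ b → length c ≡ length b N.∸ length a
  cofactor-length a c refl = sym (trans (cong (N._∸ length a) (length-· a c))
    (NP.m+n∸m≡n (length a) (length c)))

  _∣ᴾ?_ : ∀ a b → Dec (a ∣ᴾ b)
  a ∣ᴾ? b = Dec.map′ satisfied (λ (c , e) → lose (∈-monics′ c (cofactor-length a c e)) e)
    (any? (λ c → (a · c) ≟ᴸ b) (monics (length b N.∸ length a)))

  irreducible-or-factor : ∀ P → 1 N.≤ length P →
                          Irreducible P ⊎ ∃ λ a → 1 N.≤ length a × length a N.< length P × a ∣ᴾ P
  irreducible-or-factor P 1≤ with any? (_∣ᴾ? P) (degreesUpTo (length P N.∸ 1))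
  ... | yes some with find some
  ... | a , m , a∣P = inj₂ (a , proj₁ (∈-degrees⁻ (length P N.∸ 1) m) ,
      NP.≤-trans (s≤s (proj₂ (∈-degrees⁻ (length P N.∸ 1) m))) (NP.≤-reflexive (NP.m+[n∸m]≡n 1≤)) , a∣P)
  irreducible-or-factor P 1≤ | no none = inj₁ (record { positive = 1≤ ; unsplit = unsplit })
    where
    unsplit : ∀ a b → a · b ≡ P → length a ≡ 0 ⊎ length b ≡ 0
    unsplit []      b e = inj₁ refl
    unsplit a@(_ ∷ _) []        e = inj₂ refl
    unsplit a@(_ ∷ a′) b@(_ ∷ b′) e = ⊥-elim (none (lose (∈-degrees _ a (s≤s z≤n)
      (NP.≤-trans (NP.≤-trans (NP.m≤m+n _ (length b′))
        (NP.≤-reflexive (sym (NP.+-suc (length a′) (length b′)))))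
        (NP.≤-reflexive (cong (N._∸ 1) (trans (sym (length-· a b)) (cong length e)))))) (b , e)))

  irreducible? : ∀ P → Dec (Irreducible P)
  irreducible? [] = no (λ irr → NP.n≮0 (Irreducible.positive irr))
  irreducible? P@(_ ∷ _) with irreducible-or-factor P (s≤s z≤n)
  ... | inj₁ irr = yes irr
  ... | inj₂ (a , 1≤a , a<P , b , e) = no (λ irr →
    [ (λ a0 → NP.n≮0 (NP.≤-trans 1≤a (NP.≤-reflexive a0)))
    , (λ b0 → NP.<-irrefl (trans (sym (NP.+-identityʳ (length a))) (trans (cong (length a N.+_) (sym b0))
        (trans (sym (length-· a b)) (cong length e)))) a<P) ]′ (Irreducible.unsplit irr a b e))

  irreducible-factor : ∀ n g → length g N.≤ n → 1 N.≤ length g → ∃ λ Q → Irreducible Q × Q ∣ᴾ g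
  irreducible-factor zero    g g≤n 1≤g = ⊥-elim (NP.n≮0 (NP.≤-trans 1≤g g≤n))
  irreducible-factor (suc n) g g≤n 1≤g with irreducible-or-factor g 1≤g
  ... | inj₁ irr = g , irr , [] , ·-identityʳ g
  ... | inj₂ (a , 1≤a , a<g , b , e) with irreducible-factor n a (NP.≤-pred (NP.<-≤-trans a<g g≤n)) 1≤a
  ... | Q , irr , c , e′ = Q , irr , c · b , trans (sym (·-assoc Q c b)) (trans (cong (_· b) e′) e)

  pow : List Carrier → ℕ → List Carrier
  pow P zero    = []
  pow P (suc j) = P · pow P j

  length-pow : ∀ P j → length (pow P j) ≡ j N.* length P
  length-pow P zero    = refl
  length-pow P (suc j) = trans (length-· P (pow P j)) (cong (length P N.+_) (length-pow P j))

  ∣-irreducible : ∀ {Q P} → Irreducible Q → Irreducible P → Q ∣ᴾ P → Q ≡ P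
  ∣-irreducible {Q} irQ irP (w , e) with Irreducible.unsplit irP Q w e
  ... | inj₁ Q0 = ⊥-elim (NP.n≮0 (NP.≤-trans (Irreducible.positive irQ) (NP.≤-reflexive Q0)))
  ... | inj₂ w0 = trans (sym (·-identityʳ Q)) (trans (cong (Q ·_) (sym (length-0 w0))) e)

  ∣-pow : ∀ {Q P} → Irreducible Q → Irreducible P → ∀ j → Q ∣ᴾ pow P j → Q ≡ P
  ∣-pow {Q} irQ irP zero    d = ⊥-elim (NP.n≮0 (NP.≤-trans (Irreducible.positive irQ) (∣-length Q [] d)))
  ∣-pow {Q} {P} irQ irP (suc j) d = [ ∣-irreducible irQ irP , ∣-pow irQ irP j ]′ (euclid irQ P (pow P j) d)

  module _ (N : ℕ) where

    -- The exponent of `P` in `g`, for nonconstant `P` and `g` of degree at most `N`, as the number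
    -- of powers of `P` dividing `g`. In this form sums over factorizations become sums over prime
    -- powers.
    valuation : List Carrier → List Carrier → ℤ
    valuation P g = ∑ (upTo N) (λ j → ⟦ pow P (suc j) ∣ᴾ? g ⟧)

    pow-long : ∀ P → 1 N.≤ length P → ∀ j → j N.≤ length (pow P j)
    pow-long P 1≤ j = subst (j N.≤_) (sym (length-pow P j))
      (NP.≤-trans (NP.≤-reflexive (sym (NP.*-identityʳ j))) (NP.*-monoʳ-≤ j 1≤))

    -- `P^(j+1)` divides `P g` exactly when `P^j` divides `g`, so the count shifts by one. It gains
    -- the trivial divisor `P^0` and loses `P^N`, which is too long to divide `g`.
    valuation-same : ∀ P g → 1 N.≤ length P → length g N.< N → valuation P (P · g) ≡ # 1 Z.+ valuation P g
    valuation-same P g 1≤ g<N = begin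
      valuation P (P · g)
        ≡⟨ ∑-cong (upTo N) (λ j → ⟦⟧-⇔ (pow P (suc j) ∣ᴾ? (P · g)) (pow P j ∣ᴾ? g)
             (λ (c , e) → c , ·-cancelˡ P (trans (sym (·-assoc P (pow P j) c)) e))
             (λ (c , e) → c , trans (·-assoc P (pow P j) c) (cong (P ·_) e))) ⟩
      ∑ (upTo N) v ≡⟨ sym (ZP.+-identityʳ _) ⟩
      ∑ (upTo N) v Z.+ # 0 ≡⟨ cong (Z._+_ (∑ (upTo N) v)) (sym (⟦⟧-no (pow P N ∣ᴾ? g) (λ d →
                                            NP.<⇒≱ g<N (NP.≤-trans (pow-long P 1≤ N)
                                              (∣-length (pow P N) g d))))) ⟩
      ∑ (upTo N) v Z.+ v N ≡⟨ ∑-upTo-shift N v ⟩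
      v 0 Z.+ valuation P g ≡⟨ cong (Z._+ valuation P g) (⟦⟧-yes ([] ∣ᴾ? g) (g , refl)) ⟩
      # 1 Z.+ valuation P g ∎
      where
      v : ℕ → ℤ
      v j = ⟦ pow P j ∣ᴾ? g ⟧

    valuation-other : ∀ P Q g → Irreducible P → Irreducible Q → P ≢ Q → valuation P (Q · g) ≡ valuation P g
    valuation-other P Q g irP irQ ne = ∑-cong (upTo N) (λ j →
      ⟦⟧-⇔ (pow P (suc j) ∣ᴾ? (Q · g)) (pow P (suc j) ∣ᴾ? g) (down (suc j)) (up (suc j)))
      where
      swap : ∀ j c → pow P j · (Q · c) ≡ Q · (pow P j · c)
      swap j c = trans (sym (·-assoc (pow P j) Q c))
        (trans (cong (_· c) (·-comm (pow P j) Q)) (·-assoc Q (pow P j) c))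
      up : ∀ j → pow P j ∣ᴾ g → pow P j ∣ᴾ (Q · g)
      up j (c , e) = Q · c , trans (swap j c) (cong (Q ·_) e)
      down : ∀ j → pow P j ∣ᴾ (Q · g) → pow P j ∣ᴾ g
      down j (c , e) with euclid irQ (pow P j) c (g , sym e)
      ... | inj₁ d = ⊥-elim (ne (sym (∣-pow irQ irP j d)))
      ... | inj₂ (c′ , refl) = c′ , ·-cancelˡ Q (trans (sym (swap j c′)) e)

    -- The polynomial von Mangoldt function: a power of an irreducible counts with the degree of the
    -- irreducible.
    weight : List Carrier → ℤ
    weight P = ⟦ irreducible? P ⟧ Z.* # length P

    valuation-· : ∀ P Q g → 1 N.≤ length P → length g N.< N → Irreducible Q →
                  weight P Z.* valuation P (Q · g) ≡ ⟦ P ≟ᴸ Q ⟧ Z.* # length P Z.+ weight P Z.* valuation P g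
    valuation-· P Q g 1≤ g<N irQ = go (irreducible? P) (P ≟ᴸ Q)
      where
      go : (d : Dec (Irreducible P)) (e : Dec (P ≡ Q)) →
           ⟦ d ⟧ Z.* # length P Z.* valuation P (Q · g) ≡
           ⟦ e ⟧ Z.* # length P Z.+ ⟦ d ⟧ Z.* # length P Z.* valuation P g
      go (no n)  (yes refl) = ⊥-elim (n irQ)
      go (no n)  (no _)     = refl
      go (yes _) (yes refl) = trans (cong (Z._*_ (# 1 Z.* # length P)) (valuation-same P g 1≤ g<N))
        (trans (ZP.*-distribˡ-+ (# 1 Z.* # length P) (# 1) (valuation P g))
          (cong (Z._+ # 1 Z.* # length P Z.* valuation P g) (ZP.*-identityʳ (# 1 Z.* # length P))))
      go (yes i) (no ne)    = trans (cong (Z._*_ (# 1 Z.* # length P)) (valuation-other P Q g i irQ ne))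
        (sym (ZP.+-identityˡ _))

    totalDegree : List Carrier → ℤ
    totalDegree g = ∑ (degreesUpTo N) (λ P → weight P Z.* valuation P g)

    -- Induction by splitting off an irreducible factor `Q`: by Euclid's lemma this changes only the
    -- valuation at `Q`, and by one. This additive statement is the form in which unique
    -- factorization enters.
    totalDegree≡length : ∀ g → length g N.≤ N → totalDegree g ≡ # length g
    totalDegree≡length g = go (length g) g NP.≤-refl
      where
      go : ∀ n g → length g N.≤ n → length g N.≤ N → totalDegree g ≡ # length g
      go n [] _ _ = ∑-ε (degreesUpTo N) (λ P m → trans
        (cong (Z._*_ (weight P)) (∑-ε (upTo N) (λ j _ → ⟦⟧-no (pow P (suc j) ∣ᴾ? []) (λ d →
          NP.n≮0 (NP.≤-trans (pow-long P (proj₁ (∈-degrees⁻ N m)) (suc j))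
            (∣-length (pow P (suc j)) [] d))))))
        (ZP.*-zeroʳ (weight P)))
      go (suc n) g@(_ ∷ _) g≤n g≤N with irreducible-factor (length g) g NP.≤-refl (s≤s z≤n)
      ... | Q , irQ , g′ , e = begin
        totalDegree g ≡⟨ cong totalDegree (sym e) ⟩
        totalDegree (Q · g′)
          ≡⟨ ∑-cong∈ (degreesUpTo N) (λ P m → valuation-· P Q g′ (proj₁ (∈-degrees⁻ N m))
            (NP.<-≤-trans g′<g g≤N) irQ) ⟩
        ∑ (degreesUpTo N) (λ P → ⟦ P ≟ᴸ Q ⟧ Z.* # length P Z.+ weight P Z.* valuation P g′)
          ≡⟨ ∑-∙ (degreesUpTo N) _ _ ⟩
        ∑ (degreesUpTo N) (λ P → ⟦ P ≟ᴸ Q ⟧ Z.* # length P) Z.+ totalDegree g′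
          ≡⟨ cong₂ Z._+_ (∑-δ _≟ᴸ_ (degrees-unique N)
               (∈-degrees N Q (Irreducible.positive irQ) (NP.≤-trans (∣-length Q g (g′ , e)) g≤N))
                 (λ P → # length P))
               (go n g′ (NP.≤-pred (NP.<-≤-trans g′<g g≤n)) (NP.≤-trans (NP.<⇒≤ g′<g) g≤N)) ⟩
        # length Q Z.+ # length g′ ≡⟨ cong #_ (sym lengths) ⟩
        # length g ∎
        where
        lengths : length g ≡ length Q N.+ length g′
        lengths = trans (cong length (sym e)) (length-· Q g′)
        g′<g : length g′ N.< length g
        g′<g = subst (length g′ N.<_) (sym lengths) (NP.+-monoˡ-≤ (length g′) (Irreducible.positive irQ))

    -- (P , j) indexes the prime power P^(j+1).
    primePowers : List (List Carrier × ℕ)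
    primePowers = cartesianProductWith _,_ (degreesUpTo N) (upTo N)

    primePower : List Carrier × ℕ → List Carrier
    primePower (P , j) = pow P (suc j)

    -- The analogue of writing `log n` as the sum of the von Mangoldt function over the divisors of
    -- `n`.
    degree-sum : ∀ g → length g N.≤ N →
                 ∑ primePowers (λ i → weight (proj₁ i) Z.* ⟦ primePower i ∣ᴾ? g ⟧) ≡ # length g
    degree-sum g g≤N = trans (∑-cartesian _,_ (degreesUpTo N) (upTo N) _)
      (trans (∑-cong (degreesUpTo N) (λ P → ∑-*ˡ (weight P) (upTo N) _)) (totalDegree≡length g g≤N))

    module _ (X : List Carrier → ℤ) (X-· : ∀ a b → X (a · b) ≡ X a Z.* X b) where

      coefficient : ℕ → ℤ
      coefficient r = ∑ (monics r) X

      logCoefficient : ℕ → ℤ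
      logCoefficient k =
        ∑ primePowers (λ i → weight (proj₁ i) Z.* ⟦ length (primePower i) N.≟ k ⟧ Z.* X (primePower i))

      -- The multiples of `h` of degree `r` are the `h · c` with `c` of degree `r - deg h`. The
      -- right side is spread over all `k`, with an indicator selecting `k + 1 = deg h`, to produce
      -- a convolution.
      ∑-multiples : ∀ h r → 1 N.≤ length h →
        ∑ (monics r) (λ g → ⟦ h ∣ᴾ? g ⟧ Z.* X g) ≡
        X h Z.* ∑ (upTo r) (λ k → ⟦ length h N.≟ suc k ⟧ Z.* coefficient (r N.∸ suc k))
      ∑-multiples h r 1≤ with length h N.≤? r
      ... | no h≰r = trans
        (∑-ε (monics r) (λ g m → cong (Z._* X g) (⟦⟧-no (h ∣ᴾ? g) (λ d →
          h≰r (subst (length h N.≤_) (∈-monics⁻ r m) (∣-length h g d))))))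
        (sym (trans (cong (Z._*_ (X h)) (∑-ε (upTo r) (λ k m → cong (Z._* coefficient (r N.∸ suc k))
          (⟦⟧-no (length h N.≟ suc k) (λ e → h≰r (subst (N._≤ r) (sym e) (∈-upTo⁻ m)))))))
            (ZP.*-zeroʳ (X h))))
      ... | yes h≤r = begin
        ∑ (monics r) (λ g → ⟦ h ∣ᴾ? g ⟧ Z.* X g)
          ≡⟨ ∑-cong∈ (monics r) (λ g m → trans (cong (Z._* X g) (cofactors g (∈-monics⁻ r m)))
            (sym (∑-*ʳ (X g) cs _))) ⟩
        ∑ (monics r) (λ g → ∑ cs (λ c → ⟦ g ≟ᴸ (h · c) ⟧ Z.* X g))
          ≡⟨ ∑-swap (monics r) cs _ ⟩
        ∑ cs (λ c → ∑ (monics r) (λ g → ⟦ g ≟ᴸ (h · c) ⟧ Z.* X g))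
          ≡⟨ ∑-cong∈ cs (λ c m → trans (∑-δ _≟ᴸ_ (monics-unique r) (∈-monics′ (h · c) (multiple-length c m))
            X) (X-· h c)) ⟩
        ∑ cs (λ c → X h Z.* X c)
          ≡⟨ ∑-*ˡ (X h) cs X ⟩
        X h Z.* coefficient (r N.∸ length h)
          ≡⟨ cong (λ k → X h Z.* coefficient (r N.∸ k)) (sym suc-k) ⟩
        X h Z.* coefficient (r N.∸ suc k₀)
          ≡⟨ cong (Z._*_ (X h)) (sym (trans (∑-cong (upTo r) (λ k → cong (Z._* coefficient (r N.∸ suc k))
               (⟦⟧-⇔ (length h N.≟ suc k) (k N.≟ k₀) (λ e → NP.suc-injective (trans (sym e) (sym suc-k)))
                 (λ e → trans (sym suc-k) (cong suc (sym e))))))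
               (∑-δ N._≟_ (UP.upTo⁺ r) (∈-upTo⁺ (subst (N._≤ r) (sym suc-k) h≤r))
                 (λ k → coefficient (r N.∸ suc k))))) ⟩
        X h Z.* ∑ (upTo r) (λ k → ⟦ length h N.≟ suc k ⟧ Z.* coefficient (r N.∸ suc k)) ∎
        where
        cs = monics (r N.∸ length h)
        k₀ = length h N.∸ 1
        suc-k : suc k₀ ≡ length h
        suc-k = NP.m+[n∸m]≡n 1≤
        multiple-length : ∀ c → c ∈ cs → length (h · c) ≡ r
        multiple-length c m = trans (length-· h c)
          (trans (cong (length h N.+_) (∈-monics⁻ _ m)) (NP.m+[n∸m]≡n h≤r))
        cofactors : ∀ g → length g ≡ r → ⟦ h ∣ᴾ? g ⟧ ≡ ∑ cs (λ c → ⟦ g ≟ᴸ (h · c) ⟧)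
        cofactors g lg = go g lg (h ∣ᴾ? g)
          where
          go : ∀ g → length g ≡ r → Dec (h ∣ᴾ g) → ⟦ h ∣ᴾ? g ⟧ ≡ ∑ cs (λ c → ⟦ g ≟ᴸ (h · c) ⟧)
          go g lg (no nd) = trans (⟦⟧-no (h ∣ᴾ? g) nd)
            (sym (∑-ε cs (λ c _ → ⟦⟧-no (g ≟ᴸ (h · c)) (λ e → nd (c , sym e)))))
          go g lg (yes (c₀ , refl)) = trans (⟦⟧-yes (h ∣ᴾ? (h · c₀)) (c₀ , refl))
            (sym (trans (∑-cong cs (λ c → ⟦⟧-⇔ ((h · c₀) ≟ᴸ (h · c)) (c ≟ᴸ c₀)
                (λ e → ·-cancelˡ h (sym e)) (λ e → cong (h ·_) (sym e))))
              (∑-δ1 _≟ᴸ_ (monics-unique (r N.∸ length h))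
                (∈-monics′ c₀ (trans (cofactor-length h c₀ refl) (cong (N._∸ length h) lg))))))

      -- The logarithmic derivative of the Euler product of ∑ X(g) T^deg g.
      log-derivative : ∀ r → r N.≤ N →
        # r Z.* coefficient r ≡ ∑ (upTo r) (λ k → logCoefficient (suc k) Z.* coefficient (r N.∸ suc k))
      log-derivative r r≤N = begin
        # r Z.* coefficient r
          ≡⟨ sym (∑-*ˡ (# r) (monics r) X) ⟩
        ∑ (monics r) (λ g → # r Z.* X g)
          ≡⟨ ∑-cong∈ (monics r) (λ g m → trans
               (cong (Z._* X g) (sym (trans (degree-sum g (subst (N._≤ N) (sym (∈-monics⁻ r m)) r≤N))
                 (cong #_ (∈-monics⁻ r m)))))
               (sym (∑-*ʳ (X g) primePowers _))) ⟩
        ∑ (monics r) (λ g → ∑ primePowers (λ i → w i Z.* ⟦ primePower i ∣ᴾ? g ⟧ Z.* X g))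
          ≡⟨ ∑-swap (monics r) primePowers _ ⟩
        ∑ primePowers (λ i → ∑ (monics r) (λ g → w i Z.* ⟦ primePower i ∣ᴾ? g ⟧ Z.* X g))
          ≡⟨ ∑-cong∈ primePowers (λ i m → trans
            (∑-cong (monics r) (λ g → ZP.*-assoc (w i) ⟦ primePower i ∣ᴾ? g ⟧ (X g)))
               (trans (∑-*ˡ (w i) (monics r) _) (trans
                 (cong (Z._*_ (w i)) (∑-multiples (primePower i) r (positive i m)))
               (trans (sym (ZP.*-assoc (w i) (X (primePower i)) _))
                 (trans (sym (∑-*ˡ (w i Z.* X (primePower i)) (upTo r) _))
               (∑-cong (upTo r) (λ k → rearrange (w i) (X (primePower i)) _ _))))))) ⟩
        ∑ primePowers (λ i → ∑ (upTo r) (λ k → term i (suc k) Z.* coefficient (r N.∸ suc k)))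
          ≡⟨ ∑-swap primePowers (upTo r) _ ⟩
        ∑ (upTo r) (λ k → ∑ primePowers (λ i → term i (suc k) Z.* coefficient (r N.∸ suc k)))
          ≡⟨ ∑-cong (upTo r) (λ k → ∑-*ʳ (coefficient (r N.∸ suc k)) primePowers (λ i → term i (suc k))) ⟩
        ∑ (upTo r) (λ k → logCoefficient (suc k) Z.* coefficient (r N.∸ suc k)) ∎
        where
        w : List Carrier × ℕ → ℤ
        w i = weight (proj₁ i)
        term : List Carrier × ℕ → ℕ → ℤ
        term i k = w i Z.* ⟦ length (primePower i) N.≟ k ⟧ Z.* X (primePower i)
        positive : ∀ i → i ∈ primePowers → 1 N.≤ length (primePower i)
        positive i m with ∈-cartesianProductWith⁻ _,_ (degreesUpTo N) (upTo N) m
        ... | P , j , P∈ , _ , refl = NP.≤-trans (s≤s z≤n) (pow-long P (proj₁ (∈-degrees⁻ N P∈)) (suc j))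
        rearrange : ∀ a b c d → (a Z.* b) Z.* (c Z.* d) ≡ (a Z.* c Z.* b) Z.* d
        rearrange = ZS.solve 4 (λ a b c d → (a ⊗ b) ⊗ (c ⊗ d) ZS.:=
                                               (a ⊗ c ⊗ b) ⊗ d) refl

-- The L-function of the cubic

module Counting {q : ℕ} (K : FiniteField q) (N : ℕ) where

  open FieldTheory K
  open Factorization K
  open ≡-Reasoning

  one : List Carrier → ℤ
  one _ = # 1

  one-coefficient : ∀ r → coefficient N one (λ _ _ → refl) r ≡ (# q) Z.^ r
  one-coefficient zero    = refl
  one-coefficient (suc r) = trans (∑-cartesian _∷_ elems (monics r) one)
    (trans (∑-cong elems (λ _ → one-coefficient r))
      (trans (∑-const ((# q) Z.^ r) elems) (cong (λ n → # n Z.* (# q) Z.^ r) length-elems)))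

  -- With `X = 1` the coefficient in degree `r` is `q^r`, and strong induction in the logarithmic
  -- derivative leaves `(r+1) q^(r+1) = r q^(r+1) + W (r+1)`. This is the count of the elements of
  -- the extension of degree `r + 1` by their minimal polynomials.
  one-logCoefficient : ∀ r → suc r N.≤ N → logCoefficient N one (λ _ _ → refl) (suc r) ≡ (# q) Z.^ suc r
  one-logCoefficient r = strong r r NP.≤-refl
    where
    W c : ℕ → ℤ
    W = logCoefficient N one (λ _ _ → refl)
    c = coefficient N one (λ _ _ → refl)
    strong : ∀ n r → r N.≤ n → suc r N.≤ N → W (suc r) ≡ (# q) Z.^ suc r
    strong n r r≤n r<N = +-cancelˡ (# r Z.* (# q) Z.^ suc r) (begin
      # r Z.* (# q) Z.^ suc r Z.+ W (suc r)
        ≡⟨ cong₂ Z._+_ (trans (cong (λ m → # m Z.* (# q) Z.^ suc r) (sym (LP.length-upTo r)))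
          (sym (∑-const ((# q) Z.^ suc r) (upTo r))))
             (sym (ZP.*-identityʳ (W (suc r)))) ⟩
      ∑ (upTo r) (λ _ → (# q) Z.^ suc r) Z.+ W (suc r) Z.* # 1
        ≡⟨ cong₂ Z._+_ (∑-cong∈ (upTo r) (λ k m → sym (lower n k (∈-upTo⁻ m) r≤n)))
             (cong (Z._*_ (W (suc r))) (sym (trans (one-coefficient (r N.∸ r))
               (cong (Z._^_ (# q)) (NP.n∸n≡0 r))))) ⟩
      ∑ (upTo r) (λ k → W (suc k) Z.* c (suc r N.∸ suc k)) Z.+ W (suc r) Z.* c (suc r N.∸ suc r)
        ≡⟨ sym (∑-upTo-last r _) ⟩
      ∑ (upTo (suc r)) (λ k → W (suc k) Z.* c (suc r N.∸ suc k))
        ≡⟨ sym (log-derivative N one (λ _ _ → refl) (suc r) r<N) ⟩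
      # suc r Z.* c (suc r)
        ≡⟨ cong (Z._*_ (# suc r)) (one-coefficient (suc r)) ⟩
      # suc r Z.* (# q) Z.^ suc r
        ≡⟨ ZS.solve 2 (λ r x → (ZS.con (# 1) ⊕ r) ⊗ x ⊜ r ⊗ x ⊕ x) refl (# r) ((# q) Z.^ suc r) ⟩
      # r Z.* (# q) Z.^ suc r Z.+ (# q) Z.^ suc r ∎)
      where
      lower : ∀ n k → k N.< r → r N.≤ n → W (suc k) Z.* c (suc r N.∸ suc k) ≡ (# q) Z.^ suc r
      lower zero    k k<r r≤n = ⊥-elim (NP.n≮0 (NP.<-≤-trans k<r r≤n))
      lower (suc n) k k<r r≤n = begin
        W (suc k) Z.* c (r N.∸ k) ≡⟨ cong₂ Z._*_ (strong n k (NP.≤-pred (NP.<-≤-trans k<r r≤n))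
                                                    (NP.≤-trans (NP.m≤n⇒m≤1+n k<r) r<N))
                                                      (one-coefficient (r N.∸ k)) ⟩
        (# q) Z.^ suc k Z.* (# q) Z.^ (r N.∸ k) ≡⟨ sym (ZP.^-distribˡ-+-* (# q) (suc k) (r N.∸ k)) ⟩
        (# q) Z.^ (suc k N.+ (r N.∸ k))
          ≡⟨ cong (λ m → (# q) Z.^ suc m) (NP.m+[n∸m]≡n (NP.<⇒≤ k<r)) ⟩
        (# q) Z.^ suc r ∎

module LFunction {q : ℕ} (K : FiniteField q) (k : ℕ) (q≡ : q ≡ suc (2 N.* suc k))
  (d : FiniteField.Carrier K) (d≢0 : d ≢ FiniteField.0# K) (d≢1 : d ≢ FiniteField.1# K) where

  open FieldTheory K
  open Character K k q≡
  open Polynomials K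
  open Factorization K
  open ≡-Reasoning

  1-d≢0 : 1# + - d ≢ 0#
  1-d≢0 e = d≢1 (sym (x-y≡0⇒x≡y e))

  -1≢0 : - 1# ≢ 0#
  -1≢0 e = 0≢1 (sym (trans (sym (-‿involutive 1#)) (trans (cong -_ e) -0#≈0#)))

  -- For g = ∏ (T - uᵢ) the argument of χ is ∏ (0 - uᵢ)(-1 - uᵢ)(-d - uᵢ).
  values : List Carrier → Carrier
  values g = eval g 0# * eval g (- 1#) * eval g (- d)

  X : List Carrier → ℤ
  X g = χ (values g)

  X-· : ∀ a b → X (a · b) ≡ X a Z.* X b
  X-· a b = trans (cong χ (begin
    eval (a · b) 0# * eval (a · b) (- 1#) * eval (a · b) (- d)
      ≡⟨ cong₂ _*_ (cong₂ _*_ (eval-· a b 0#) (eval-· a b (- 1#))) (eval-· a b (- d)) ⟩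
    (eval a 0# * eval b 0#) * (eval a (- 1#) * eval b (- 1#)) * (eval a (- d) * eval b (- d))
      ≡⟨ solve 6 (λ a b c d e f → (a :* b) :* (c :* d) :* (e :* f) := (a :* c :* e) :* (b :* d :* f)) refl _
        _ _ _ _ _ ⟩
    values a * values b ∎)) (χ-* (values a) (values b))

  X-[] : X [] ≡ # 1
  X-[] = trans (cong χ (solve 0 (:1 :* :1 :* :1 := :1) refl)) χ-1

  c : ℕ → ℤ
  c r = ∑ (monics r) X

  c₀ : c 0 ≡ # 1
  c₀ = trans (ZP.+-identityʳ (X [])) X-[]

  ∑-χ-vanish : ∀ r s t → ∑ elems (λ x → χ (r * ((d * (d + - 1#)) * x + s) * t)) ≡ # 0
  ∑-χ-vanish r s t = trans (∑-cong elems
    (λ x → trans (cong χ (solve 3 (λ r y t → r :* y :* t := (r :* t) :* y) refl r _ t)) (χ-* (r * t) _)))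
    (trans (∑-*ˡ (χ (r * t)) elems _) (trans
      (cong (Z._*_ (χ (r * t))) (∑χ-affine (*-≢0 d≢0 (λ e → d≢1 (x-y≡0⇒x≡y e))) s)) (ZP.*-zeroʳ (χ (r * t)))))

  -- From degree 3 on, the three lowest coefficients can be traded for the values at 0, -1 and `-d`;
  -- summing `χ` over a freely varying value gives 0.
  c-vanish : ∀ r → c (suc (suc (suc r))) ≡ # 0
  c-vanish r = trans (∑-cartesian _∷_ elems _ X) (∑-ε elems (λ a₀ _ → begin
    ∑ (monics (suc (suc r))) (λ g → X (a₀ ∷ g))
      ≡⟨ trans (∑-cartesian _∷_ elems _ _)
        (∑-cong elems (λ a₁ → trans (∑-cartesian _∷_ elems _ _) (∑-swap elems (monics r) _))) ⟩
    ∑ elems (λ a₁ → ∑ (monics r) (λ g → ∑ elems (λ a₂ → X (a₀ ∷ a₁ ∷ a₂ ∷ g))))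
      ≡⟨ ∑-swap elems (monics r) _ ⟩
    ∑ (monics r) (λ g → ∑ elems (λ a₁ → ∑ elems (λ a₂ → X (a₀ ∷ a₁ ∷ a₂ ∷ g))))
      ≡⟨ ∑-ε (monics r) (λ g _ → vanish a₀ g) ⟩
    # 0 ∎))
    where
    vanish : ∀ a₀ g → ∑ elems (λ a₁ → ∑ elems (λ a₂ → X (a₀ ∷ a₁ ∷ a₂ ∷ g))) ≡ # 0
    vanish a₀ g = begin
      ∑ elems (λ a₁ → ∑ elems (λ a₂ → X (a₀ ∷ a₁ ∷ a₂ ∷ g)))
        ≡⟨ ∑-swap elems elems _ ⟩
      ∑ elems (λ a₂ → ∑ elems (λ a₁ → X (a₀ ∷ a₁ ∷ a₂ ∷ g)))
        -- The new variable `b` replacing `a₁` is the value at -1, which is `a₀ - a₁ + a₂ - G₁`.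
        ≡⟨ ∑-cong elems (λ a₂ → sym (∑-affine -1≢0 (a₀ + a₂ + - G₁) (λ a₁ → X (a₀ ∷ a₁ ∷ a₂ ∷ g)))) ⟩
      ∑ elems (λ a₂ → ∑ elems (λ b → X (a₀ ∷ (- 1# * b + (a₀ + a₂ + - G₁)) ∷ a₂ ∷ g)))
        ≡⟨ ∑-swap elems elems _ ⟩
      ∑ elems (λ b → ∑ elems (λ a₂ → X (a₀ ∷ (- 1# * b + (a₀ + a₂ + - G₁)) ∷ a₂ ∷ g)))
        -- For fixed `a₀` and `b` the value at `-d` is affine in `a₂` with slope `d (d - 1)`, which
        -- is nonzero.
        ≡⟨ ∑-ε elems (λ b _ → trans (∑-cong elems (λ a₂ → cong χ (expand b a₂))) (∑-χ-vanish (a₀ * b) _ 1#)) ⟩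
      # 0 ∎
      where
      G₀ = eval g 0#
      G₁ = eval g (- 1#)
      G₂ = eval g (- d)
      expand : ∀ b a₂ → values (a₀ ∷ (- 1# * b + (a₀ + a₂ + - G₁)) ∷ a₂ ∷ g) ≡
        a₀ * b * ((d * (d + - 1#)) * a₂ + (a₀ + - d * (- b + a₀ + - G₁) + - d * (- d * (- d * G₂)))) * 1#
      expand b a₂ = solve 7 (λ a₀ b a₂ d G₀ G₁ G₂ →
        let a₁ = :- :1 :* b :+ (a₀ :+ a₂ :- G₁) in
        (a₀ :+ :0 :* (a₁ :+ :0 :* (a₂ :+ :0 :* G₀))) :* (a₀ :+ :- :1 :* (a₁ :+ :- :1 :* (a₂ :+ :- :1 :* G₁)))
          :* (a₀ :+ :- d :* (a₁ :+ :- d :* (a₂ :+ :- d :* G₂)))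
        := a₀ :* b :* ((d :* (d :- :1)) :* a₂ :+
          (a₀ :+ :- d :* (:- b :+ a₀ :- G₁) :+ :- d :* (:- d :* (:- d :* G₂)))) :* :1)
        refl a₀ b a₂ d G₀ G₁ G₂

  -- For `T^2 + b T + a` the values at 0, -1 and `-d` satisfy one linear relation. Scaled suitably,
  -- they are `x`, `y` and `x + y - 1` up to a square factor in the product, which gives a sum of
  -- Jacobi type.
  c₂ : c 2 ≡ # q
  c₂ = begin
    c 2
      ≡⟨ trans (∑-cartesian _∷_ elems _ X)
        (∑-cong elems (λ a → trans (∑-cartesian _∷_ elems _ _) (∑-cong elems (λ b → ZP.+-identityʳ _)))) ⟩
    ∑ elems (λ a → ∑ elems (λ b → X (a ∷ b ∷ [])))
      ≡⟨ ∑-cong elems (λ a → sym (∑-affine -1≢0 (a + 1#) (λ b → X (a ∷ b ∷ [])))) ⟩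
    ∑ elems (λ a → ∑ elems (λ b → X (a ∷ (- 1# * b + (a + 1#)) ∷ [])))
      -- The scalings `a = d x` and, next, value at -1 equal to `(1 - d) y` make the value at `-d`
      -- equal to `d (1 - d) (x + y - 1)`; the constants then combine to the square of `d (1 - d)`.
      ≡⟨ sym (∑-affine d≢0 0# _) ⟩
    ∑ elems (λ x → ∑ elems (λ b → X ((d * x + 0#) ∷ (- 1# * b + ((d * x + 0#) + 1#)) ∷ [])))
      ≡⟨ ∑-cong elems (λ x → sym (∑-affine 1-d≢0 0# _)) ⟩
    ∑ elems (λ x → ∑ elems (λ y → X ((d * x + 0#) ∷ (- 1# * ((1# + - d) * y + 0#) + ((d * x + 0#) + 1#)) ∷
      [])))
      ≡⟨ ∑-cong elems (λ x → trans (∑-cong elems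
        (λ y → trans (cong χ (expand x y)) (trans (χ-sq-* (*-≢0 d≢0 1-d≢0) _) (χ-* x _))))
           (∑-*ˡ (χ x) elems _)) ⟩
    ∑ elems (λ x → χ x Z.* Jac x)
      ≡⟨ sym (ZP.+-identityʳ _) ⟩
    ∑ elems (λ x → χ x Z.* Jac x) Z.+ # 0
      -- The vanishing sum of `χ` is added to supply the 1 of `∑χ-quadratic`; afterwards only
      -- `x = 1` contributes.
      ≡⟨ cong (Z._+_ (∑ elems (λ x → χ x Z.* Jac x))) (sym ∑χ≡0) ⟩
    ∑ elems (λ x → χ x Z.* Jac x) Z.+ ∑ elems χ
      ≡⟨ sym (∑-∙ elems _ _) ⟩
    ∑ elems (λ x → χ x Z.* Jac x Z.+ χ x)
      ≡⟨ ∑-cong elems (λ x → begin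
           χ x Z.* Jac x Z.+ χ x
             ≡⟨ ZS.solve 2 (λ a b → a ⊗ b ⊕ a ⊜ a ⊗ (b ⊕ ZS.con (# 1))) refl (χ x) (Jac x) ⟩
           χ x Z.* (Jac x Z.+ # 1)
             ≡⟨ cong (Z._*_ (χ x)) (trans (∑χ-quadratic (x + - 1#)) (cong (Z._*_ (# q))
                                                             (⟦⟧-⇔ ((x + - 1#) ≟ 0#) (x ≟ 1#) x-y≡0⇒x≡y
                                                               (λ { refl → -‿inverseʳ 1# })))) ⟩
           χ x Z.* (# q Z.* ⟦ x ≟ 1# ⟧)
             ≡⟨ ZS.solve 3 (λ a b c → a ⊗ (b ⊗ c) ⊜ c ⊗ (b ⊗ a)) refl (χ x) (# q) ⟦ x ≟ 1# ⟧ ⟩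
           ⟦ x ≟ 1# ⟧ Z.* (# q Z.* χ x) ∎) ⟩
    ∑ elems (λ x → ⟦ x ≟ 1# ⟧ Z.* (# q Z.* χ x))
      ≡⟨ ∑-δ _≟_ elems-unique (∈-elems 1#) (λ x → # q Z.* χ x) ⟩
    # q Z.* χ 1#
      ≡⟨ trans (cong (Z._*_ (# q)) χ-1) (ZP.*-identityʳ (# q)) ⟩
    # q ∎
    where
    Jac : Carrier → ℤ
    Jac x = ∑ elems (λ y → χ (y * (y + (x + - 1#))))
    expand : ∀ x y → values ((d * x + 0#) ∷ (- 1# * ((1# + - d) * y + 0#) + ((d * x + 0#) + 1#)) ∷ []) ≡
      (d * (1# + - d)) * (d * (1# + - d)) * (x * (y * (y + (x + - 1#))))
    expand x y = solve 3 (λ x y d →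
      let a = d :* x :+ :0 ; b = :- :1 :* ((:1 :- d) :* y :+ :0) :+ (a :+ :1) in
      (a :+ :0 :* (b :+ :0 :* :1)) :* (a :+ :- :1 :* (b :+ :- :1 :* :1)) :* (a :+ :- d :* (b :+ :- d :* :1))
      := (d :* (:1 :- d)) :* (d :* (:1 :- d)) :* (x :* (y :* (y :+ (x :- :1))))) refl x y d

  module LogCoefficients (c₁ : c 1 ≡ # 0) (N : ℕ) where

    W : ℕ → ℤ
    W = logCoefficient N X X-·

    W₁ : 1 N.≤ N → W 1 ≡ # 0
    W₁ 1≤N = begin
      W 1 ≡⟨ sym (trans (cong (Z._*_ (W 1)) c₀) (ZP.*-identityʳ (W 1))) ⟩
      W 1 Z.* c 0 ≡⟨ sym (ZP.+-identityʳ _) ⟩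
      W 1 Z.* c 0 Z.+ # 0 ≡⟨ sym (log-derivative N X X-· 1 1≤N) ⟩
      # 1 Z.* c 1 ≡⟨ cong (Z._*_ (# 1)) c₁ ⟩
      # 0 ∎

    W₂ : 2 N.≤ N → W 2 ≡ # 2 Z.* # q
    W₂ 2≤N = begin
      W 2
        ≡⟨ ZS.solve 2 (λ a b → b ⊜ a ⊗ ZS.con (# 0) ⊕ (b ⊗ ZS.con (# 1) ⊕ ZS.con (# 0))) refl (W 1) (W 2) ⟩
      W 1 Z.* # 0 Z.+ (W 2 Z.* # 1 Z.+ # 0)
        ≡⟨ sym (cong₂ (λ a b → W 1 Z.* a Z.+ (W 2 Z.* b Z.+ # 0)) c₁ c₀) ⟩
      W 1 Z.* c 1 Z.+ (W 2 Z.* c 0 Z.+ # 0) ≡⟨ sym (log-derivative N X X-· 2 2≤N) ⟩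
      # 2 Z.* c 2 ≡⟨ cong (Z._*_ (# 2)) c₂ ⟩
      # 2 Z.* # q ∎

    -- With `c 0 = 1`, `c 1 = 0`, `c 2 = q` and all later coefficients 0, the convolution reduces to
    -- `W (s+3) + q W (s+1) = 0`. This is the recurrence of the negated power sums of the two square
    -- roots of `-q`.
    W-step : ∀ s → suc (suc (suc s)) N.≤ N → W (suc (suc (suc s))) ≡ Z.- (# q) Z.* W (suc s)
    W-step s ≤N = +-cancelˡ (W (suc s) Z.* # q) (begin
      W (suc s) Z.* # q Z.+ W (3 N.+ s)
        ≡⟨ ZS.solve 4 (λ a b c q → a ⊗ q ⊕ b ⊜ ((ZS.con (# 0) ⊕ a ⊗ q) ⊕ c ⊗ ZS.con (# 0)) ⊕ b ⊗ ZS.con (# 1))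
             refl (W (suc s)) (W (3 N.+ s)) (W (2 N.+ s)) (# q) ⟩
      ((# 0 Z.+ W (suc s) Z.* # q) Z.+ W (2 N.+ s) Z.* # 0) Z.+ W (3 N.+ s) Z.* # 1
        ≡⟨ cong₂ Z._+_ (cong₂ Z._+_ (cong₂ Z._+_
          (sym (∑-ε (upTo s) (λ k m → trans (cong (Z._*_ (W (suc k))) (tail k (∈-upTo⁻ m)))
          (ZP.*-zeroʳ (W (suc k)))))) 
             (cong (Z._*_ (W (suc s))) (sym (trans (cong c (NP.m+n∸n≡m 2 s)) c₂))))
             (cong (Z._*_ (W (2 N.+ s))) (sym (trans (cong c (NP.m+n∸n≡m 1 s)) c₁))))
             (cong (Z._*_ (W (3 N.+ s))) (sym (trans (cong c (NP.n∸n≡0 s)) c₀))) ⟩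
      ((∑ (upTo s) f Z.+ f s) Z.+ f (suc s)) Z.+ f (suc (suc s))
        ≡⟨ sym (trans (∑-upTo-last (suc (suc s)) f)
          (cong (Z._+ f (suc (suc s))) (trans (∑-upTo-last (suc s) f)
          (cong (Z._+ f (suc s)) (∑-upTo-last s f))))) ⟩
      ∑ (upTo (3 N.+ s)) f
        ≡⟨ sym (log-derivative N X X-· (3 N.+ s) ≤N) ⟩
      # (3 N.+ s) Z.* c (3 N.+ s)
        ≡⟨ trans (cong (Z._*_ (# (3 N.+ s))) (c-vanish s)) (ZP.*-zeroʳ (# (3 N.+ s))) ⟩
      # 0
        ≡⟨ ZS.solve 2 (λ a q → ZS.con (# 0) ⊜ a ⊗ q ⊕ ⊝ q ⊗ a) refl (W (suc s)) (# q) ⟩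
      W (suc s) Z.* # q Z.+ Z.- (# q) Z.* W (suc s) ∎)
      where
      f : ℕ → ℤ
      f k = W (suc k) Z.* c (3 N.+ s N.∸ suc k)
      tail : ∀ k → k N.< s → c (2 N.+ s N.∸ k) ≡ # 0
      tail k k<s = trans (cong c (trans (NP.+-∸-assoc 2 (NP.<⇒≤ k<s))
        (cong (2 N.+_) (sym (NP.m+[n∸m]≡n {1} (NP.m<n⇒0<n∸m k<s))))))
        (c-vanish (s N.∸ k N.∸ 1))

    W-odd : ∀ m → suc (2 N.* m) N.≤ N → W (suc (2 N.* m)) ≡ # 0
    W-odd zero    ≤N = W₁ ≤N
    W-odd (suc m) ≤N = subst (λ n → suc n N.≤ N → W (suc n) ≡ # 0) (sym (NP.*-suc 2 m))
      (λ ≤N → trans (W-step (2 N.* m) ≤N) (trans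
        (cong (Z._*_ (Z.- (# q))) (W-odd m (NP.≤-trans (NP.m≤n+m _ 2) ≤N))) (ZP.*-zeroʳ (Z.- (# q))))) ≤N

    W-even : ∀ m → 2 N.* suc m N.≤ N → W (2 N.* suc m) ≡ Z.- (# 2) Z.* (Z.- (# q)) Z.^ suc m
    W-even zero    ≤N = trans (W₂ ≤N) (ZS.solve 1
      (λ q → ZS.con (# 2) ⊗ q ⊜ ⊝ ZS.con (# 2) ⊗ (⊝ q ⊗ ZS.con (# 1))) refl (# q))
    W-even (suc m) ≤N = subst (λ n → n N.≤ N → W n ≡ Z.- (# 2) Z.* (Z.- (# q)) Z.^ suc (suc m))
      (trans (cong (2 N.+_) (sym (NP.*-suc 2 m))) (sym (NP.*-suc 2 (suc m))))
      (λ ≤N → trans (W-step (suc (2 N.* m)) ≤N) (trans (cong (Z._*_ (Z.- (# q)))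
        (trans (cong W (sym (NP.*-suc 2 m)))
          (W-even m (NP.≤-trans (NP.≤-reflexive (NP.*-suc 2 m)) (NP.≤-trans (NP.m≤n+m _ 2) ≤N)))))
        (ZS.solve 3 (λ q a x → q ⊗ (a ⊗ x) ⊜ a ⊗ (q ⊗ x)) refl (Z.- (# q)) (Z.- (# 2))
          ((Z.- (# q)) Z.^ suc m))))
      ≤N

-- Frobenius

absorption : ∀ n k → suc k N.* (suc n C suc k) ≡ suc n N.* (n C k)
absorption zero    zero    = refl
absorption zero    (suc k) = trans (cong (suc (suc k) N.*_) (k>n⇒nCk≡0 (s≤s (s≤s (z≤n {k})))))
  (trans (NP.*-zeroʳ (suc (suc k))) (cong (λ t → t N.+ 0) (sym (k>n⇒nCk≡0 (s≤s (z≤n {k}))))))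
absorption (suc n) zero    = begin
  1 N.* (suc (suc n) C 1) ≡⟨ NP.*-identityˡ _ ⟩
  suc (suc n) C 1 ≡⟨ sym (nCk+nC[k+1]≡[n+1]C[k+1] (suc n) 0) ⟩
  1 N.+ (suc n C 1) ≡⟨ cong (1 N.+_) (trans (sym (NP.*-identityˡ _)) (absorption n 0)) ⟩
  1 N.+ suc n N.* 1 ∎
  where open ≡-Reasoning
absorption (suc n) (suc k) = begin
  suc (suc k) N.* (suc (suc n) C suc (suc k))
    ≡⟨ cong (suc (suc k) N.*_) (sym (nCk+nC[k+1]≡[n+1]C[k+1] (suc n) (suc k))) ⟩
  suc (suc k) N.* (u N.+ v)
    ≡⟨ NP.*-distribˡ-+ (suc (suc k)) u v ⟩
  (u N.+ suc k N.* u) N.+ suc (suc k) N.* v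
    ≡⟨ cong₂ (λ a b → (u N.+ a) N.+ b) (absorption n k) (absorption n (suc k)) ⟩
  (u N.+ suc n N.* (n C k)) N.+ suc n N.* (n C suc k)
    ≡⟨ NP.+-assoc u _ _ ⟩
  u N.+ (suc n N.* (n C k) N.+ suc n N.* (n C suc k))
    ≡⟨ cong (u N.+_) (trans (sym (NP.*-distribˡ-+ (suc n) (n C k) (n C suc k)))
      (cong (suc n N.*_) (nCk+nC[k+1]≡[n+1]C[k+1] n k))) ⟩
  u N.+ suc n N.* u ∎
  where
  open ≡-Reasoning
  u = suc n C suc k
  v = suc n C suc (suc k)

-- By `absorption` the prime divides `(k+1)` times the binomial coefficient, and it is too large to
-- divide `k+1`.
prime∣choose : ∀ {n} → Prime (suc n) → ∀ k → k N.< n → suc n ∣ (suc n C suc k)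
prime∣choose {n} pr k k<n = [ (λ d → ⊥-elim (NP.<⇒≱ (s≤s k<n) (∣⇒≤ d))) , (λ d → d) ]′
  (euclidsLemma (suc k) (suc n C suc k) pr (subst (suc n ∣_) (sym (absorption n k)) (m∣m*n (n C k))))

module Binomial {q : ℕ} (K : FiniteField q) where

  open FieldTheory K
  open ≡-Reasoning
  open import Algebra.Properties.CommutativeSemiring.Binomial commutativeSemiring using (theorem)
  open import Algebra.Properties.Semiring.Mult semiring renaming (_×_ to _×ᴷ_) using ()
  open import Algebra.Properties.Semiring.Sum semiring using () renaming (sum to sumᶠ)

  ×≡ι* : ∀ n x → n ×ᴷ x ≡ ι n * x
  ×≡ι* zero    x = sym (zeroˡ x)
  ×≡ι* (suc n) x = trans (cong₂ _+_ (sym (*-identityˡ x)) (×≡ι* n x)) (sym (distribʳ x 1# (ι n)))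

  sumᶠ≡∑ : ∀ n (f : ℕ → Carrier) → sumᶠ {n} (λ i → f (Fin.toℕ i)) ≡ ∑ᴷ (upTo n) f
  sumᶠ≡∑ zero    f = refl
  sumᶠ≡∑ (suc n) f = trans (cong (f 0 +_) (sumᶠ≡∑ n (f ∘ suc))) (sym (∑ᴷ-upTo-suc n f))

  binomial : ∀ n x y → (x + y) ^ n ≡ ∑ᴷ (upTo (suc n)) (λ k → ι (n C k) * (x ^ k * y ^ (n N.∸ k)))
  binomial n x y = trans (theorem n x y) (trans (sumᶠ≡∑ (suc n) (λ k → (n C k) ×ᴷ (x ^ k * y ^ (n N.∸ k))))
    (∑ᴷ-cong (upTo (suc n)) (λ k → ×≡ι* (n C k) _)))

module Frobenius {q : ℕ} (K : FiniteField q) (p : ℕ) (pr : Prime p)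
  (ι-p : FiniteField.ι K p ≡ FiniteField.0# K) where

  open FieldTheory K
  open Binomial K
  open ≡-Reasoning

  ι-∣ : ∀ {m} → p ∣ m → ι m ≡ 0#
  ι-∣ (divides k refl) = trans (ι-* k p) (trans (cong (ι k *_) ι-p) (zeroʳ (ι k)))

  frobenius-+ : ∀ x y → (x + y) ^ p ≡ x ^ p + y ^ p
  frobenius-+ x y = go p pr ι-∣
    where
    go : ∀ p → Prime p → (∀ {m} → p ∣ m → ι m ≡ 0#) → (x + y) ^ p ≡ x ^ p + y ^ p
    go (suc n) pr kill = begin
      (x + y) ^ suc n ≡⟨ binomial (suc n) x y ⟩
      ∑ᴷ (upTo (suc (suc n))) f ≡⟨ ∑ᴷ-upTo-last (suc n) f ⟩
      ∑ᴷ (upTo (suc n)) f + f (suc n) ≡⟨ cong (_+ f (suc n)) (∑ᴷ-upTo-suc n f) ⟩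
      (f 0 + ∑ᴷ (upTo n) (f ∘ suc)) + f (suc n)
        ≡⟨ cong₂ (λ s c → (f 0 + s) + ι c * (x ^ suc n * y ^ (n N.∸ n)))
             (∑ᴷ-0 (upTo n) (λ k m → trans (cong (_* (x ^ suc k * y ^ (n N.∸ k)))
               (kill (prime∣choose pr k (∈-upTo⁻ m)))) (zeroˡ _)))
             (nCn≡1 (suc n)) ⟩
      (f 0 + 0#) + ι 1 * (x ^ suc n * y ^ (n N.∸ n))
        ≡⟨ cong (λ k → (f 0 + 0#) + ι 1 * (x ^ suc n * y ^ k)) (NP.n∸n≡0 n) ⟩
      ((1# + 0#) * (1# * y ^ suc n) + 0#) + (1# + 0#) * (x ^ suc n * 1#)
        ≡⟨ solve 2 (λ a b → ((:1 :+ :0) :* (:1 :* b) :+ :0) :+ (:1 :+ :0) :* (a :* :1) := a :+ b) refl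
          (x ^ suc n) (y ^ suc n) ⟩
      x ^ suc n + y ^ suc n ∎
      where
      f : ℕ → Carrier
      f k = ι (suc n C k) * (x ^ k * y ^ (suc n N.∸ k))

  -- The `i`-th iterate of Frobenius, written as a single power, so that in a field of `p^n`
  -- elements its `n`-th iterate is the identity by `fermat` as it stands.
  conj : ℕ → Carrier → Carrier
  conj i x = x ^ (p N.^ i)

  conj-zero : ∀ x → conj 0 x ≡ x
  conj-zero x = trans (*-comm x 1#) (*-identityˡ x)

  conj-∘ : ∀ i j x → conj (i N.+ j) x ≡ conj i (conj j x)
  conj-∘ i j x = begin
    x ^ (p N.^ (i N.+ j))
      ≡⟨ cong (x ^_) (trans (cong (p N.^_) (NP.+-comm i j)) (NP.^-distribˡ-+-* p j i)) ⟩
    x ^ (p N.^ j N.* p N.^ i) ≡⟨ sym (^-assocʳ x (p N.^ j) (p N.^ i)) ⟩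
    (x ^ (p N.^ j)) ^ (p N.^ i) ∎

  conj-1 : ∀ x → conj 1 x ≡ x ^ p
  conj-1 x = cong (x ^_) (NP.*-identityʳ p)

  conj-+ : ∀ i x y → conj i (x + y) ≡ conj i x + conj i y
  conj-+ zero    x y = trans (conj-zero _) (sym (cong₂ _+_ (conj-zero x) (conj-zero y)))
  conj-+ (suc i) x y = begin
    conj (1 N.+ i) (x + y) ≡⟨ trans (conj-∘ 1 i (x + y)) (conj-1 _) ⟩
    conj i (x + y) ^ p ≡⟨ cong (_^ p) (conj-+ i x y) ⟩
    (conj i x + conj i y) ^ p ≡⟨ frobenius-+ _ _ ⟩
    conj i x ^ p + conj i y ^ p
      ≡⟨ sym (cong₂ _+_ (trans (conj-∘ 1 i x) (conj-1 _)) (trans (conj-∘ 1 i y) (conj-1 _))) ⟩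
    conj (suc i) x + conj (suc i) y ∎

  conj-* : ∀ i x y → conj i (x * y) ≡ conj i x * conj i y
  conj-* i x y = ^-distrib-* x y (p N.^ i)

record FieldHom {q q′ : ℕ} (A : FiniteField q) (B : FiniteField q′) : Set where
  private
    module A = FiniteField A
    module B = FiniteField B
  field
    σ   : A.Carrier → B.Carrier
    σ-+ : ∀ x y → σ (x A.+ y) ≡ σ x B.+ σ y
    σ-* : ∀ x y → σ (x A.* y) ≡ σ x B.* σ y
    σ-1 : σ A.1# ≡ B.1#

module Hom {q q′ : ℕ} {A : FiniteField q} {B : FiniteField q′} (hom : FieldHom A B) where

  open FieldHom hom public
  private module A = FieldTheory A
  open FieldTheory B
  open ≡-Reasoning

  σ-0 : σ A.0# ≡ 0#
  σ-0 = begin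
    σ A.0# ≡⟨ solve 1 (λ x → x := (x :+ x) :- x) refl (σ A.0#) ⟩
    (σ A.0# + σ A.0#) + - σ A.0#
      ≡⟨ cong (_+ - σ A.0#) (sym (trans (cong σ (sym (A.+-identityˡ A.0#))) (σ-+ _ _))) ⟩
    σ A.0# + - σ A.0# ≡⟨ -‿inverseʳ _ ⟩
    0# ∎

  σ-neg : ∀ x → σ (A.- x) ≡ - σ x
  σ-neg x = begin
    σ (A.- x) ≡⟨ solve 2 (λ y z → y := (z :+ y) :- z) refl (σ (A.- x)) (σ x) ⟩
    (σ x + σ (A.- x)) + - σ x
      ≡⟨ cong (_+ - σ x) (trans (sym (σ-+ x (A.- x))) (trans (cong σ (A.-‿inverseʳ x)) σ-0)) ⟩
    0# + - σ x ≡⟨ +-identityˡ _ ⟩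
    - σ x ∎

  σ-injective : ∀ {x y} → σ x ≡ σ y → x ≡ y
  σ-injective {x} {y} e with (x A.+ A.- y) A.≟ A.0#
  ... | yes z = A.x-y≡0⇒x≡y z
  ... | no ne = ⊥-elim (0≢1 (begin
    0# ≡⟨ sym (zeroˡ _) ⟩
    0# * σ (A.inv (x A.+ A.- y))
      ≡⟨ cong (_* _) (sym (trans (σ-+ x (A.- y)) (trans (cong₂ _+_ e (σ-neg y)) (-‿inverseʳ (σ y))))) ⟩
    σ (x A.+ A.- y) * σ (A.inv (x A.+ A.- y)) ≡⟨ trans (sym (σ-* _ _)) (cong σ (A.*-inv ne)) ⟩
    σ A.1# ≡⟨ σ-1 ⟩
    1# ∎))

  σ-ι : ∀ n → σ (A.ι n) ≡ ι n
  σ-ι zero    = σ-0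
  σ-ι (suc n) = trans (σ-+ _ _) (cong₂ _+_ σ-1 (σ-ι n))

  σ-cast : ∀ i → σ (A.cast i) ≡ cast i
  σ-cast (# n)     = σ-ι n
  σ-cast -[1+ n ]  = trans (σ-neg _) (cong -_ (σ-ι (suc n)))

  σ-^ : ∀ x n → σ (x A.^ n) ≡ σ x ^ n
  σ-^ x zero    = σ-1
  σ-^ x (suc n) = trans (σ-* _ _) (cong (σ x *_) (σ-^ x n))

  eval-map : ∀ a x → eval (map σ a) (σ x) ≡ σ (A.eval a x)
  eval-map []      x = sym σ-1
  eval-map (c ∷ a) x = trans (cong (λ t → σ c + σ x * t) (eval-map a x))
    (sym (trans (σ-+ _ _) (cong (σ c +_) (σ-* _ _))))

-- Conjugates over the prime field

least : (P : ℕ → Set) → (∀ i → Dec (P i)) → ∀ n → P n →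
        ∃ λ m → m N.≤ n × P m × (∀ i → i N.< m → ¬ P i)
least P P? n Pn with P? 0
... | yes P0 = 0 , z≤n , P0 , λ i ()
least P P? zero    Pn | no ¬P0 = ⊥-elim (¬P0 Pn)
least P P? (suc n) Pn | no ¬P0 with least (P ∘ suc) (P? ∘ suc) n Pn
... | m , m≤n , Pm , min = suc m , s≤s m≤n , Pm , λ { zero _ → ¬P0 ; (suc i) (s≤s i<m) → min i i<m }

module HomPolynomials {q q′ : ℕ} {A : FiniteField q} {B : FiniteField q′} (hom : FieldHom A B) where

  open Hom hom public
  private
    module PA = Polynomials A
    module PB = Polynomials B

  map-addMul : ∀ y κ w → map σ (PA.addMul y κ w) ≡ PB.addMul (map σ y) (σ κ) (map σ w)
  map-addMul []      κ w       = refl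
  map-addMul (c ∷ y) κ []      = cong (_∷ map σ y) (σ-+ c κ)
  map-addMul (c ∷ y) κ (e ∷ w) = cong₂ _∷_ (trans (σ-+ c _) (cong (FiniteField._+_ B (σ c)) (σ-* κ e)))
    (map-addMul y κ w)

  map-· : ∀ a b → map σ (a PA.· b) ≡ map σ a PB.· map σ b
  map-· []      b = refl
  map-· (c ∷ a) b = trans (map-addMul _ c b)
    (cong (λ t → PB.addMul t (σ c) (map σ b)) (cong₂ _∷_ σ-0 (map-· a b)))

module Extension (p : ℕ) (pr : Prime p) (n : ℕ) (1≤n : 1 N.≤ n)
  (F : FiniteField p) (K : FiniteField (p N.^ n)) (hom : FieldHom F K) where

  module F = FieldTheory F
  module FP = Polynomials F
  module FF = Factorization F
  open HomPolynomials hom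
    renaming (σ to emb; σ-+ to emb-+; σ-* to emb-*; σ-1 to emb-1; σ-0 to emb-0; σ-neg to emb-neg;
      σ-injective to emb-injective; σ-ι to emb-ι
             ; σ-cast to emb-cast; σ-^ to emb-^; eval-map to eval-emb; map-· to emb-·)
    public
  open FieldTheory K
  open Polynomials K
  open ≡-Reasoning

  ι-p : ι p ≡ 0#
  ι-p = trans (sym (emb-ι p)) (trans (cong emb F.ι-q) emb-0)

  open Frobenius K p pr ι-p public

  instance
    p-nonZero : N.NonZero p
    p-nonZero = prime⇒nonZero pr

  conj-emb : ∀ i c → conj i (emb c) ≡ emb c
  conj-emb zero    c = conj-zero (emb c)
  conj-emb (suc i) c = begin
    conj (1 N.+ i) (emb c) ≡⟨ trans (conj-∘ 1 i (emb c)) (conj-1 _) ⟩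
    conj i (emb c) ^ p ≡⟨ cong (_^ p) (conj-emb i c) ⟩
    emb c ^ p ≡⟨ sym (emb-^ c p) ⟩
    emb (c F.^ p) ≡⟨ cong emb (F.fermat c) ⟩
    emb c ∎

  conj-n : ∀ x → conj n x ≡ x
  conj-n = fermat

  conjHom : ℕ → FieldHom K K
  conjHom i = record { σ = conj i ; σ-+ = conj-+ i ; σ-* = conj-* i ; σ-1 = 1^ (p N.^ i) }

  module ConjHom (i : ℕ) = HomPolynomials (conjHom i)

  -- All `p` images of elements of `F` are roots of `T^p - T`, which has at most `p` roots;
  -- comparing the two counts termwise leaves no other root.
  fixed⇒base : ∀ x → x ^ p ≡ x → ∃ λ c → emb c ≡ x
  fixed⇒base x e = found (any? (λ c → emb c ≟ x) F.elems)
    where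
    T^p-T : ∃ λ a → length a ≡ p × (∀ y → eval a y ≡ y ^ p + - y)
    T^p-T = go p (N.nonTrivial⇒n>1 p ⦃ prime⇒nonTrivial pr ⦄)
      where
      go : ∀ p → 1 N.< p → ∃ λ a → length a ≡ p × (∀ y → eval a y ≡ y ^ p + - y)
      go (suc (suc m)) _ = 0# ∷ - 1# ∷ replicate m 0# , cong (suc ∘ suc) (LP.length-replicate m) ,
        (λ y → trans (cong (λ t → 0# + y * (- 1# + y * t)) (eval-T^ m y))
          (solve 2 (λ y t → :0 :+ y :* (:- :1 :+ y :* t) := y :* (y :* t) :- y) refl y (y ^ m)))
      go (suc zero) (s≤s ())
    a = proj₁ T^p-T
    is-root : ∀ {y} → y ^ p ≡ y → eval a y ≡ 0#
    is-root {y} f = trans (proj₂ (proj₂ T^p-T) y) (trans (cong (_+ - y) f) (-‿inverseʳ y))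
    image : Carrier → ℤ
    image y = ∑ F.elems (λ c → ⟦ emb c ≟ y ⟧)
    image≤ : ∀ y → image y Z.≤ ⟦ eval a y ≟ 0# ⟧
    image≤ y with any? (λ c → emb c ≟ y) F.elems
    ... | no none = ZP.≤-trans (ZP.≤-reflexive
      (∑-ε F.elems (λ c m → ⟦⟧-no (emb c ≟ y) (λ f → none (lose m f))))) (⟦⟧-≥0 (eval a y ≟ 0#))
    ... | yes some with satisfied some
    ... | c , refl = ZP.≤-reflexive (trans
      (∑-cong F.elems (λ b → ⟦⟧-⇔ (emb b ≟ emb c) (b F.≟ c) emb-injective (cong emb)))
      (trans (∑-δ1 F._≟_ F.elems-unique (F.∈-elems c))
        (sym (⟦⟧-yes (eval a (emb c) ≟ 0#) (is-root (trans (sym (conj-1 (emb c))) (conj-emb 1 c)))))))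
    ∑-image : ∑ elems image ≡ # p
    ∑-image = begin
      ∑ elems image ≡⟨ ∑-swap elems F.elems _ ⟩
      ∑ F.elems (λ c → ∑ elems (λ y → ⟦ emb c ≟ y ⟧))
        ≡⟨ ∑-cong F.elems (λ c → trans (∑-cong elems (λ y →
        ⟦⟧-⇔ (emb c ≟ y) (y ≟ emb c) sym sym)) (∑-δ1 _≟_ elems-unique (∈-elems (emb c)))) ⟩
      ∑ F.elems (λ _ → # 1) ≡⟨ trans (∑-const (# 1) F.elems) (ZP.*-identityʳ _) ⟩
      # length F.elems ≡⟨ cong #_ F.length-elems ⟩
      # p ∎
    image≡ : image x ≡ ⟦ eval a x ≟ 0# ⟧
    image≡ = ∑-≤-≡ elems (λ y _ → image≤ y)
      (ZP.≤-trans (count-roots a) (ZP.≤-reflexive (trans (cong #_ (proj₁ (proj₂ T^p-T))) (sym ∑-image)))) x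
      (∈-elems x)
    found : Dec _ → ∃ λ c → emb c ≡ x
    found (yes some) = satisfied some
    found (no none) with trans (trans (sym
      (∑-ε F.elems (λ c m → ⟦⟧-no (emb c ≟ x) (λ f → none (lose m f))))) image≡)
      (⟦⟧-yes (eval a x ≟ 0#) (is-root e))
    ... | ()

  descend : ∀ a → map (conj 1) a ≡ a → ∃ λ g → map emb g ≡ a
  descend []      e = [] , refl
  descend (c ∷ a) e with fixed⇒base c (trans (sym (conj-1 c)) (proj₁ (LP.∷-injective e))) | descend a
    (proj₂ (LP.∷-injective e))
  ... | b , eb | g , eg = b ∷ g , cong₂ _∷_ eb eg

  ·-isCommutativeMonoid : IsCommutativeMonoid _≡_ _·_ []
  ·-isCommutativeMonoid = record
    { isMonoid = record
      { isSemigroup = record { isMagma = isMagma _·_ ; assoc = ·-assoc }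
      ; identity = (λ _ → refl) , ·-identityʳ }
    ; comm = ·-comm }

  module ·-Sum = ListSum _·_ [] ·-isCommutativeMonoid

  module Orbit (u : Carrier) where

    linear : Carrier → List Carrier
    linear r = - r ∷ []

    orbitPoly : ℕ → List Carrier
    orbitPoly e = ·-Sum.∑ (upTo e) (λ i → linear (conj i u))

    length-∑ : (is : List ℕ) (f : ℕ → Carrier) → length (·-Sum.∑ is (linear ∘ f)) ≡ length is
    length-∑ []       f = refl
    length-∑ (i ∷ is) f = trans (length-· (linear (f i)) (·-Sum.∑ is (linear ∘ f))) (cong suc (length-∑ is f))

    eval-∑ : (is : List ℕ) (f : ℕ → Carrier) → ∀ x → eval (·-Sum.∑ is (linear ∘ f)) x ≡ ∏ is (λ i → x + - f i)
    eval-∑ []       f x = refl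
    eval-∑ (i ∷ is) f x = trans (eval-· (linear (f i)) (·-Sum.∑ is (linear ∘ f)) x)
      (cong₂ _*_ (solve 2 (λ r x → :- r :+ x :* :1 := x :- r) refl (f i) x) (eval-∑ is f x))

    map-conj-∑ : (is : List ℕ) (f : ℕ → Carrier) → map (conj 1) (·-Sum.∑ is (linear ∘ f)) ≡ ·-Sum.∑ is
      (linear ∘ conj 1 ∘ f)
    map-conj-∑ []       f = refl
    map-conj-∑ (i ∷ is) f = trans (ConjHom.map-· 1 (linear (f i)) (·-Sum.∑ is (linear ∘ f)))
      (cong₂ _·_ (cong (_∷ []) (ConjHom.σ-neg 1 (f i))) (map-conj-∑ is f))

    -- The search runs over `suc i`, which excludes the trivial period 0; it succeeds by `n - 1`
    -- because `conj n` is the identity.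
    period : ∃ λ m → m N.≤ n N.∸ 1 × conj (suc m) u ≡ u × (∀ i → i N.< m → conj (suc i) u ≢ u)
    period = least (λ i → conj (suc i) u ≡ u) (λ i → conj (suc i) u ≟ u) (n N.∸ 1)
      (trans (cong (λ k → conj k u) (NP.m+[n∸m]≡n 1≤n)) (conj-n u))

    e : ℕ
    e = suc (proj₁ period)

    conj-e : conj e u ≡ u
    conj-e = proj₁ (proj₂ (proj₂ period))

    e≤n : e N.≤ n
    e≤n = NP.≤-trans (s≤s (proj₁ (proj₂ period))) (NP.≤-reflexive (NP.m+[n∸m]≡n 1≤n))

    minimal : ∀ i → 1 N.≤ i → i N.< e → conj i u ≢ u
    minimal (suc i) _ (s≤s i<m) = proj₂ (proj₂ (proj₂ period)) i i<m

    conj-multiple : ∀ j {x} → conj e x ≡ x → conj (j N.* e) x ≡ x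
    conj-multiple zero    {x} _ = conj-zero x
    conj-multiple (suc j) {x} f = trans (conj-∘ e (j N.* e) x) (trans (cong (conj e) (conj-multiple j f)) f)

    j : ℕ
    j = n / e

    -- The remainder of `n` modulo `e` is again a period of `u`, and it is smaller than the least
    -- positive one.
    n≡j*e : n ≡ j N.* e
    n≡j*e = trans (m≡m%n+[m/n]*n n e) (cong (N._+ j N.* e) (remainder (n % e) refl))
      where
      remainder : ∀ r → n % e ≡ r → n % e ≡ 0
      remainder zero    f = f
      remainder (suc r) f = ⊥-elim (minimal (n % e) (subst (1 N.≤_) (sym f) (s≤s z≤n)) (m%n<n n e) (begin
        conj (n % e) u ≡⟨ cong (conj (n % e)) (sym (conj-multiple j conj-e)) ⟩
        conj (n % e) (conj (j N.* e) u) ≡⟨ sym (conj-∘ (n % e) (j N.* e) u) ⟩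
        conj (n % e N.+ j N.* e) u ≡⟨ cong (λ k → conj k u) (sym (m≡m%n+[m/n]*n n e)) ⟩
        conj n u ≡⟨ conj-n u ⟩
        u ∎))

    1≤j : 1 N.≤ j
    1≤j with j in eq
    ... | zero  = ⊥-elim (NP.n≮0 (subst (1 N.≤_) (trans n≡j*e (cong (N._* e) eq)) 1≤n))
    ... | suc _ = s≤s z≤n

    -- Frobenius rotates the linear factors cyclically. Multiplying both sides by `T - u` completes
    -- the shifted product at its lower end, and `conj e u ≡ u` closes the cycle.
    invariant : map (conj 1) (orbitPoly e) ≡ orbitPoly e
    invariant = trans (map-conj-∑ (upTo e) (λ i → conj i u)) (·-cancelˡ (linear u) (begin
      linear u · ·-Sum.∑ (upTo e) (λ i → linear (conj 1 (conj i u)))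
        ≡⟨ cong₂ _·_ (cong linear (sym (conj-zero u)))
          (·-Sum.∑-cong (upTo e) (λ i → cong linear (sym (conj-∘ 1 i u)))) ⟩
      linear (conj 0 u) · ·-Sum.∑ (upTo e) (λ i → linear (conj (suc i) u))
        ≡⟨ sym (·-Sum.∑-upTo-shift e (λ i → linear (conj i u))) ⟩
      orbitPoly e · linear (conj e u)
        ≡⟨ ·-comm (orbitPoly e) _ ⟩
      linear (conj e u) · orbitPoly e
        ≡⟨ cong (λ t → linear t · orbitPoly e) conj-e ⟩
      linear u · orbitPoly e ∎))

    -- The minimal polynomial of `u` over `F`, obtained by descending the product over its orbit.
    g : List F.Carrier
    g = proj₁ (descend (orbitPoly e) invariant)

    emb-g : map emb g ≡ orbitPoly e
    emb-g = proj₂ (descend (orbitPoly e) invariant)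

    length-g : length g ≡ e
    length-g = trans (sym (LP.length-map emb g))
      (trans (cong length emb-g) (trans (length-∑ (upTo e) (λ i → conj i u)) (LP.length-upTo e)))

    eval-g : ∀ x → eval (map emb g) x ≡ ∏ (upTo e) (λ i → x + - conj i u)
    eval-g x = trans (cong (λ a → eval a x) emb-g) (eval-∑ (upTo e) (λ i → conj i u) x)

    root : eval (map emb g) u ≡ 0#
    root = trans (eval-g u) (trans (∏-upTo-suc (proj₁ period) f)
      (trans (cong (_* ∏ (upTo (proj₁ period)) (f ∘ suc))
        (trans (cong (λ t → u + - t) (conj-zero u)) (-‿inverseʳ u))) (zeroˡ _)))
      where
      f : ℕ → Carrier
      f i = u + - conj i u

    distinct : ∀ i k → i N.< k → k N.< e → conj i u ≢ conj k u
    distinct i k i<k k<e f = minimal (k N.∸ i) (NP.m<n⇒0<n∸m i<k) (NP.≤-<-trans (NP.m∸n≤m k i) k<e)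
      (sym (ConjHom.σ-injective i (trans f
        (trans (cong (λ t → conj t u) (sym (NP.m+[n∸m]≡n (NP.<⇒≤ i<k)))) (conj-∘ i (k N.∸ i) u)))))

    -- Frobenius fixes the coefficients of `a`, so all `e` distinct conjugates of `u` are roots.
    vanishing⇒long : ∀ a → eval (map emb a) u ≡ 0# → e N.≤ length a
    vanishing⇒long a z = NP.≤-trans (distinct-roots e (map emb a) (λ i → conj i u) distinct (λ i _ → begin
      eval (map emb a) (conj i u) ≡⟨ cong (λ t → eval t (conj i u)) (sym (fixed i a)) ⟩
      eval (map (conj i) (map emb a)) (conj i u) ≡⟨ ConjHom.eval-map i (map emb a) u ⟩
      conj i (eval (map emb a) u) ≡⟨ cong (conj i) z ⟩
      conj i 0# ≡⟨ ConjHom.σ-0 i ⟩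
      0# ∎)) (NP.≤-reflexive (LP.length-map emb a))
      where
      fixed : ∀ i a → map (conj i) (map emb a) ≡ map emb a
      fixed i []      = refl
      fixed i (c ∷ a) = cong₂ _∷_ (conj-emb i c) (fixed i a)

    -- In a factorization of `g` one factor vanishes at `u`, hence already has degree at least `e`,
    -- and nothing is left for the other.
    irreducible : FP.Irreducible g
    irreducible = record
      { positive = subst (1 N.≤_) (sym length-g) (s≤s z≤n)
      ; unsplit  = λ a b ab → [ (λ z → inj₂ (short a b ab (vanishing⇒long a z)))
                              , (λ z → inj₁ (short b a (trans (FP.·-comm b a) ab) (vanishing⇒long b z))) ]′
          (integral (eval (map emb a) u) (eval (map emb b) u)
            (trans (sym (eval-· (map emb a) (map emb b) u))
              (trans (cong (λ t → eval t u) (trans (sym (emb-· a b)) (cong (map emb) ab))) root))) }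
      where
      short : ∀ a b → a FP.· b ≡ g → e N.≤ length a → length b ≡ 0
      short a b ab e≤a = NP.n≤0⇒n≡0 (NP.+-cancelˡ-≤ e _ _ (NP.≤-trans (NP.+-monoˡ-≤ (length b) e≤a)
        (NP.≤-reflexive (trans (sym (FP.length-· a b))
          (trans (cong length ab) (trans length-g (sym (NP.+-identityʳ e))))))))

    -- The value of the minimal polynomial at `c` is the norm of `c - u`, the product of its
    -- conjugates.
    norm-g : ∀ c → emb (F.eval g c) ≡ ∏ (upTo e) (λ i → conj i (emb c + - u))
    norm-g c = begin
      emb (F.eval g c) ≡⟨ sym (eval-emb g c) ⟩
      eval (map emb g) (emb c) ≡⟨ eval-g (emb c) ⟩
      ∏ (upTo e) (λ i → emb c + - conj i u)
        ≡⟨ ∏-cong (upTo e) (λ i → sym (trans (conj-+ i (emb c) (- u))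
                                                              (cong₂ _+_ (conj-emb i c) (ConjHom.σ-neg i
                                                                u)))) ⟩
      ∏ (upTo e) (λ i → conj i (emb c + - u)) ∎

-- Character sums over extensions

pos-^ : ∀ p n → # (p N.^ n) ≡ (# p) Z.^ n
pos-^ p zero    = refl
pos-^ p (suc n) = trans (ZP.pos-* p (p N.^ n)) (cong (Z._*_ (# p)) (pos-^ p n))

-- This is `1 + p + ... + p^(i-1)`, the exponent by which the norm from degree `i` acts.
geometric : ℕ → ℕ → ℕ
geometric p zero    = 0
geometric p (suc i) = geometric p i N.+ p N.^ i

^≡1+geometric : ∀ p a → p ≡ suc (2 N.* a) → ∀ i → p N.^ i ≡ suc (2 N.* (a N.* geometric p i))
^≡1+geometric p a p≡ zero    = cong (λ t → suc (2 N.* t)) (sym (NP.*-zeroʳ a))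
^≡1+geometric p a p≡ (suc i) = begin
  p N.* p N.^ i ≡⟨ cong (N._* p N.^ i) p≡ ⟩
  p N.^ i N.+ 2 N.* a N.* p N.^ i ≡⟨ cong (N._+ 2 N.* a N.* p N.^ i) (^≡1+geometric p a p≡ i) ⟩
  suc (2 N.* (a N.* geometric p i)) N.+ 2 N.* a N.* p N.^ i
    ≡⟨ solve 3 (λ a s x → con 1 :+ con 2 :* (a :* s) :+ con 2 :* a :* x := con 1 :+ con 2 :*
      (a :* (s :+ x))) refl a (geometric p i) (p N.^ i) ⟩
  suc (2 N.* (a N.* (geometric p i N.+ p N.^ i))) ∎
  where
  open ≡-Reasoning
  open Data.Nat.Solver.+-*-Solver

module CharacterSum (p : ℕ) (pr : Prime p) (n : ℕ) (1≤n : 1 N.≤ n)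
  (F : FiniteField p) (K : FiniteField (p N.^ n)) (hom : FieldHom F K)
  (m : ℕ) (p≡ : p ≡ suc (2 N.* suc m))
  (d : FiniteField.Carrier F) (d≢0 : d ≢ FiniteField.0# F) (d≢1 : d ≢ FiniteField.1# F) where

  open Extension p pr n 1≤n F K hom
  open FieldTheory K
  open Polynomials K
  open ≡-Reasoning

  -- Chosen so that `suc k`, the half exponent `(p^n - 1)/2` of `K`, is the half exponent `suc m` of
  -- `F` times the norm exponent.
  k : ℕ
  k = suc m N.* geometric p n N.∸ 1

  suc-k : suc k ≡ suc m N.* geometric p n
  suc-k = NP.m+[n∸m]≡n (NP.*-mono-≤ (s≤s (z≤n {m})) (1≤geometric n 1≤n))
    where
    1≤geometric : ∀ n → 1 N.≤ n → 1 N.≤ geometric p n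
    1≤geometric (suc n) _ = NP.≤-trans (NP.m^n>0 p n) (NP.m≤n+m _ (geometric p n))

  q≡ : p N.^ n ≡ suc (2 N.* suc k)
  q≡ = trans (^≡1+geometric p (suc m) p≡ n) (cong (λ t → suc (2 N.* t)) (sym suc-k))

  module CF = Character F m p≡
  module CK = Character K k q≡
  module L  = LFunction F m p≡ d d≢0 d≢1

  ∏-conj : ∀ z i → ∏ (upTo i) (λ t → conj t z) ≡ z ^ geometric p i
  ∏-conj z zero    = refl
  ∏-conj z (suc i) = trans (∏-upTo-last i _)
    (trans (cong (_* conj i z) (∏-conj z i)) (sym (^-homo-* z (geometric p i) (p N.^ i))))

  ∏-period : ∀ z e → conj e z ≡ z → ∀ j → ∏ (upTo (j N.* e)) (λ t → conj t z) ≡ ∏ (upTo e) (λ t → conj t z)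
    ^ j
  ∏-period z e f zero    = refl
  ∏-period z e f (suc j) = trans (∏-upTo-+ e (j N.* e) (λ t → conj t z))
    (cong (∏ (upTo e) (λ t → conj t z) *_)
    (trans (∏-cong (upTo (j N.* e)) (λ t → trans (cong (λ s → conj s z) (NP.+-comm e t))
      (trans (conj-∘ t e z) (cong (conj t) f))))
      (∏-period z e f j)))

  -- Raising `z` to `(p^n - 1)/2` means taking its norm down to `F` and then the power `(p - 1)/2`.
  -- The full norm runs `j` times through the cycle of length `e` and is therefore the `j`-th power
  -- of `G`. Any period `e` of `z` will do; the case `e = 1` treats elements of `F`.
  χ-norm : ∀ z G e j → emb G ≡ ∏ (upTo e) (λ t → conj t z) → conj e z ≡ z → n ≡ j N.* e → CK.χ z ≡ CF.χ G
    Z.^ j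
  χ-norm z G e j normG fixed n≡ = CK.χ-unique (Sign₀-^ j (CF.χ-sign G)) (begin
    cast (CF.χ G Z.^ j) ≡⟨ cast-^ (CF.χ G) j ⟩
    cast (CF.χ G) ^ j
      ≡⟨ cong (_^ j) (trans (sym (emb-cast (CF.χ G))) (trans (cong emb (CF.cast-χ G)) (emb-^ G (suc m)))) ⟩
    (emb G ^ suc m) ^ j
      ≡⟨ trans (^-assocʳ (emb G) (suc m) j)
        (trans (cong (emb G ^_) (NP.*-comm (suc m) j)) (sym (^-assocʳ (emb G) j (suc m)))) ⟩
    (emb G ^ j) ^ suc m ≡⟨ cong (λ t → (t ^ j) ^ suc m) normG ⟩
    (∏ (upTo e) (λ t → conj t z) ^ j) ^ suc m ≡⟨ cong (_^ suc m) (sym (∏-period z e fixed j)) ⟩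
    ∏ (upTo (j N.* e)) (λ t → conj t z) ^ suc m
      ≡⟨ cong (_^ suc m) (trans (cong (λ i → ∏ (upTo i) (λ t → conj t z)) (sym n≡)) (∏-conj z n)) ⟩
    (z ^ geometric p n) ^ suc m
      ≡⟨ trans (^-assocʳ z (geometric p n) (suc m))
        (cong (z ^_) (trans (NP.*-comm (geometric p n) (suc m)) (sym suc-k))) ⟩
    z ^ suc k ∎)

  -- The constants are kept as images of elements of `F`, so that `norm-g` applies to each factor.
  cubic : Carrier → Carrier
  cubic u = (emb F.0# + - u) * (emb (F.- F.1#) + - u) * (emb (F.- d) + - u)

  open Orbit using (g; j)

  χ-cubic : ∀ u → CK.χ (cubic u) ≡ L.X (g u) Z.^ j u
  χ-cubic u = χ-norm (cubic u) (L.values (g u)) e (j u) (begin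
    emb (L.values (g u))
      ≡⟨ trans (emb-* _ _) (cong (_* emb (F.eval (g u) (F.- d))) (emb-* _ _)) ⟩
    emb (F.eval (g u) F.0#) * emb (F.eval (g u) (F.- F.1#)) * emb (F.eval (g u) (F.- d))
      ≡⟨ cong₂ _*_ (cong₂ _*_ (norm-g F.0#) (norm-g (F.- F.1#))) (norm-g (F.- d)) ⟩
    ∏ (upTo e) (factor F.0#) * ∏ (upTo e) (factor (F.- F.1#)) * ∏ (upTo e) (factor (F.- d))
      ≡⟨ sym (trans (∏-* (upTo e) _ _) (cong (_* ∏ (upTo e) (factor (F.- d))) (∏-* (upTo e) _ _))) ⟩
    ∏ (upTo e) (λ i → factor F.0# i * factor (F.- F.1#) i * factor (F.- d) i)
      ≡⟨ ∏-cong (upTo e) (λ i → sym (trans (conj-* i _ _) (cong (_* factor (F.- d) i) (conj-* i _ _)))) ⟩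
    ∏ (upTo e) (λ i → conj i (cubic u)) ∎)
    (trans (conj-* e _ _) (cong₂ _*_ (trans (conj-* e _ _) (cong₂ _*_ (fixed F.0#) (fixed (F.- F.1#))))
      (fixed (F.- d))))
    n≡j*e
    where
    open Orbit u hiding (g; j)
    factor : F.Carrier → ℕ → Carrier
    factor c i = conj i (emb c + - u)
    fixed : ∀ c → conj e (emb c + - u) ≡ emb c + - u
    fixed c = trans (conj-+ e (emb c) (- u))
      (cong₂ _+_ (conj-emb e c) (trans (ConjHom.σ-neg e u) (cong -_ conj-e)))

  -- Points at the prime power `g^j`, which has degree `n`; the second component is `j - 1` because
  -- `(P , i)` indexes `P^(i+1)`.
  place : Carrier → List F.Carrier × ℕ
  place u = g u , j u N.∸ 1

  suc-place : ∀ u → suc (j u N.∸ 1) ≡ j u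
  suc-place u = NP.m+[n∸m]≡n (Orbit.1≤j u)

  places : List (List F.Carrier × ℕ)
  places = FF.primePowers n

  place∈ : ∀ u → place u ∈ places
  place∈ u = ∈-cartesianProductWith⁺ _,_
    (FF.∈-degrees n (g u) (FP.Irreducible.positive (Orbit.irreducible u))
      (NP.≤-trans (NP.≤-reflexive (Orbit.length-g u)) (Orbit.e≤n u)))
    (∈-upTo⁺ (NP.≤-trans (NP.≤-reflexive (suc-place u)) (j≤n (Orbit.e u) (j u) (s≤s z≤n) (Orbit.n≡j*e u))))
    where
    j≤n : ∀ e j → 1 N.≤ e → n ≡ j N.* e → j N.≤ n
    j≤n e j 1≤e f = NP.≤-trans (NP.≤-reflexive (sym (NP.*-identityʳ j)))
      (NP.≤-trans (NP.*-monoʳ-≤ j 1≤e) (NP.≤-reflexive (sym f)))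

  places-unique : Unique places
  places-unique = UP.cartesianProductWith⁺ _,_ (λ { refl → refl , refl }) (FF.degrees-unique n) (UP.upTo⁺ n)

  _≟ᴾ_ : DecidableEquality (List F.Carrier × ℕ)
  _≟ᴾ_ = ×P.≡-dec FF._≟ᴸ_ N._≟_

  -- The expected size of a fibre of `place`: an irreducible `P` with a power of degree `n` should
  -- have all `deg P` roots in `K`. It is also the factor in front of `X` in `logCoefficient`.
  mass : List F.Carrier × ℕ → ℤ
  mass i = FF.weight n (proj₁ i) Z.* ⟦ length (FF.primePower n i) N.≟ n ⟧

  fibre : List F.Carrier × ℕ → ℤ
  fibre i = ∑ elems (λ u → ⟦ place u ≟ᴾ i ⟧)

  length-place : ∀ u → length (FF.primePower n (place u)) ≡ n
  length-place u = trans (FF.length-pow (g u) (suc (j u N.∸ 1)))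
    (trans (cong₂ N._*_ (suc-place u) (Orbit.length-g u)) (sym (Orbit.n≡j*e u)))

  mass≥0 : ∀ i → # 0 Z.≤ mass i
  mass≥0 i = go (FF.irreducible? (proj₁ i)) (length (FF.primePower n i) N.≟ n) (length (proj₁ i))
    where
    go : {A B : Set} (a : Dec A) (b : Dec B) (l : ℕ) → # 0 Z.≤ ⟦ a ⟧ Z.* # l Z.* ⟦ b ⟧
    go (no _)  b       l = ZP.≤-refl
    go (yes _) (no _)  l = ZP.≤-reflexive (sym (ZP.*-zeroʳ (# 1 Z.* # l)))
    go (yes _) (yes _) l = ZP.≤-trans (Z.+≤+ z≤n)
      (ZP.≤-reflexive (sym (trans (ZP.*-identityʳ (# 1 Z.* # l)) (ZP.*-identityˡ (# l)))))

  mass-place : ∀ u → mass (place u) ≡ # length (g u)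
  mass-place u = trans
    (cong₂ (λ a b → a Z.* # length (g u) Z.* b)
      (⟦⟧-yes (FF.irreducible? (g u)) (Orbit.irreducible u))
      (⟦⟧-yes (length (FF.primePower n (place u)) N.≟ n) (length-place u)))
    (trans (ZP.*-identityʳ (# 1 Z.* # length (g u))) (ZP.*-identityˡ (# length (g u))))

  -- Elements with the same place are roots of the same polynomial over `K`, and `count-roots`
  -- bounds their number by its degree.
  fibre≤length : ∀ u₀ → fibre (place u₀) Z.≤ # length (g u₀)
  fibre≤length u₀ = ZP.≤-trans
    (∑-mono elems (λ u _ → ⟦⟧-≤ (place u ≟ᴾ place u₀) (eval (map emb (g u₀)) u ≟ 0#)
      (λ e → subst (λ h → eval (map emb h) u ≡ 0#) (cong proj₁ e) (Orbit.root u))))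
    (ZP.≤-trans (count-roots (map emb (g u₀))) (ZP.≤-reflexive (cong #_ (LP.length-map emb (g u₀)))))

  fibre≤mass : ∀ i → fibre i Z.≤ mass i
  fibre≤mass i = go (any? (λ u → place u ≟ᴾ i) elems)
    where
    attained : (∃ λ u → place u ≡ i) → fibre i Z.≤ mass i
    attained (u , e) = subst (λ i → fibre i Z.≤ mass i) e
      (ZP.≤-trans (fibre≤length u) (ZP.≤-reflexive (sym (mass-place u))))
    go : Dec _ → fibre i Z.≤ mass i
    go (yes some) = attained (satisfied some)
    go (no none)  = ZP.≤-trans (ZP.≤-reflexive
      (∑-ε elems (λ u m → ⟦⟧-no (place u ≟ᴾ i) (λ e → none (lose m e))))) (mass≥0 i)

  ∑-fibre : ∑ places fibre ≡ # (p N.^ n)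
  ∑-fibre = begin
    ∑ places fibre
      ≡⟨ sym (trans (∑-count _≟ᴾ_ elems places-unique place (λ u _ → place∈ u) (λ _ → # 1))
        (∑-cong places (λ i → ZP.*-identityʳ (fibre i)))) ⟩
    ∑ elems (λ _ → # 1) ≡⟨ trans (∑-const (# 1) elems) (ZP.*-identityʳ _) ⟩
    # length elems ≡⟨ cong #_ length-elems ⟩
    # (p N.^ n) ∎

  -- The total mass is the logarithmic coefficient for `X = 1`. The `subst` rewrites the index
  -- `suc (n ∸ 1)` as `n`.
  ∑-mass : ∑ places mass ≡ # (p N.^ n)
  ∑-mass = trans (∑-cong places (λ i → sym (ZP.*-identityʳ (mass i)))) (trans
    (subst (λ r → Counting.one F n ≡ Counting.one F n → FF.logCoefficient n (Counting.one F n)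
      (λ _ _ → refl) r ≡ (# p) Z.^ r) (NP.m+[n∸m]≡n 1≤n)
      (λ _ → Counting.one-logCoefficient F n (n N.∸ 1) (NP.≤-reflexive (NP.m+[n∸m]≡n 1≤n))) refl)
    (sym (pos-^ p n)))

  -- Every irreducible polynomial over F of degree dividing n therefore splits in K.
  fibre≡mass : ∀ i → i ∈ places → fibre i ≡ mass i
  fibre≡mass = ∑-≤-≡ places (λ i _ → fibre≤mass i) (ZP.≤-reflexive (trans ∑-mass (sym ∑-fibre)))

  X-pow : ∀ P i → L.X (FF.pow P i) ≡ L.X P Z.^ i
  X-pow P zero    = L.X-[]
  X-pow P (suc i) = trans (L.X-· P (FF.pow P i)) (cong (Z._*_ (L.X P)) (X-pow P i))

  -- The summand depends on `u` only through its place, so the sum is regrouped along `place`, and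
  -- the fibre sizes are the weights of the logarithmic derivative.
  ∑-χ-cubic : ∑ elems (λ u → CK.χ (cubic u)) ≡ FF.logCoefficient n L.X L.X-· n
  ∑-χ-cubic = begin
    ∑ elems (λ u → CK.χ (cubic u))
      ≡⟨ ∑-cong elems (λ u → trans (χ-cubic u)
        (sym (trans (X-pow (g u) (suc (j u N.∸ 1))) (cong (Z._^_ (L.X (g u))) (suc-place u))))) ⟩
    ∑ elems (λ u → L.X (FF.primePower n (place u)))
      ≡⟨ ∑-count _≟ᴾ_ elems places-unique place (λ u _ → place∈ u) (λ i → L.X (FF.primePower n i)) ⟩
    ∑ places (λ i → fibre i Z.* L.X (FF.primePower n i))
      ≡⟨ ∑-cong∈ places (λ i i∈ → cong (Z._* L.X (FF.primePower n i)) (fibre≡mass i i∈)) ⟩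
    FF.logCoefficient n L.X L.X-· n ∎

  module Supersingular (c₁ : L.c 1 ≡ # 0) where

    open L.LogCoefficients c₁ n

    ∑-χ-odd : ∀ i → n ≡ 1 N.+ 2 N.* i → ∑ elems (λ u → CK.χ (cubic u)) ≡ # 0
    ∑-χ-odd i n≡ = trans ∑-χ-cubic (trans (cong W n≡) (W-odd i (NP.≤-reflexive (sym n≡))))

    ∑-χ-even : ∀ i → n ≡ 2 N.* i → ∑ elems (λ u → CK.χ (cubic u)) ≡ Z.- (# 2) Z.* (Z.- (# p)) Z.^ i
    ∑-χ-even zero    n≡ = ⊥-elim (NP.n≮0 (subst (1 N.≤_) n≡ 1≤n))
    ∑-χ-even (suc i) n≡ = trans ∑-χ-cubic (trans (cong W n≡) (W-even i (NP.≤-reflexive (sym n≡))))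

-- The Hasse invariant

module Characteristic {q : ℕ} (K : FiniteField q) (p : ℕ) (pr : Prime p)
  (ι-p : FiniteField.ι K p ≡ FiniteField.0# K) where

  open FieldTheory K
  open ≡-Reasoning

  ι-multiple : ∀ k → ι (k N.* p) ≡ 0#
  ι-multiple k = trans (ι-* k p) (trans (cong (ι k *_) ι-p) (zeroʳ (ι k)))

  coprime⇒unit : ∀ n → ¬ (p ∣ n) → ∃ λ k → ι n * ι k ≡ 1#
  coprime⇒unit n p∤n with coprime-Bézout coprime
    where
    coprime : Coprime n p
    coprime {d} (d∣n , d∣p) with prime⇒irreducible pr d∣p
    ... | inj₁ d≡1 = d≡1
    ... | inj₂ refl = ⊥-elim (p∤n d∣n)
  ... | Bézout.+- x y e = x , (begin
    ι n * ι x ≡⟨ trans (*-comm _ _) (sym (ι-* x n)) ⟩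
    ι (x N.* n) ≡⟨ cong ι (sym e) ⟩
    1# + ι (y N.* p) ≡⟨ trans (cong (1# +_) (ι-multiple y)) (+-identityʳ 1#) ⟩
    1# ∎)
  -- Here `1 + x n = y p`, so the inverse of `n` is `-x`, represented by the natural number
  -- `x (p - 1)`.
  ... | Bézout.-+ x y e = x N.* (p N.∸ 1) , (begin
    ι n * ι (x N.* (p N.∸ 1)) ≡⟨ cong (ι n *_) (trans (ι-* x (p N.∸ 1)) (cong (ι x *_) ι-p-1)) ⟩
    ι n * (ι x * - 1#)
      ≡⟨ solve 2 (λ n x → n :* (x :* :- :1) := :1 :- (:1 :+ x :* n)) refl (ι n) (ι x) ⟩
    1# + - (1# + ι x * ι n) ≡⟨ cong (λ t → 1# + - (1# + t)) (sym (ι-* x n)) ⟩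
    1# + - ι (1 N.+ x N.* n) ≡⟨ cong (λ t → 1# + - ι t) e ⟩
    1# + - ι (y N.* p)
      ≡⟨ trans (cong (λ t → 1# + - t) (ι-multiple y)) (trans (cong (1# +_) -0#≈0#) (+-identityʳ 1#)) ⟩
    1# ∎)
    where
    ι-p-1 : ι (p N.∸ 1) ≡ - 1#
    ι-p-1 = begin
      ι (p N.∸ 1) ≡⟨ solve 1 (λ x → x := (:1 :+ x) :- :1) refl _ ⟩
      ι (1 N.+ (p N.∸ 1)) + - 1#
        ≡⟨ cong (λ t → ι t + - 1#) (NP.m+[n∸m]≡n (N.>-nonZero⁻¹ p ⦃ prime⇒nonZero pr ⦄)) ⟩
      ι p + - 1# ≡⟨ trans (cong (_+ - 1#) ι-p) (+-identityˡ _) ⟩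
      - 1# ∎

  ι≡0⇒∣ : ∀ n → ι n ≡ 0# → p ∣ n
  ι≡0⇒∣ n e with p ∣? n
  ... | yes d = d
  ... | no p∤n with coprime⇒unit n p∤n
  ... | k , u = ⊥-elim (0≢1 (trans (sym (zeroˡ (ι k))) (trans (cong (_* ι k) (sym e)) u)))

module PowerSums {q : ℕ} (K : FiniteField q) (m : ℕ) (q≡ : q ≡ suc (2 N.* suc m)) where

  open FieldTheory K
  open Character K m q≡
  open ≡-Reasoning

  powerSum : ℕ → Carrier
  powerSum e = ∑ᴷ elems (_^ e)

  -- Otherwise zero and the roots of `T^(e+1) - 1` would exhaust the field, although they number at
  -- most `e + 2`, which is less than `q`.
  non-root : ∀ e → suc e N.< 2 N.* h → ∃ λ b → b ≢ 0# × b ^ suc e ≢ 1#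
  non-root e e< with any? (λ b → ¬? (b ≟ 0#) ×-dec ¬? ((b ^ suc e) ≟ 1#)) elems
  ... | yes some = satisfied some
  ... | no none  = ⊥-elim (NP.<⇒≱ (s≤s e<) (ZP.drop‿+≤+ (ZP.≤-trans (ZP.≤-reflexive (begin
      # suc (2 N.* h) ≡⟨ cong #_ (sym q≡) ⟩
      # q ≡⟨ sym (trans (∑-elems-const (# 1)) (ZP.*-identityʳ (# q))) ⟩
      ∑ elems (λ _ → # 1) ∎))
    (ZP.≤-trans (∑-mono elems (λ b _ → covered b)) (ZP.≤-trans (ZP.≤-reflexive (trans (∑-∙ elems _ _)
        (cong (Z._+ ∑ elems (λ b → ⟦ eval T^-1 b ≟ 0# ⟧)) (∑-δ1 _≟_ elems-unique (∈-elems 0#)))))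
      (ZP.+-monoʳ-≤ (# 1) (ZP.≤-trans (count-roots T^-1)
        (ZP.≤-reflexive (cong (λ l → # suc l) (LP.length-replicate e))))))))))
    where
    T^-1 : List Carrier
    T^-1 = - 1# ∷ replicate e 0#
    covered : ∀ b → # 1 Z.≤ ⟦ b ≟ 0# ⟧ Z.+ ⟦ eval T^-1 b ≟ 0# ⟧
    covered b = ⟦⟧-⊎-≤ (yes (refl {x = b})) (b ≟ 0#) (eval T^-1 b ≟ 0#) (λ _ → go (b ≟ 0#) ((b ^ suc e) ≟ 1#))
      where
      go : Dec (b ≡ 0#) → Dec (b ^ suc e ≡ 1#) → b ≡ 0# ⊎ eval T^-1 b ≡ 0#
      go (yes z) _        = inj₁ z
      go (no _)  (yes b1) = inj₂ (trans (cong (λ t → - 1# + b * t) (eval-T^ e b))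
        (trans (cong (- 1# +_) b1) (-‿inverseˡ 1#)))
      go (no nz) (no n1)  = ⊥-elim (none (lose (∈-elems b) (nz , n1)))

  -- Multiplication by `b` permutes the field and multiplies the power sum by `b^(e+1)`, which
  -- differs from 1 for a suitable `b`.
  powerSum-0 : ∀ e → suc e N.< 2 N.* h → powerSum (suc e) ≡ 0#
  powerSum-0 e e< with non-root e e<
  ... | b , nz , n1 = [ (λ z → ⊥-elim (n1 (x-y≡0⇒x≡y z))) , (λ z → z) ]′ (integral (b ^ suc e + - 1#) S (begin
    (b ^ suc e + - 1#) * S ≡⟨ solve 2 (λ b s → (b :- :1) :* s := b :* s :- s) refl (b ^ suc e) S ⟩
    b ^ suc e * S + - S ≡⟨ cong (_+ - S) (sym (∑ᴷ-*ˡ (b ^ suc e) elems _)) ⟩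
    ∑ᴷ elems (λ a → b ^ suc e * a ^ suc e) + - S
      ≡⟨ cong (_+ - S) (trans (∑ᴷ-cong elems (λ a → sym (^-distrib-* b a (suc e))))
           (∑ᴷ-reindex _≟_ elems-unique elems-unique (b *_) (inv b *_) (λ x _ → ∈-elems _)
             (λ x _ → ∈-elems _) (inv-cancelˡ nz) (inv-cancelʳ nz) (_^ suc e))) ⟩
    S + - S ≡⟨ -‿inverseʳ S ⟩
    0# ∎))
    where S = powerSum (suc e)

  -- The remaining exponent is kept positive so that `a = 0` is covered as well.
  ^-reduce : ∀ t a → a ^ (2 N.* h N.+ suc t) ≡ a ^ suc t
  ^-reduce t a = begin
    a ^ (2 N.* h N.+ suc t) ≡⟨ cong (a ^_) (NP.+-suc (2 N.* h) t) ⟩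
    a ^ (suc (2 N.* h) N.+ t) ≡⟨ ^-homo-* a (suc (2 N.* h)) t ⟩
    a ^ suc (2 N.* h) * a ^ t ≡⟨ cong (_* a ^ t) (trans (cong (a ^_) (sym q≡)) (fermat a)) ⟩
    a * a ^ t ∎

  -- Every nonzero element contributes 1 and zero contributes 0, so the sum is `q - 1` in the field.
  powerSum-2h : powerSum (2 N.* h) ≡ - 1#
  powerSum-2h = begin
    powerSum (2 N.* h)
      ≡⟨ solve 1 (λ s → s := (s :+ :1) :- :1) refl _ ⟩
    (powerSum (2 N.* h) + 1#) + - 1#
      ≡⟨ cong (λ t → (powerSum (2 N.* h) + t) + - 1#)
        (sym (trans (∑ᴷ-single elems-unique (∈-elems 0#) other) (zero-one refl))) ⟩
    (powerSum (2 N.* h) + ∑ᴷ elems indicator) + - 1#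
      ≡⟨ cong (_+ - 1#) (trans (sym (∑ᴷ-+ elems _ _)) (∑ᴷ-cong elems complement)) ⟩
    ∑ᴷ elems (λ _ → 1#) + - 1#
      ≡⟨ cong (_+ - 1#) (trans (∑ᴷ-1 elems) (trans (cong ι length-elems) ι-q)) ⟩
    0# + - 1#
      ≡⟨ +-identityˡ _ ⟩
    - 1# ∎
    where
    indicator : Carrier → Carrier
    indicator a = if does (a ≟ 0#) then 1# else 0#
    other : ∀ a → a ≢ 0# → indicator a ≡ 0#
    other a ne with a ≟ 0#
    ... | yes e = ⊥-elim (ne e)
    ... | no _  = refl
    zero-one : ∀ {a} → a ≡ 0# → indicator a ≡ 1#
    zero-one {a} e with a ≟ 0#
    ... | yes _ = refl
    ... | no ne = ⊥-elim (ne e)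
    complement : ∀ a → a ^ (2 N.* h) + indicator a ≡ 1#
    complement a = go (a ≟ 0#)
      where
      go : Dec (a ≡ 0#) → a ^ (2 N.* h) + indicator a ≡ 1#
      go (yes e) = trans (cong₂ _+_ (trans (cong (_^ (2 N.* h)) e) (0^ (m N.+ (h N.+ 0)))) (zero-one e))
        (+-identityˡ 1#)
      go (no ne) = trans (cong₂ _+_ (^2h ne) (other a ne)) (+-identityʳ 1#)

module HasseInvariant (p : ℕ) (pr : Prime p) (F : FiniteField p) (m : ℕ) (p≡ : p ≡ suc (2 N.* suc m))
  (d₀ : ℕ) (d≢0 : FiniteField.ι F d₀ ≢ FiniteField.0# F) (d≢1 : FiniteField.ι F d₀ ≢ FiniteField.1# F)
  (supersingular : p ∣ hasseSum (suc m) d₀) where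

  open FieldTheory F
  open Character F m p≡
  open PowerSums F m p≡
  open Binomial F
  open Characteristic F p pr ι-q

  d : Carrier
  d = ι d₀

  open LFunction F m p≡ d d≢0 d≢1
  open ≡-Reasoning

  ι-^ : ∀ n k → ι (n N.^ k) ≡ ι n ^ k
  ι-^ n zero    = +-identityʳ 1#
  ι-^ n (suc k) = trans (ι-* n (n N.^ k)) (cong (ι n *_) (ι-^ n k))

  ι-sum : {B : Set} (xs : List B) (f : B → ℕ) → ι (sum (map f xs)) ≡ ∑ᴷ xs (λ x → ι (f x))
  ι-sum []       f = refl
  ι-sum (x ∷ xs) f = trans (ι-+ (f x) _) (cong (ι (f x) +_) (ι-sum xs f))

  -- The power of `a` in the product of `a^h`, the `i`-th term of `(a - 1)^h` and the `j`-th term of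
  -- `(-d + a)^h`. It equals `2h` exactly on the diagonal.
  exponent : ℕ → ℕ → ℕ
  exponent i j = h N.+ (i N.+ (h N.∸ j))

  -- For `i < j` the exponent lies strictly between 0 and `2h`. For `i > j` it exceeds `2h` by
  -- `i - j`, and reduction modulo `2h` leaves `i - j`, which again lies strictly between 0 and
  -- `2h`.
  powerSum-exponent : ∀ i j → i N.≤ h → j N.≤ h → i ≢ j → powerSum (exponent i j) ≡ 0#
  powerSum-exponent i j i≤h j≤h i≢j with NP.<-cmp i j
  ... | tri≈ _ e _ = ⊥-elim (i≢j e)
  ... | tri< i<j _ _ = powerSum-0 (m N.+ (i N.+ (h N.∸ j))) (NP.+-monoʳ-< h (NP.<-≤-trans
      (NP.+-monoˡ-< (h N.∸ j) i<j) (NP.≤-reflexive (trans (NP.m+[n∸m]≡n j≤h) (sym (NP.+-identityʳ h))))))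
  ... | tri> _ _ j<i = trans (cong powerSum exponent≡) (trans (∑ᴷ-cong elems (^-reduce t)) (powerSum-0 t t<))
    where
    t = i N.∸ j N.∸ 1
    suc-t : suc t ≡ i N.∸ j
    suc-t = NP.m+[n∸m]≡n (NP.m<n⇒0<n∸m j<i)
    exponent≡ : exponent i j ≡ 2 N.* h N.+ suc t
    exponent≡ = begin
      h N.+ (i N.+ (h N.∸ j))
        ≡⟨ cong (λ i → h N.+ (i N.+ (h N.∸ j)))
          (sym (trans (cong (N._+ j) suc-t) (NP.m∸n+n≡m (NP.<⇒≤ j<i)))) ⟩
      h N.+ (suc t N.+ j N.+ (h N.∸ j))
        ≡⟨ cong (h N.+_) (trans (NP.+-assoc (suc t) j (h N.∸ j)) (cong (suc t N.+_) (NP.m+[n∸m]≡n j≤h))) ⟩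
      h N.+ (suc t N.+ h) ≡⟨ cong (h N.+_) (NP.+-comm (suc t) h) ⟩
      h N.+ (h N.+ suc t) ≡⟨ sym (NP.+-assoc h h (suc t)) ⟩
      h N.+ h N.+ suc t ≡⟨ cong (λ x → h N.+ x N.+ suc t) (sym (NP.+-identityʳ h)) ⟩
      2 N.* h N.+ suc t ∎
    t< : suc t N.< 2 N.* h
    t< = NP.≤-<-trans (NP.≤-trans (NP.≤-reflexive suc-t) (NP.≤-trans (NP.m∸n≤m i j) i≤h))
      (NP.m<m+n h (NP.≤-trans (s≤s z≤n) (NP.m≤m+n h 0)))

  coef₁ coef₂ : ℕ → Carrier
  coef₁ i = ι (h C i) * (- 1#) ^ (h N.∸ i)
  coef₂ j = ι (h C j) * (- d) ^ j

  -- Euler's criterion turns the character of `a (a - 1) (a - d)` into an `h`-th power, to which the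
  -- binomial theorem is applied twice.
  expansion : ∀ a → cast (X (a ∷ [])) ≡ ∑ᴷ (upTo (suc h))
    (λ i → ∑ᴷ (upTo (suc h)) (λ j → coef₁ i * coef₂ j * a ^ exponent i j))
  expansion a = begin
    cast (X (a ∷ [])) ≡⟨ cast-χ _ ⟩
    values (a ∷ []) ^ h
      -- The last factor is ordered as `-d + a`, so that the binomial index `j` becomes the exponent
      -- of `d`, as in the Hasse sum.
      ≡⟨ cong (_^ h) (solve 2 (λ a d → (a :+ :0 :* :1) :* (a :+ :- :1 :* :1) :* (a :+ :- d :* :1)
                                                                  := a :* ((a :+ :- :1) :* (:- d :+ a)))
                                                                    refl a d) ⟩
    (a * ((a + - 1#) * (- d + a))) ^ h
      ≡⟨ trans (^-distrib-* a _ h) (cong (a ^ h *_) (^-distrib-* _ _ h)) ⟩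
    a ^ h * ((a + - 1#) ^ h * (- d + a) ^ h)
      ≡⟨ cong₂ (λ u v → a ^ h * (u * v)) (binomial h a (- 1#)) (binomial h (- d) a) ⟩
    a ^ h * (∑ᴷ is f * ∑ᴷ is g)
      ≡⟨ cong (a ^ h *_) (trans (*-comm _ _) (sym (∑ᴷ-*ˡ (∑ᴷ is g) is f))) ⟩
    a ^ h * ∑ᴷ is (λ i → ∑ᴷ is g * f i) ≡⟨ sym (∑ᴷ-*ˡ (a ^ h) is _) ⟩
    ∑ᴷ is (λ i → a ^ h * (∑ᴷ is g * f i))
      ≡⟨ ∑ᴷ-cong is (λ i → trans (cong (a ^ h *_) (trans (*-comm _ _) (sym (∑ᴷ-*ˡ (f i) is g))))
                                                                  (trans (sym (∑ᴷ-*ˡ (a ^ h) is _)) (∑ᴷ-cong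
                                                                    is (λ j → collect i j)))) ⟩
    ∑ᴷ is (λ i → ∑ᴷ is (λ j → coef₁ i * coef₂ j * a ^ exponent i j)) ∎
    where
    is = upTo (suc h)
    f g : ℕ → Carrier
    f i = ι (h C i) * (a ^ i * (- 1#) ^ (h N.∸ i))
    g j = ι (h C j) * ((- d) ^ j * a ^ (h N.∸ j))
    collect : ∀ i j → a ^ h * (f i * g j) ≡ coef₁ i * coef₂ j * a ^ exponent i j
    collect i j = trans (solve 7 (λ x b y s b′ t z → x :* ((b :* (y :* s)) :* (b′ :* (t :* z))) := (b :* s)
      :* (b′ :* t) :* (x :* (y :* z)))
        refl (a ^ h) (ι (h C i)) (a ^ i) ((- 1#) ^ (h N.∸ i)) (ι (h C j)) ((- d) ^ j) (a ^ (h N.∸ j)))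
      (cong (coef₁ i * coef₂ j *_) (sym (trans (^-homo-* a h _) (cong (a ^ h *_) (^-homo-* a i (h N.∸ j))))))

  diagonal : ∀ i → i N.≤ h → coef₁ i * coef₂ i ≡ (- 1#) ^ h * ι ((h C i) N.* (h C i) N.* d₀ N.^ i)
  diagonal i i≤h = begin
    (b * (- 1#) ^ (h N.∸ i)) * (b * (- d) ^ i) ≡⟨ cong (λ t → (b * (- 1#) ^ (h N.∸ i)) * (b * t))
                                                                   (trans (cong (_^ i) (solve 1 (λ d → :- d
                                                                     := :- :1 :* d) refl d)) (^-distrib-*
                                                                     (- 1#) d i)) ⟩
    (b * (- 1#) ^ (h N.∸ i)) * (b * ((- 1#) ^ i * d ^ i))
      ≡⟨ solve 4 (λ b x y z → (b :* x) :* (b :* (y :* z)) := (y :* x) :* ((b :* b) :* z)) refl b _ _ _ ⟩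
    ((- 1#) ^ i * (- 1#) ^ (h N.∸ i)) * ((b * b) * d ^ i)
      ≡⟨ cong₂ _*_ (trans (sym (^-homo-* (- 1#) i (h N.∸ i))) (cong ((- 1#) ^_) (NP.m+[n∸m]≡n i≤h)))
                                                                   (sym (trans (ι-* ((h C i) N.* (h C i))
                                                                     (d₀ N.^ i)) (cong₂ _*_ (ι-* (h C i) (h
                                                                     C i)) (ι-^ d₀ i)))) ⟩
    (- 1#) ^ h * ι ((h C i) N.* (h C i) N.* d₀ N.^ i) ∎
    where b = ι (h C i)

  -- Summing the expansion over `a` replaces powers of `a` by power sums. Only the diagonal
  -- survives, each term with factor -1, and what remains is the Hasse sum up to sign.
  cast-c₁ : cast (c 1) ≡ 0#
  cast-c₁ = begin
    cast (c 1)
      ≡⟨ cong cast (trans (∑-cartesian _∷_ elems _ X) (∑-cong elems (λ a → ZP.+-identityʳ (X (a ∷ []))))) ⟩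
    cast (∑ elems (λ a → X (a ∷ [])))
      ≡⟨ trans (cast-∑ elems _) (∑ᴷ-cong elems expansion) ⟩
    ∑ᴷ elems (λ a → ∑ᴷ is (λ i → ∑ᴷ is (λ j → coef₁ i * coef₂ j * a ^ exponent i j)))
      ≡⟨ trans (∑ᴷ-swap elems is _) (∑ᴷ-cong is
        (λ i → trans (∑ᴷ-swap elems is _) (∑ᴷ-cong is (λ j → ∑ᴷ-*ˡ (coef₁ i * coef₂ j) elems _)))) ⟩
    ∑ᴷ is (λ i → ∑ᴷ is (λ j → coef₁ i * coef₂ j * powerSum (exponent i j)))
      ≡⟨ ∑ᴷ-cong∈ is (λ i m → row i (NP.≤-pred (∈-upTo⁻ m))) ⟩
    ∑ᴷ is (λ i → - ((- 1#) ^ h) * ι ((h C i) N.* (h C i) N.* d₀ N.^ i))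
      ≡⟨ ∑ᴷ-*ˡ (- ((- 1#) ^ h)) is _ ⟩
    - ((- 1#) ^ h) * ∑ᴷ is (λ i → ι ((h C i) N.* (h C i) N.* d₀ N.^ i))
      ≡⟨ cong (- ((- 1#) ^ h) *_) (trans (sym (ι-sum is (λ i → (h C i) N.* (h C i) N.* d₀ N.^ i)))
        (vanish supersingular)) ⟩
    - ((- 1#) ^ h) * 0#
      ≡⟨ zeroʳ _ ⟩
    0# ∎
    where
    is = upTo (suc h)
    vanish : ∀ {n} → p ∣ n → ι n ≡ 0#
    vanish (divides k refl) = ι-multiple k
    row : ∀ i → i N.≤ h → ∑ᴷ is (λ j → coef₁ i * coef₂ j * powerSum (exponent i j)) ≡ - ((- 1#) ^ h) * ι
      ((h C i) N.* (h C i) N.* d₀ N.^ i)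
    row i i≤h = begin
      ∑ᴷ is (λ j → coef₁ i * coef₂ j * powerSum (exponent i j))
        ≡⟨ ∑ᴷ-cong∈ is (λ j m → off j m) ⟩
      ∑ᴷ is (λ j → if does (j N.≟ i) then - (coef₁ i * coef₂ i) else 0#)
        ≡⟨ ∑ᴷ-single (UP.upTo⁺ (suc h)) (∈-upTo⁺ (s≤s i≤h)) (λ j ne → []·-no (j N.≟ i) ne) ⟩
      (if does (i N.≟ i) then - (coef₁ i * coef₂ i) else 0#)
        ≡⟨ []·-yes (i N.≟ i) refl ⟩
      - (coef₁ i * coef₂ i)
        ≡⟨ trans (cong -_ (diagonal i i≤h)) (-‿distribˡ-* _ _) ⟩
      - ((- 1#) ^ h) * ι ((h C i) N.* (h C i) N.* d₀ N.^ i) ∎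
      where
      open ListSum _+_ 0# +-isCommutativeMonoid using ([]·-yes; []·-no)
      off : ∀ j → j ∈ is → coef₁ i * coef₂ j * powerSum (exponent i j) ≡
        (if does (j N.≟ i) then - (coef₁ i * coef₂ i) else 0#)
      off j m = go (j N.≟ i)
        where
        go : (e : Dec (j ≡ i)) → coef₁ i * coef₂ j * powerSum (exponent i j) ≡
          (if does e then - (coef₁ i * coef₂ i) else 0#)
        go (yes refl) = trans (cong (λ e → coef₁ i * coef₂ i * powerSum (h N.+ e))
          (trans (NP.m+[n∸m]≡n i≤h) (sym (NP.+-identityʳ h))))
          (trans (cong (coef₁ i * coef₂ i *_) powerSum-2h) (solve 1 (λ x → x :* :- :1 := :- x) refl _))
        go (no ne) = trans (cong (coef₁ i * coef₂ j *_)
          (powerSum-exponent i j i≤h (NP.≤-pred (∈-upTo⁻ m)) (ne ∘ sym))) (zeroʳ _)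

  -- The term at a = 0 vanishes, so that |c 1| < p.
  c₁ : c 1 ≡ # 0
  c₁ = ZP.∣i∣≡0⇒i≡0 (divisible-small Z.∣ c 1 ∣ (p∣∣i∣ (c 1) cast-c₁) (bound (c 1) upper lower))
    where
    divisible-small : ∀ n → p ∣ n → n N.< p → n ≡ 0
    divisible-small zero    _ _   = refl
    divisible-small (suc n) d n<p = ⊥-elim (NP.<⇒≱ n<p (∣⇒≤ d))
    p∣∣i∣ : ∀ i → cast i ≡ 0# → p ∣ Z.∣ i ∣
    p∣∣i∣ (# n)    e = ι≡0⇒∣ n e
    p∣∣i∣ -[1+ n ] e = ι≡0⇒∣ (suc n) (trans (sym (-‿involutive _)) (trans (cong -_ e) -0#≈0#))
    bound : ∀ i → i Z.+ # 1 Z.≤ # p → Z.- i Z.+ # 1 Z.≤ # p → Z.∣ i ∣ N.< p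
    bound (# n)    u l = subst (N._≤ p) (NP.+-comm n 1) (ZP.drop‿+≤+ u)
    bound -[1+ n ] u l = subst (N._≤ p) (NP.+-comm (suc n) 1) (ZP.drop‿+≤+ l)
    X≤ : ∀ a → X (a ∷ []) Z.+ ⟦ a ≟ 0# ⟧ Z.≤ # 1
    X≤ a with a ≟ 0#
    ... | yes refl = ZP.≤-reflexive (cong (Z._+ # 1)
      (χ-0 (solve 1 (λ d → (:0 :+ :0 :* :1) :* (:0 :+ :- :1 :* :1) :* (:0 :+ :- d :* :1) := :0) refl d)))
    ... | no _ with X (a ∷ []) | χ-sign (values (a ∷ []))
    ... | _ | nul = Z.+≤+ z≤n
    ... | _ | pos = ZP.≤-refl
    ... | _ | neg = Z.-≤+
    -X≤ : ∀ a → Z.- X (a ∷ []) Z.+ ⟦ a ≟ 0# ⟧ Z.≤ # 1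
    -X≤ a with a ≟ 0#
    ... | yes refl = ZP.≤-reflexive (cong (λ x → Z.- x Z.+ # 1)
      (χ-0 (solve 1 (λ d → (:0 :+ :0 :* :1) :* (:0 :+ :- :1 :* :1) :* (:0 :+ :- d :* :1) := :0) refl d)))
    ... | no _ with X (a ∷ []) | χ-sign (values (a ∷ []))
    ... | _ | nul = Z.+≤+ z≤n
    ... | _ | pos = Z.-≤+
    ... | _ | neg = ZP.≤-refl
    c1≡ : c 1 ≡ ∑ elems (λ a → X (a ∷ []))
    c1≡ = trans (∑-cartesian _∷_ elems _ X) (∑-cong elems (λ a → ZP.+-identityʳ (X (a ∷ []))))
    upper : c 1 Z.+ # 1 Z.≤ # p
    upper = ZP.≤-trans (ZP.≤-reflexive (trans (cong₂ Z._+_ c1≡ (sym (∑-δ1 _≟_ elems-unique (∈-elems 0#))))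
      (sym (∑-∙ elems _ _))))
      (ZP.≤-trans (∑-mono elems (λ a _ → X≤ a))
        (ZP.≤-reflexive (trans (∑-elems-const (# 1)) (ZP.*-identityʳ (# p)))))
    lower : Z.- c 1 Z.+ # 1 Z.≤ # p
    lower = ZP.≤-trans (ZP.≤-reflexive (trans
      (cong₂ Z._+_ (trans (cong Z.-_ c1≡) (trans (sym (ZP.-1*i≡-i _)) (trans (sym (∑-*ˡ (Z.- (# 1)) elems _))
          (∑-cong elems (λ a → ZP.-1*i≡-i (X (a ∷ []))))))) (sym (∑-δ1 _≟_ elems-unique (∈-elems 0#))))
            (sym (∑-∙ elems _ _))))
      (ZP.≤-trans (∑-mono elems (λ a _ → -X≤ a))
        (ZP.≤-reflexive (trans (∑-elems-const (# 1)) (ZP.*-identityʳ (# p)))))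

-- Point counts

#-sum : {B : Set} (xs : List B) (f : B → ℕ) → # sum (map f xs) ≡ ∑ xs (λ x → # f x)
#-sum []       f = refl
#-sum (x ∷ xs) f = cong (Z._+_ (# f x)) (#-sum xs f)

module Curves {q : ℕ} (K : FiniteField q) (k : ℕ) (q≡ : q ≡ suc (2 N.* suc k))
  (d₀ : ℕ) (d≢0 : FiniteField.ι K d₀ ≢ FiniteField.0# K) (d≢1 : FiniteField.ι K d₀ ≢ FiniteField.1# K) where

  open FieldTheory K
  open Character K k q≡
  open ≡-Reasoning

  d : Carrier
  d = ι d₀

  #-count : (l r : Carrier → Carrier → Carrier) →
            # countSolutions K l r ≡ ∑ elems (λ x → ∑ elems (λ y → ⟦ l x y ≟ r x y ⟧))
  #-count l r = trans (#-sum (allFin q) _) (trans (∑-cong (allFin q) (λ i → trans (#-sum (allFin q) _)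
      (trans (∑-cong (allFin q) (λ j → bit (does (l (elt i) (elt j) ≟ r (elt i) (elt j)))))
        (sym (∑-map elt (allFin q) _)))))
    (sym (∑-map elt (allFin q) _)))
    where
    bit : ∀ b → # (if b then 1 else 0) ≡ (if b then # 1 else # 0)
    bit true  = refl
    bit false = refl

  2≢0 : ι 2 ≢ 0#
  2≢0 e = 1≢-1 (begin
    1# ≡⟨ solve 0 (:1 := con (# 2) :- :1) refl ⟩
    ι 2 + - 1# ≡⟨ trans (cong (_+ - 1#) e) (+-identityˡ _) ⟩
    - 1# ∎)

  4≢0 : ι 4 ≢ 0#
  4≢0 e = *-≢0 2≢0 2≢0 (trans (solve 0 (con (# 2) :* con (# 2) := con (# 4)) refl) e)

  1-d≢0 : 1# + - d ≢ 0#
  1-d≢0 e = d≢1 (sym (x-y≡0⇒x≡y e))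

  d-1≢0 : d + - 1# ≢ 0#
  d-1≢0 e = d≢1 (x-y≡0⇒x≡y e)

  -‿≢0 : ∀ {x} → x ≢ 0# → - x ≢ 0#
  -‿≢0 ne e = ne (trans (sym (-‿involutive _)) (trans (cong -_ e) -0#≈0#))

  χ-inv : ∀ {x} → x ≢ 0# → χ (inv x) ≡ χ x
  χ-inv {x} ne = trans (sym (χ-sq-* ne (inv x)))
    (cong χ (trans (*-assoc x x (inv x))
    (trans (cong (x *_) (*-inv ne)) (trans (*-comm x 1#) (*-identityˡ x)))))

  legendreCubic : Carrier → Carrier
  legendreCubic t = t * ((1# + - t) * (1# + - (d * t)))

  S : ℤ
  S = ∑ elems (λ t → χ (legendreCubic t))

  -- The substitution `u = -d t` produces the Legendre form up to the square `d^2`.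
  S≡ : ∑ elems (λ u → χ ((0# + - u) * (- 1# + - u) * (- d + - u))) ≡ S
  S≡ = trans (sym (∑-affine (-‿≢0 d≢0) 0# _)) (∑-cong elems (λ t → trans (cong χ
    (solve 2 (λ d t → let u = :- d :* t :+ :0 in (:0 :- u) :* (:- :1 :- u) :* (:- d :- u)
                        := d :* d :* (t :* ((:1 :- t) :* (:1 :- d :* t)))) refl d t))
                          (χ-sq-* d≢0 (legendreCubic t))))

  -- With `t = (1 - y)/d` the product becomes `y (y + d - 1)/d`; since `d` is not 1, the quadratic
  -- character sum is -1, and the factor `1/d` has the character of `d`.
  conic-sum : ∑ elems (λ t → χ ((1# + - t) * (1# + - (d * t)))) ≡ Z.- χ d
  conic-sum = begin
    ∑ elems (λ t → χ ((1# + - t) * (1# + - (d * t))))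
      ≡⟨ sym (∑-affine (-‿≢0 (inv-≢0 d≢0)) (inv d) _) ⟩
    ∑ elems (λ y → χ ((1# + - (- inv d * y + inv d)) * (1# + - (d * (- inv d * y + inv d)))))
      ≡⟨ ∑-cong elems (λ y → trans (cong χ (expand y))
        (trans (χ-* (inv d) _) (cong (Z._* χ (y * (y + (d + - 1#)))) (χ-inv d≢0)))) ⟩
    ∑ elems (λ y → χ d Z.* χ (y * (y + (d + - 1#))))
      ≡⟨ ∑-*ˡ (χ d) elems _ ⟩
    χ d Z.* Q
      ≡⟨ ZS.solve 2 (λ a b → a ⊗ b ⊜ a ⊗ (b ⊕ ZS.con (# 1)) ⊖ a) refl (χ d) Q ⟩
    χ d Z.* (Q Z.+ # 1) Z.- χ d
      ≡⟨ cong (λ z → χ d Z.* z Z.- χ d) (trans (∑χ-quadratic (d + - 1#))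
        (trans (cong (Z._*_ (# q)) (⟦⟧-no ((d + - 1#) ≟ 0#) d-1≢0)) (ZP.*-zeroʳ (# q)))) ⟩
    χ d Z.* # 0 Z.- χ d
      ≡⟨ ZS.solve 1 (λ a → a ⊗ ZS.con (# 0) ⊖ a ⊜ ⊝ a) refl (χ d) ⟩
    Z.- χ d ∎
    where
    Q = ∑ elems (λ y → χ (y * (y + (d + - 1#))))
    expand : ∀ y → (1# + - (- inv d * y + inv d)) * (1# + - (d * (- inv d * y + inv d))) ≡ inv d *
      (y * (y + (d + - 1#)))
    expand y = begin
      (1# + - (- inv d * y + inv d)) * (1# + - (d * (- inv d * y + inv d)))
        ≡⟨ solve 3 (λ i y d → (:1 :- (:- i :* y :+ i)) :* (:1 :- d :* (:- i :* y :+ i))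
             := (i :* y :- i :+ :1) :* (:1 :+ (d :* i) :* (y :- :1))) refl (inv d) y d ⟩
      (inv d * y + - inv d + 1#) * (1# + (d * inv d) * (y + - 1#))
        ≡⟨ cong₂ (λ s t → (inv d * y + - inv d + s) * (1# + t * (y + - 1#))) (sym (*-inv d≢0)) (*-inv d≢0) ⟩
      (inv d * y + - inv d + d * inv d) * (1# + 1# * (y + - 1#))
        ≡⟨ solve 3 (λ i y d → (i :* y :- i :+ d :* i) :* (:1 :+ :1 :* (y :- :1)) := i :*
          (y :* (y :+ (d :- :1)))) refl (inv d) y d ⟩
      inv d * (y * (y + (d + - 1#))) ∎

  -- Grouping by `t = x^2` weights each `t` by `1 + χ t`; the 1 gives the conic and `χ t` completes
  -- the Legendre cubic.
  quartic-sum : ∑ elems (λ x → χ ((1# + - (x * x)) * (1# + - (d * (x * x))))) ≡ Z.- χ d Z.+ S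
  quartic-sum = begin
    ∑ elems (λ x → f (x * x))
      ≡⟨ ∑-count _≟_ elems elems-unique (λ x → x * x) (λ x _ → ∈-elems (x * x)) f ⟩
    ∑ elems (λ t → roots t Z.* f t)
      ≡⟨ ∑-cong elems (λ t → trans (cong (Z._* f t) (count-roots≡1+χ t))
        (trans (ZP.*-distribʳ-+ (f t) (# 1) (χ t))
           (cong₂ Z._+_ (ZP.*-identityˡ (f t)) (sym (χ-* t _))))) ⟩
    ∑ elems (λ t → f t Z.+ χ (legendreCubic t))
      ≡⟨ trans (∑-∙ elems _ _) (cong (Z._+ S) conic-sum) ⟩
    Z.- χ d Z.+ S ∎
    where
    f : Carrier → ℤ
    f t = χ ((1# + - t) * (1# + - (d * t)))

  -- For nonzero `B` the roots are the square roots of `A / B`, whose character is that of `A B`.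
  -- For `B = 0` there are none while the right side is 1; the indicator makes up the difference.
  scaled-roots : ∀ A B → (B ≡ 0# → A ≢ 0#) →
                 ∑ elems (λ y → ⟦ (B * (y * y)) ≟ A ⟧) Z.+ ⟦ B ≟ 0# ⟧ ≡ # 1 Z.+ χ (A * B)
  scaled-roots A B side = go (B ≟ 0#)
    where
    go : Dec (B ≡ 0#) → ∑ elems (λ y → ⟦ (B * (y * y)) ≟ A ⟧) Z.+ ⟦ B ≟ 0# ⟧ ≡ # 1 Z.+ χ (A * B)
    go (yes e) = begin
      ∑ elems (λ y → ⟦ (B * (y * y)) ≟ A ⟧) Z.+ ⟦ B ≟ 0# ⟧
        ≡⟨ cong₂ Z._+_ (∑-ε elems (λ y _ → ⟦⟧-no ((B * (y * y)) ≟ A)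
          (λ z → side e (trans (sym z) (trans (cong (_* (y * y)) e) (zeroˡ _))))))
             (⟦⟧-yes (B ≟ 0#) e) ⟩
      # 1 ≡⟨ cong (Z._+_ (# 1)) (sym (χ-0 (trans (cong (A *_) e) (zeroʳ A)))) ⟩
      # 1 Z.+ χ (A * B) ∎
    go (no ne) = begin
      ∑ elems (λ y → ⟦ (B * (y * y)) ≟ A ⟧) Z.+ ⟦ B ≟ 0# ⟧
        ≡⟨ cong₂ Z._+_ (∑-cong elems (λ y → ⟦⟧-⇔ ((B * (y * y)) ≟ A) ((y * y) ≟ (inv B * A))
             (λ z → trans (sym (inv-cancelˡ ne (y * y))) (cong (inv B *_) z))
             (λ z → trans (cong (B *_) z) (inv-cancelʳ ne A)))) (⟦⟧-no (B ≟ 0#) ne) ⟩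
      roots (inv B * A) Z.+ # 0 ≡⟨ trans (ZP.+-identityʳ _) (count-roots≡1+χ _) ⟩
      # 1 Z.+ χ (inv B * A) ≡⟨ cong (Z._+_ (# 1)) (sym (χ-sq-* ne (inv B * A))) ⟩
      # 1 Z.+ χ (B * B * (inv B * A))
        ≡⟨ cong (λ t → # 1 Z.+ χ t) (trans (*-assoc B B _)
          (trans (cong (B *_) (inv-cancelʳ ne A)) (*-comm B A))) ⟩
      # 1 Z.+ χ (A * B) ∎

  ∑-poles : ∑ elems (λ x → ⟦ (1# + - (d * (x * x))) ≟ 0# ⟧) ≡ # 1 Z.+ χ d
  ∑-poles = trans (∑-cong elems (λ x → ⟦⟧-⇔ ((1# + - (d * (x * x))) ≟ 0#) ((x * x) ≟ inv d)
      (λ e → *-cancel d≢0 (trans (sym (x-y≡0⇒x≡y e)) (sym (*-inv d≢0))))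
      (λ e → trans (cong (λ t → 1# + - (d * t)) e)
        (trans (cong (λ t → 1# + - t) (*-inv d≢0)) (-‿inverseʳ 1#)))))
    (trans (count-roots≡1+χ (inv d)) (cong (Z._+_ (# 1)) (χ-inv d≢0)))

  -- For fixed `x` the curve reads `(1 - d x^2) y^2 = 1 - x^2`, which `scaled-roots` counts up to
  -- the correction at the zeros of `1 - d x^2`.
  affine-count : # edwardsAffineCount K d₀ ≡ # q Z.- # 1 Z.- # 2 Z.* χ d Z.+ S
  affine-count = begin
    # edwardsAffineCount K d₀
      ≡⟨ #-count _ _ ⟩
    ∑ elems column
      ≡⟨ ZS.solve 2 (λ a b → a ⊜ (a ⊕ b) ⊖ b) refl (∑ elems column) (∑ elems pole) ⟩
    (∑ elems column Z.+ ∑ elems pole) Z.- ∑ elems pole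
      ≡⟨ cong₂ Z._-_ (trans (sym (∑-∙ elems _ _)) (∑-cong elems per-x)) ∑-poles ⟩
    ∑ elems (λ x → # 1 Z.+ χ (A x * B x)) Z.- (# 1 Z.+ χ d)
      ≡⟨ cong (Z._- (# 1 Z.+ χ d)) (trans (∑-∙ elems _ _)
        (cong₂ Z._+_ (trans (∑-elems-const (# 1)) (ZP.*-identityʳ (# q))) quartic-sum)) ⟩
    # q Z.+ (Z.- χ d Z.+ S) Z.- (# 1 Z.+ χ d)
      ≡⟨ ZS.solve 3 (λ q x s → q ⊕ (⊝ x ⊕ s) ⊖ (ZS.con (# 1) ⊕ x)
           ⊜ q ⊖ ZS.con (# 1) ⊖ ZS.con (# 2) ⊗ x ⊕ s) refl (# q) (χ d) S ⟩
    # q Z.- # 1 Z.- # 2 Z.* χ d Z.+ S ∎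
    where
    A B : Carrier → Carrier
    A x = 1# + - (x * x)
    B x = 1# + - (d * (x * x))
    column pole : Carrier → ℤ
    column x = ∑ elems (λ y → ⟦ (x * x + y * y) ≟ (1# + d * (x * x) * (y * y)) ⟧)
    pole x = ⟦ B x ≟ 0# ⟧
    difference : ∀ x y → B x * (y * y) + - A x ≡ (x * x + y * y) + - (1# + d * (x * x) * (y * y))
    difference x y = solve 3 (λ d x y → (:1 :- d :* (x :* x)) :* (y :* y) :- (:1 :- x :* x)
      := (x :* x :+ y :* y) :- (:1 :+ d :* (x :* x) :* (y :* y))) refl d x y
    x≡y⇒x-y≡0 : ∀ {x y} → x ≡ y → x + - y ≡ 0#
    x≡y⇒x-y≡0 {x} refl = -‿inverseʳ x
    -- If both `d x^2` and `x^2` were 1, then `d` would be 1.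
    poles-off : ∀ x → B x ≡ 0# → A x ≢ 0#
    poles-off x b a = d≢1 (begin
      d ≡⟨ sym (trans (*-comm d 1#) (*-identityˡ d)) ⟩
      d * 1# ≡⟨ cong (d *_) (x-y≡0⇒x≡y a) ⟩
      d * (x * x) ≡⟨ sym (x-y≡0⇒x≡y b) ⟩
      1# ∎)
    per-x : ∀ x → column x Z.+ pole x ≡ # 1 Z.+ χ (A x * B x)
    per-x x = trans (cong (Z._+ pole x) (∑-cong elems (λ y → ⟦⟧-⇔
        ((x * x + y * y) ≟ (1# + d * (x * x) * (y * y))) ((B x * (y * y)) ≟ A x)
        (λ e → x-y≡0⇒x≡y (trans (difference x y) (x≡y⇒x-y≡0 e)))
        (λ e → x-y≡0⇒x≡y (trans (sym (difference x y)) (x≡y⇒x-y≡0 e))))))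
      (scaled-roots (A x) (B x) (poles-off x))

  montgomery : Carrier → Carrier
  montgomery u = (d + - 1#) * u * u * u + ι 2 * (d + 1#) * u * u + (d + - 1#) * u

  ℓ : Carrier → Carrier
  ℓ w = (d + - 1#) * w + ι 2 * (d + 1#)

  -- montgomery u = u² ℓ(w) with w = u + 1/u, that is, u² + 1 = w u.
  fibre-w : ∀ u → χ (montgomery u) ≡ ∑ elems (λ w → ⟦ (u * u + 1#) ≟ (w * u) ⟧ Z.* χ (ℓ w))
  fibre-w u = go (u ≟ 0#)
    where
    go : Dec (u ≡ 0#) → χ (montgomery u) ≡ ∑ elems (λ w → ⟦ (u * u + 1#) ≟ (w * u) ⟧ Z.* χ (ℓ w))
    go (yes refl) = trans (χ-0 (solve 1 (λ d → (d :- :1) :* :0 :* :0 :* :0 :+ con (# 2) :* (d :+ :1) :* :0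
      :* :0 :+ (d :- :1) :* :0 := :0) refl d))
      (sym (∑-ε elems (λ w _ → cong (Z._* χ (ℓ w))
        (⟦⟧-no ((0# * 0# + 1#) ≟ (w * 0#)) (λ e → 0≢1 (trans (sym (zeroʳ w))
        (trans (sym e) (solve 0 (:0 :* :0 :+ :1 := :1) refl))))))))
    go (no ne) = begin
      χ (montgomery u)
        ≡⟨ cong χ (begin
             montgomery u
               ≡⟨ solve 2 (λ d u → (d :- :1) :* u :* u :* u :+ con (# 2) :* (d :+ :1) :* u :* u :+ (d :- :1)
                 :* u
                    := u :* ((d :- :1) :* u :* u :+ con (# 2) :* (d :+ :1) :* u :+ (d :- :1) :* :1)) refl d
                      u ⟩
             u * ((d + - 1#) * u * u + ι 2 * (d + 1#) * u + (d + - 1#) * 1#)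
               ≡⟨ cong (λ t → u * ((d + - 1#) * u * u + ι 2 * (d + 1#) * u + (d + - 1#) * t))
                 (sym (*-inv ne)) ⟩
             u * ((d + - 1#) * u * u + ι 2 * (d + 1#) * u + (d + - 1#) * (u * inv u))
               ≡⟨ solve 3 (λ d u i → u :* ((d :- :1) :* u :* u :+ con (# 2) :* (d :+ :1) :* u :+ (d :- :1)
                 :* (u :* i))
                    := u :* u :* ((d :- :1) :* (u :+ i) :+ con (# 2) :* (d :+ :1))) refl d u (inv u) ⟩
             u * u * ℓ (u + inv u) ∎) ⟩
      χ (u * u * ℓ (u + inv u))
        ≡⟨ χ-sq-* ne _ ⟩
      χ (ℓ (u + inv u))
        ≡⟨ sym (∑-δ _≟_ elems-unique (∈-elems (u + inv u)) (χ ∘ ℓ)) ⟩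
      ∑ elems (λ w → ⟦ w ≟ (u + inv u) ⟧ Z.* χ (ℓ w))
        ≡⟨ ∑-cong elems (λ w → cong (Z._* χ (ℓ w)) (⟦⟧-⇔ (w ≟ (u + inv u)) ((u * u + 1#) ≟ (w * u))
             (λ { refl → trans (cong (u * u +_) (sym (inv-* ne))) (sym (distribʳ u u (inv u))) })
             (λ e → *-cancel ne (trans (*-comm u w)
               (trans (sym e) (trans (cong (u * u +_) (sym (*-inv ne))) (sym (distribˡ u u (inv u))))))))) ⟩
      ∑ elems (λ w → ⟦ (u * u + 1#) ≟ (w * u) ⟧ Z.* χ (ℓ w)) ∎

  -- Completing the square in `u^2 - w u + 1` gives `(2u - w)^2 = w^2 - 4`.
  fibre-u : ∀ w → ∑ elems (λ u → ⟦ (u * u + 1#) ≟ (w * u) ⟧) ≡ # 1 Z.+ χ (w * w + - ι 4)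
  fibre-u w = begin
    ∑ elems (λ u → ⟦ (u * u + 1#) ≟ (w * u) ⟧)
      ≡⟨ ∑-cong elems (λ u → ⟦⟧-⇔ ((u * u + 1#) ≟ (w * u))
        (((ι 2 * u + - w) * (ι 2 * u + - w)) ≟ (w * w + - ι 4))
           (λ e → x-y≡0⇒x≡y (trans (square u) (trans
             (cong (ι 4 *_) (trans (cong (_+ - (w * u)) e) (-‿inverseʳ _))) (zeroʳ _))))
           (λ e → [ (λ z → ⊥-elim (4≢0 z)) , x-y≡0⇒x≡y ]′
             (integral (ι 4) _ (trans (sym (square u))
             (trans (cong (_+ - (w * w + - ι 4)) e) (-‿inverseʳ _)))))) ⟩
    ∑ elems (λ u → ⟦ ((ι 2 * u + - w) * (ι 2 * u + - w)) ≟ (w * w + - ι 4) ⟧)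
      ≡⟨ ∑-affine 2≢0 (- w) (λ y → ⟦ (y * y) ≟ (w * w + - ι 4) ⟧) ⟩
    roots (w * w + - ι 4)
      ≡⟨ count-roots≡1+χ _ ⟩
    # 1 Z.+ χ (w * w + - ι 4) ∎
    where
    square : ∀ u → (ι 2 * u + - w) * (ι 2 * u + - w) + - (w * w + - ι 4) ≡ ι 4 * ((u * u + 1#) + - (w * u))
    square u = solve 2 (λ u w → (con (# 2) :* u :- w) :* (con (# 2) :* u :- w) :- (w :* w :- con (# 4))
      := con (# 4) :* ((u :* u :+ :1) :- w :* u)) refl u w

  -- The cubic has the roots 2, -2 and `2(1 + d)/(1 - d)`. The affine substitution takes `x = 0`, 1,
  -- `1/d` to the root of `ℓ`, to 2 and to -2 respectively; the constant left over is the square of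
  -- `8 d / (1 - d)`.
  w-sum : ∑ elems (λ w → χ ((w * w + - ι 4) * ℓ w)) ≡ S
  w-sum = trans (sym (∑-affine (-‿≢0 (*-≢0 (*-≢0 4≢0 d≢0) (inv-≢0 1-d≢0))) (- ι 2 + ι 4 * r) _))
    (∑-cong elems (λ x → trans (cong χ (expand x))
      (χ-sq-* (*-≢0 (*-≢0 (*-≢0 4≢0 2≢0) (inv-≢0 1-d≢0)) d≢0) (legendreCubic x))))
    where
    r ε : Carrier
    r = inv (1# + - d)
    -- The ring solver does not know that `r` inverts `1 - d`; the identity is therefore proved with
    -- the defect `ε` as an explicit expression, which is then set to 0.
    ε = (1# + - d) * r + - 1#
    ε≡0 : ε ≡ 0#
    ε≡0 = trans (cong (_+ - 1#) (*-inv 1-d≢0)) (-‿inverseʳ 1#)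
    expand : ∀ x → let w = - (ι 4 * d * r) * x + (- ι 2 + ι 4 * r) in
      (w * w + - ι 4) * ℓ w ≡ (ι 4 * ι 2 * r * d) * (ι 4 * ι 2 * r * d) * legendreCubic x
    expand x = begin
      (w * w + - ι 4) * ℓ w
        ≡⟨ solve 3 (λ d r x → let w = :- (con (# 4) :* d :* r) :* x :+ (:- con (# 2) :+ con (# 4) :* r) ; ε = (:1 :- d) :* r :- :1 in
             (w :* w :- con (# 4)) :* ((d :- :1) :* w :+ con (# 2) :* (d :+ :1))
             := ((con (# 4) :* r :* d :* (:1 :- x) :+ con (# 4) :* ε) :* (con (# 4) :* r :* (:1 :- d :* x)))
                :* (con (# 4) :* d :* x :- con (# 4) :* (:1 :- d :* x) :* ε)) refl d r x ⟩
      ((ι 4 * r * d * (1# + - x) + ι 4 * ε) * (ι 4 * r * (1# + - (d * x)))) *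
        (ι 4 * d * x + - (ι 4 * (1# + - (d * x)) * ε))
        ≡⟨ cong (λ e → ((ι 4 * r * d * (1# + - x) + ι 4 * e) * (ι 4 * r * (1# + - (d * x)))) *
          (ι 4 * d * x + - (ι 4 * (1# + - (d * x)) * e))) ε≡0 ⟩
      ((ι 4 * r * d * (1# + - x) + ι 4 * 0#) * (ι 4 * r * (1# + - (d * x)))) *
        (ι 4 * d * x + - (ι 4 * (1# + - (d * x)) * 0#))
        ≡⟨ solve 3 (λ d r x → ((con (# 4) :* r :* d :* (:1 :- x) :+ con (# 4) :* :0) :*
          (con (# 4) :* r :* (:1 :- d :* x)))
                :* (con (# 4) :* d :* x :- con (# 4) :* (:1 :- d :* x) :* :0)
             := (con (# 4) :* con (# 2) :* r :* d) :* (con (# 4) :* con (# 2) :* r :* d) :*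
               (x :* ((:1 :- x) :* (:1 :- d :* x)))) refl d r x ⟩
      (ι 4 * ι 2 * r * d) * (ι 4 * ι 2 * r * d) * legendreCubic x ∎
      where w = - (ι 4 * d * r) * x + (- ι 2 + ι 4 * r)

  montgomery-sum : ∑ elems (χ ∘ montgomery) ≡ S
  montgomery-sum = begin
    ∑ elems (χ ∘ montgomery)
      ≡⟨ trans (∑-cong elems fibre-w) (trans (∑-swap elems elems _)
        (∑-cong elems (λ w → trans (∑-*ʳ (χ (ℓ w)) elems _) (cong (Z._* χ (ℓ w)) (fibre-u w))))) ⟩
    ∑ elems (λ w → (# 1 Z.+ χ (w * w + - ι 4)) Z.* χ (ℓ w))
      ≡⟨ ∑-cong elems (λ w → trans (ZP.*-distribʳ-+ (χ (ℓ w)) (# 1) (χ (w * w + - ι 4)))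
        (cong₂ Z._+_ (ZP.*-identityˡ (χ (ℓ w))) (sym (χ-* (w * w + - ι 4) (ℓ w))))) ⟩
    ∑ elems (λ w → χ (ℓ w) Z.+ χ ((w * w + - ι 4) * ℓ w))
      ≡⟨ trans (∑-∙ elems _ _) (cong₂ Z._+_ (∑χ-affine d-1≢0 _) w-sum) ⟩
    # 0 Z.+ S
      ≡⟨ ZP.+-identityˡ S ⟩
    S ∎

  projective-count : # edwardsProjectiveCount K d₀ ≡ # q Z.+ # 1 Z.+ S
  projective-count = begin
    # edwardsProjectiveCount K d₀
      ≡⟨ cong (Z._+_ (# 1)) (trans (#-count _ _) (∑-cong elems (λ u → count-roots≡1+χ (montgomery u)))) ⟩
    # 1 Z.+ ∑ elems (λ u → # 1 Z.+ χ (montgomery u))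
      ≡⟨ cong (Z._+_ (# 1)) (trans (∑-∙ elems _ _)
        (cong₂ Z._+_ (trans (∑-elems-const (# 1)) (ZP.*-identityʳ (# q))) montgomery-sum)) ⟩
    # 1 Z.+ (# q Z.+ S)
      ≡⟨ ZS.solve 2 (λ q s → ZS.con (# 1) ⊕ (q ⊕ s) ⊜ q ⊕ ZS.con (# 1) ⊕ s) refl (# q) S ⟩
    # q Z.+ # 1 Z.+ S ∎

-- The prime field

-- The field `natural` brings elements of `F` back to natural numbers below `p`, the range searched
-- by `legendre`.
record PrimeSubfield (p : ℕ) {q : ℕ} (K : FiniteField q) : Set₁ where
  field
    F       : FiniteField p
    hom     : FieldHom F K
    natural : ∀ x → ∃ λ k → k N.< p × FieldHom.σ hom x ≡ FiniteField.ι K k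

module Residues {q : ℕ} (K : FiniteField q) (p : ℕ) (pr : Prime p)
  (ι-p : FiniteField.ι K p ≡ FiniteField.0# K) where

  open FieldTheory K
  open Characteristic K p pr ι-p
  open ≡-Reasoning

  instance
    p-nonZero : N.NonZero p
    p-nonZero = prime⇒nonZero pr

  ι-% : ∀ n → ι (n % p) ≡ ι n
  ι-% n = sym (begin
    ι n ≡⟨ cong ι (m≡m%n+[m/n]*n n p) ⟩
    ι (n % p N.+ n / p N.* p) ≡⟨ ι-+ (n % p) _ ⟩
    ι (n % p) + ι (n / p N.* p)
      ≡⟨ trans (cong (ι (n % p) +_) (ι-multiple (n / p))) (+-identityʳ _) ⟩
    ι (n % p) ∎)

  ι-≢0 : ∀ n → 0 N.< n → n N.< p → ι n ≢ 0#
  ι-≢0 (suc n) _ n<p e = NP.<⇒≱ n<p (∣⇒≤ (ι≡0⇒∣ (suc n) e))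

  ι-<-≢ : ∀ a b → a N.< b → b N.< p → ι a ≢ ι b
  ι-<-≢ a b a<b b<p e = ι-≢0 (b N.∸ a) (NP.m<n⇒0<n∸m a<b) (NP.≤-<-trans (NP.m∸n≤m b a) b<p) (begin
    ι (b N.∸ a) ≡⟨ solve 2 (λ x y → y := (x :+ y) :- x) refl (ι a) _ ⟩
    (ι a + ι (b N.∸ a)) + - ι a
      ≡⟨ cong (_+ - ι a) (trans (sym (ι-+ a (b N.∸ a))) (cong ι (NP.m+[n∸m]≡n (NP.<⇒≤ a<b)))) ⟩
    ι b + - ι a ≡⟨ trans (cong (λ t → ι b + - t) e) (-‿inverseʳ _) ⟩
    0# ∎)

  ι-injective : ∀ a b → a N.< p → b N.< p → ι a ≡ ι b → a ≡ b
  ι-injective a b a<p b<p e with NP.<-cmp a b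
  ... | tri< a<b _ _ = ⊥-elim (ι-<-≢ a b a<b b<p e)

  ... | tri≈ _ a≡b _ = a≡b
  ... | tri> _ _ b<a = ⊥-elim (ι-<-≢ b a b<a a<p (sym e))

  ι-≡⇒%-≡ : ∀ a b → ι a ≡ ι b → a % p ≡ b % p
  ι-≡⇒%-≡ a b e = ι-injective (a % p) (b % p) (m%n<n a p) (m%n<n b p) (trans (ι-% a) (trans e (sym (ι-% b))))

  residue : ℕ → Fin p
  residue n = fromℕ< (m%n<n n p)

  embed : Fin p → Carrier
  embed i = ι (toℕ i)

  embed-residue : ∀ n → embed (residue n) ≡ ι n
  embed-residue n = trans (cong ι (FinP.toℕ-fromℕ< (m%n<n n p))) (ι-% n)

  embed-injective : ∀ {i j} → embed i ≡ embed j → i ≡ j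
  embed-injective {i} {j} e = FinP.toℕ-injective (ι-injective (toℕ i) (toℕ j) (FinP.toℕ<n i) (FinP.toℕ<n j) e)

  residueRing : RawRing 0ℓ 0ℓ
  residueRing = record
    { Carrier = Fin p
    ; _≈_ = _≡_
    ; _+_ = λ i j → residue (toℕ i N.+ toℕ j)
    ; _*_ = λ i j → residue (toℕ i N.* toℕ j)
    ; -_  = λ i → residue (p N.∸ toℕ i)
    ; 0#  = residue 0
    ; 1#  = residue 1 }

  module R = RawRing residueRing

  embed-+ : ∀ i j → embed (i R.+ j) ≡ embed i + embed j
  embed-+ i j = trans (embed-residue _) (ι-+ (toℕ i) (toℕ j))

  embed-* : ∀ i j → embed (i R.* j) ≡ embed i * embed j
  embed-* i j = trans (embed-residue _) (ι-* (toℕ i) (toℕ j))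

  embed-neg : ∀ i → embed (R.- i) ≡ - embed i
  embed-neg i = begin
    embed (residue (p N.∸ toℕ i)) ≡⟨ embed-residue _ ⟩
    ι (p N.∸ toℕ i) ≡⟨ solve 2 (λ x y → y := (x :+ y) :- x) refl (embed i) _ ⟩
    (embed i + ι (p N.∸ toℕ i)) + - embed i
      ≡⟨ cong (_+ - embed i) (trans (sym (ι-+ (toℕ i) (p N.∸ toℕ i)))
                                                          (trans (cong ι (NP.m+[n∸m]≡n (NP.<⇒≤
                                                            (FinP.toℕ<n i)))) ι-p)) ⟩
    0# + - embed i ≡⟨ +-identityˡ _ ⟩
    - embed i ∎

  embed-1 : embed R.1# ≡ 1#
  embed-1 = trans (embed-residue 1) (+-identityʳ 1#)

  -- The residue operations go over into those of `K` under the injective map `embed`, so the ring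
  -- laws are pulled back from `K`.
  residue-isCommutativeRing : IsCommutativeRing _≡_ R._+_ R._*_ R.-_ R.0# R.1#
  residue-isCommutativeRing = RingMonomorphism.isCommutativeRing
    {R₁ = residueRing} {R₂ = record { Carrier = Carrier ; _≈_ = _≡_ ; _+_ = _+_ ; _*_ = _*_ ; -_ = -_ ; 0# =
      0# ; 1# = 1# }} {⟦_⟧ = embed}
    (record
      { isRingHomomorphism = record
        { isSemiringHomomorphism = record
          { isNearSemiringHomomorphism = record
            { +-isMonoidHomomorphism = record
              { isMagmaHomomorphism = record { isRelHomomorphism = record { cong = cong embed } ; homo =
                embed-+ }
              ; ε-homo = embed-residue 0 }
            ; *-homo = embed-* }
          ; 1#-homo = embed-1 }
        ; -‿homo = embed-neg }
      ; injective = embed-injective })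
    (FiniteField.isCommutativeRing K)

  primeField : FiniteField p
  primeField = record
    { Carrier = Fin p
    ; _+_ = R._+_ ; _*_ = R._*_ ; -_ = R.-_ ; 0# = R.0# ; 1# = R.1#
    ; isCommutativeRing = residue-isCommutativeRing
    ; 0≢1 = λ e → 0≢1 (trans (sym (embed-residue 0)) (trans (cong embed e) embed-1))
    ; inverse = inverse′
    ; enum = ↔-id (Fin p) }
    where
    inverse′ : ∀ i → i ≢ R.0# → ∃ λ j → i R.* j ≡ R.1#
    inverse′ i i≢0 = residue k , embed-injective (trans (embed-* i (residue k))
      (trans (cong (embed i *_) (embed-residue k)) (trans (proj₂ unit) (sym embed-1))))
      where
      unit = coprime⇒unit (toℕ i) (λ { (divides c e) → i≢0 (embed-injective
        (trans (trans (cong ι e) (ι-multiple c)) (sym (embed-residue 0)))) })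
      k = proj₁ unit

  primeSubfield : PrimeSubfield p K
  primeSubfield = record
    { F = primeField ; hom = record { σ = embed ; σ-+ = embed-+ ; σ-* = embed-* ; σ-1 = embed-1 }
    ; natural = λ i → toℕ i , FinP.toℕ<n i , refl }

-- The Legendre symbol and the two parities of the degree

legendre-spec : ∀ p .{{_ : N.NonZero p}} d → d % p ≢ 0 →
  ((∃ λ x → (x N.* x) % p ≡ d % p) × legendre p d ≡ # 1) ⊎
  ((∀ x → x N.< p → (x N.* x) % p ≢ d % p) × legendre p d ≡ -[1+ 0 ])
legendre-spec (suc m) d ne with d % suc m N.≟ 0
... | yes e = ⊥-elim (ne e)
... | no _ with any? (λ x → (x N.* x) % suc m N.≟ d % suc m) (upTo (suc m))
...   | yes some = inj₁ (satisfied some , refl)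
...   | no none  = inj₂ ((λ x x< e → none (lose (∈-upTo⁺ x<) e)) , refl)

odd-prime : ∀ p → Prime p → p ≢ 2 → ∃ λ m → p ≡ suc (2 N.* suc m) × (p N.∸ 1) / 2 ≡ suc m
odd-prime p pr p≢2 = go (p % 2) (p / 2) (m%n<n p 2) (m≡m%n+[m/n]*n p 2)
  where
  go : ∀ r h → r N.< 2 → p ≡ r N.+ h N.* 2 → ∃ λ m → p ≡ suc (2 N.* suc m) × (p N.∸ 1) / 2 ≡ suc m
  go 0 h _ e with prime⇒irreducible pr (divides h e)
  ... | inj₂ 2≡p = ⊥-elim (p≢2 (sym 2≡p))
  go 1 zero    _ e = ⊥-elim (NP.<-irrefl (sym e) (N.nonTrivial⇒n>1 p ⦃ prime⇒nonTrivial pr ⦄))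
  go 1 (suc m) _ e = m , trans e (cong suc (NP.*-comm (suc m) 2)) , trans (cong (λ t → (t N.∸ 1) / 2) e)
    (m*n/n≡m (suc m) 2)
  go (suc (suc r)) h (s≤s (s≤s ())) e

module Main (p : ℕ) (pr : Prime p) (m : ℕ) (p≡ : p ≡ suc (2 N.* suc m))
  (d : ℕ) (2≤d : 2 N.≤ d) (d<p : d N.< p) (supersingular : p ∣ hasseSum (suc m) d)
  (n : ℕ) (1≤n : 1 N.≤ n) (K : FiniteField (p N.^ n))
  (ι-p : FiniteField.ι K p ≡ FiniteField.0# K) (P : PrimeSubfield p K) where

  open PrimeSubfield P
  open Residues K p pr ι-p using (ι-≢0; ι-<-≢; ι-≡⇒%-≡; ι-%; p-nonZero)
  open FieldTheory K
  open Extension p pr n 1≤n F K hom using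
    (emb; emb-*; emb-1; emb-ι; emb-0; emb-neg; emb-injective; conj-emb; conj-zero)
  open ≡-Reasoning

  dᶠ : FiniteField.Carrier F
  dᶠ = FiniteField.ι F d

  d≢0 : ι d ≢ 0#
  d≢0 = ι-≢0 d (NP.<-trans (s≤s z≤n) 2≤d) d<p

  d≢1 : ι d ≢ 1#
  d≢1 e = ι-<-≢ 1 d 2≤d d<p (trans (+-identityʳ 1#) (sym e))

  dᶠ≢0 : dᶠ ≢ FiniteField.0# F
  dᶠ≢0 e = d≢0 (trans (sym (emb-ι d)) (trans (cong emb e) emb-0))

  dᶠ≢1 : dᶠ ≢ FiniteField.1# F
  dᶠ≢1 e = d≢1 (trans (sym (emb-ι d)) (trans (cong emb e) emb-1))

  open CharacterSum p pr n 1≤n F K hom m p≡ dᶠ dᶠ≢0 dᶠ≢1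
    using (k; q≡; module CF; module CK; cubic; χ-norm; module Supersingular)
  open HasseInvariant p pr F m p≡ d dᶠ≢0 dᶠ≢1 supersingular using (c₁)
  open Supersingular c₁
  open Curves K k q≡ d d≢0 d≢1 using (S; S≡; affine-count; projective-count)

  S≡∑cubic : S ≡ ∑ elems (λ u → CK.χ (cubic u))
  S≡∑cubic = trans (sym S≡) (∑-cong elems (λ u → cong CK.χ (sym (cong₂ _*_ (cong₂ _*_
    (cong (_+ - u) emb-0)
    (cong (_+ - u) (trans (emb-neg _) (cong -_ emb-1))))
    (cong (_+ - u) (trans (emb-neg _) (cong -_ (emb-ι d))))))))

  -- As `d` lies in the prime field, its norm from `K` is its `n`-th power. Hence the Legendre
  -- symbol survives for odd `n` and becomes 1 for even `n`.
  χ-d : CK.χ (ι d) ≡ CF.χ dᶠ Z.^ n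
  χ-d = trans (cong CK.χ (sym (emb-ι d))) (χ-norm (emb dᶠ) dᶠ 1 n
    (sym (trans (*-comm _ 1#) (trans (*-identityˡ _) (conj-zero (emb dᶠ))))) (conj-emb 1 dᶠ)
      (sym (NP.*-identityʳ n)))

  -- A square modulo `p` is a square in `F` and has character 1. Conversely, a square root in `F`
  -- would come from a natural number below `p`; if there is none, the root count `1 + χ` is 0,
  -- which leaves only -1.
  legendre≡χ : legendre p d ≡ CF.χ dᶠ
  legendre≡χ with legendre-spec p d d%p≢0
    where
    d%p≢0 : d % p ≢ 0
    d%p≢0 e = d≢0 (trans (sym (ι-% d)) (cong ι e))
  ... | inj₁ ((x , e) , l) = trans l (sym (trans (cong CF.χ square) (CF.χ-sq x≢0)))
    where
    module F′ = FieldTheory F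
    square : dᶠ ≡ F′.ι x F′.* F′.ι x
    square = emb-injective (begin
      emb dᶠ ≡⟨ emb-ι d ⟩
      ι d ≡⟨ trans (sym (ι-% d)) (trans (cong ι (sym e)) (ι-% (x N.* x))) ⟩
      ι (x N.* x) ≡⟨ sym (emb-ι (x N.* x)) ⟩
      emb (F′.ι (x N.* x)) ≡⟨ cong emb (F′.ι-* x x) ⟩
      emb (F′.ι x F′.* F′.ι x) ∎)
    x≢0 : F′.ι x ≢ F′.0#
    x≢0 z = dᶠ≢0 (trans square (trans (cong (F′._* F′.ι x) z) (F′.zeroˡ _)))
  ... | inj₂ (none , l) = trans l (sym (nonresidue (CF.χ dᶠ) (CF.χ-sign dᶠ) refl))
    where
    module F′ = FieldTheory F
    no-roots : CF.roots dᶠ ≡ # 0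
    no-roots = ∑-ε F′.elems (λ y _ → ⟦⟧-no ((y F′.* y) F′.≟ dᶠ) (λ e →
      none (proj₁ (natural y)) (proj₁ (proj₂ (natural y))) (ι-≡⇒%-≡ _ d (begin
        ι (proj₁ (natural y) N.* proj₁ (natural y)) ≡⟨ ι-* (proj₁ (natural y)) (proj₁ (natural y)) ⟩
        ι (proj₁ (natural y)) * ι (proj₁ (natural y))
          ≡⟨ sym (cong₂ _*_ (proj₂ (proj₂ (natural y))) (proj₂ (proj₂ (natural y)))) ⟩
        emb y * emb y ≡⟨ sym (emb-* y y) ⟩
        emb (y F′.* y) ≡⟨ trans (cong emb e) (emb-ι d) ⟩
        ι d ∎))))
    nonresidue : ∀ s → Sign₀ s → CF.χ dᶠ ≡ s → CF.χ dᶠ ≡ -[1+ 0 ]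
    nonresidue _ neg e = e
    nonresidue _ nul e with trans (sym no-roots) (trans (CF.count-roots≡1+χ dᶠ) (cong (Z._+_ (# 1)) e))
    ... | ()
    nonresidue _ pos e with trans (sym no-roots) (trans (CF.count-roots≡1+χ dᶠ) (cong (Z._+_ (# 1)) e))
    ... | ()

  χ-dᶠ-sq : CF.χ dᶠ Z.* CF.χ dᶠ ≡ # 1
  χ-dᶠ-sq = trans (sym (CF.χ-* dᶠ dᶠ)) (CF.χ-sq dᶠ≢0)

  χ-even : ∀ i → CF.χ dᶠ Z.^ (2 N.* i) ≡ # 1
  χ-even i = trans (sym (ZP.^-*-assoc (CF.χ dᶠ) 2 i))
    (trans (cong (Z._^ i) (trans (cong (Z._*_ (CF.χ dᶠ)) (ZP.*-identityʳ (CF.χ dᶠ))) χ-dᶠ-sq)) (ZP.^-zeroˡ i))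

  odd : ∀ i → n ≡ 1 N.+ 2 N.* i →
        (# edwardsProjectiveCount K d ≡ # (p N.^ n) Z.+ # 1)
        × (# edwardsAffineCount K d ≡ # (p N.^ n) Z.- # 1 Z.- # 2 Z.* legendre p d)
  odd i n≡ = trans projective-count (trans (cong (Z._+_ (# (p N.^ n) Z.+ # 1)) S≡0) (ZP.+-identityʳ _))
    , trans affine-count (trans (cong₂ (λ x s → # (p N.^ n) Z.- # 1 Z.- # 2 Z.* x Z.+ s) χ≡ S≡0)
      (ZP.+-identityʳ _))
    where
    S≡0 : S ≡ # 0
    S≡0 = trans S≡∑cubic (∑-χ-odd i n≡)
    χ≡ : CK.χ (ι d) ≡ legendre p d
    χ≡ = trans χ-d (trans (cong (Z._^_ (CF.χ dᶠ)) n≡)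
      (trans (cong (Z._*_ (CF.χ dᶠ)) (χ-even i)) (trans (ZP.*-identityʳ (CF.χ dᶠ)) (sym legendre≡χ))))

  even : ∀ i → n ≡ 2 N.* i →
         (# edwardsAffineCount K d ≡ # (p N.^ n) Z.- # 3 Z.- # 2 Z.* (Z.- (# p)) Z.^ i)
         × (# edwardsProjectiveCount K d ≡ # (p N.^ n) Z.+ # 1 Z.- # 2 Z.* (Z.- (# p)) Z.^ i)
  even i n≡ = trans affine-count (trans (cong₂ (λ x s → # (p N.^ n) Z.- # 1 Z.- # 2 Z.* x Z.+ s) χ≡1 S≡W)
      (ZS.solve 2 (λ q x → q ⊖ ZS.con (# 1) ⊖ ZS.con (# 2) ⊗ ZS.con (# 1) ⊕ ⊝ ZS.con (# 2) ⊗ x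
        ⊜ q ⊖ ZS.con (# 3) ⊖ ZS.con (# 2) ⊗ x) refl (# (p N.^ n)) ((Z.- (# p)) Z.^ i)))
    , trans projective-count (trans (cong (Z._+_ (# (p N.^ n) Z.+ # 1)) S≡W)
      (ZS.solve 2 (λ q x → q ⊕ ZS.con (# 1) ⊕ ⊝ ZS.con (# 2) ⊗ x
        ⊜ q ⊕ ZS.con (# 1) ⊖ ZS.con (# 2) ⊗ x) refl (# (p N.^ n)) ((Z.- (# p)) Z.^ i)))
    where
    S≡W : S ≡ Z.- (# 2) Z.* (Z.- (# p)) Z.^ i
    S≡W = trans S≡∑cubic (∑-χ-even i n≡)
    χ≡1 : CK.χ (ι d) ≡ # 1
    χ≡1 = trans χ-d (trans (cong (Z._^_ (CF.χ dᶠ)) n≡) (χ-even i))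

-- The `n`-th power of `ι p` is `ι` of the field's order, which is 0, and a field has no nilpotents.
characteristic : ∀ p n (K : FiniteField (p N.^ n)) → FiniteField.ι K p ≡ FiniteField.0# K
characteristic p n K with FiniteField._≟_ K (FiniteField.ι K p) (FiniteField.0# K)
... | yes e = e
... | no ne = ⊥-elim (^-≢0 n ne (trans (sym (ι-^ n)) ι-q))
  where
  open FieldTheory K
  ι-^ : ∀ i → ι (p N.^ i) ≡ ι p ^ i
  ι-^ zero    = +-identityʳ 1#
  ι-^ (suc i) = trans (ι-* p (p N.^ i)) (cong (ι p *_) (ι-^ i))

open import Data.Nat using (ℕ; _≤_; _<_; _^_; _∸_; _/_)
open import Data.Nat.Divisibility using (_∣_)
open import Data.Nat.Primality using (Prime)
open import Data.Integer using (ℤ; +_; -_; _+_; _-_; _*_)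
open import Data.Product using (_×_)
open import Relation.Binary.PropositionalEquality using (_≡_; _≢_)

theorem3 : (p : ℕ) → Prime p → p ≢ 2 →
    (d : ℕ) → 2 ≤ d → d < p →
    p ∣ hasseSum ((p ∸ 1) / 2) d →
    (n : ℕ) → 1 ≤ n → (K : FiniteField (p ^ n)) →
    ((k : ℕ) → n ≡ N._+_ 1 (N._*_ 2 k) →
    (+ edwardsProjectiveCount K d ≡ + (p ^ n) + + 1)
    × (+ edwardsAffineCount K d ≡ + (p ^ n) - + 1 - + 2 * legendre p d))
    × ((k : ℕ) → n ≡ N._*_ 2 k →
    (+ edwardsAffineCount K d ≡ + (p ^ n) - + 3 - + 2 * (- (+ p)) Z.^ k)
    × (+ edwardsProjectiveCount K d ≡ + (p ^ n) + + 1 - + 2 * (- (+ p)) Z.^ k))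
theorem3 p pr p≢2 d 2≤d d<p p∣H n 1≤n K with odd-prime p pr p≢2
... | m , p≡ , half = M.odd , M.even
  where
  ι-p = characteristic p n K
  module M = Main p pr m p≡ d 2≤d d<p (subst (λ h → p ∣ hasseSum h d) half p∣H) n 1≤n K ι-p
    (Residues.primeSubfield K p pr ι-p)
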